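{- For $k=28,30$ and $b=0$, the quotient $H/P_{C_{k,0}}$ is isomorphic to $C_2^6$; for $k=29,31$ and $b=0$, it is isomorphic to $C_2^5$. In each of these four cases the projected target $\pi(C_{k,0})\subset H/P_{C_{k,0}}$ omits exactly one class $t$. Thus, for a signed integer $m$ prime to six, the condition $$\Bigl(c(m)+\sum_{q^e\parallel|m|}P_q(\min(e,26))\Bigr)\cap C_{k,0}\ne\varnothing$$ holds if and only if the projected baseline $\pi(c(m))$ differs from $t$, or some prime move (for some prime $q\mid m$) has nonzero projection under $\pi$ and cost at most $v_q(|m|)$.
   Context: $O=\mathbb Z[\omega]$, $\omega^2+\omega+1=0$, $\lambda=1-\omega$, $N(b+c\omega)=b^2-bc+c^2$, $\mu_6=O^\times$. $C_n$ is the cyclic group of order $n$. $W=(W_{hg})$ with $W_{hg}=(-1)^{h\cdot g}$, $h,g\in\mathbb F_2^3$. Finite quotient. $\Gamma=\prod_{h\in\mathbb F_2^3}\bigl((\mathbb Z/24\mathbb Z)^\times\times(O/8\lambda O)^\times\bigr)$, with elements $(a_h,\beta_h)_h$. $L\le\Gamma$ is the subgroup of residues with $a_h\equiv\beta_h\pmod\lambda$ for all $h$, $Wa\in8\mathbb Z^8$, $W\beta\in8O^8$. $E^+\le\Gamma$ consists of the images of $((\epsilon_h,\xi_h))_h$ with $\epsilon_h\in\{1,-1\}$, $\prod_h\epsilon_h=1$, $\xi_h\in\mu_6$. $H=\Gamma/(E^+L)$, written additively, with quotient map $\theta$. $\theta_{h,1}(v)$ (resp. $\theta_{h,3}(v)$)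 is the class of the tuple with $v$ in the rational (resp. $O$-) component at $h$ and every other component one. Classes at two. For $e\in\mathbb Z_{>0}^8$, $R_e$ is the set of classes $\theta((u_h,\gamma_h)_h)$ with $u_h\in\{1,7,13,19\}$, $\gamma_h=17^{e_h\bmod2}$, $W(2^{e_h}u_h)_h\in8\mathbb Z^8$. For $f\in\mathbb Z_{>0}^8$, $Q_f$ is the set of classes with $u_h=1$, $\gamma_h\in(O/8\lambda O)^\times$, $\gamma_h\equiv2^{f_h}\pmod\lambda$, $W(2^{f_h}\gamma_h)_h\in8O^8$. $R_0=Q_0=\{0\}$; for $a,r>0$, $R_a=\bigcup_{\sum e_h=a}R_e$, $Q_r=\bigcup_{\sum f_h=r}Q_f$. Put $$C_{k,0}=\bigcup_{a+2r=k}(R_a+Q_r),\qquad a\in\{0,8\}\cup\mathbb Z_{\ge12},\quad r\in\{0,8\}\cup\mathbb Z_{\ge10}.$$ Stabilizer. For $B\subseteq H$, $P_B=\{g\in H:B+g=B\}$; $\pi:H\to H/P_B$ is the projection, here with $B=C_{k,0}$. Prime moves. $c(m)=\theta_{0,1}(m)$ for signed $m$ prime to $6$. For a prime $q>3$ the moves are $\theta_{h,1}(q)-\theta_{0,1}(q)$ for $h\neq0$, of cost $1$; and $\theta_{h,3}(\pi_{\mathfrak q})-f_{\mathfrak q}\theta_{0,1}(q)$ for each $h\in\mathbb F_2^3$ and each prime ideal $\mathfrak q\mid q$ of $O$ with generator $\pi_{\mathfrak q}$, $N(\pi_{\mathfrak q})=q^{f_{\mathfrak q}}$, of cost $f_{\mathfrak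 q}$. $P_q(e)$ is the set of sums of finite sequences of moves at $q$ (repetition allowed, including the empty sum) of total cost at most $e$. Sums over $q^e\parallel|m|$ are sumsets over the primes dividing $m$, with empty sum $\{0\}$. -}

module Defs where

open import Level using (0ℓ)
open import Algebra.Bundles using (CommutativeMonoid; AbelianGroup; CommutativeRing; Semiring)
open import Algebra.Core using (Op₂)
open import Algebra.Morphism.Structures using (module GroupMorphisms)
open import Data.Bool.Base using (Bool; true; false; if_then_else_; not; _∧_; _xor_)
import Data.Bool.Properties as Bool
open import Data.Empty using (⊥-elim)
open import Data.Fin.Base using (Fin; toℕ; fromℕ<)
open import Data.Fin.Properties using (all?; toℕ-fromℕ<)
import Data.Integer.Base as Int
open import Data.Integer.Base using (ℤ; +_; 0ℤ; 1ℤ; -1ℤ)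
open import Data.Integer.Coprimality using (Coprime)
open import Data.Integer.DivMod using (_%ℕ_; _/ℕ_; n%ℕd<d; a≡a%ℕn+[a/ℕn]*n)
import Data.Integer.Divisibility.Signed as Signed
import Data.Integer.Properties as ℤₚ
import Data.Integer.Tactic.RingSolver as ℤ-Solver
open import Data.List.Base as List using (List; []; _∷_; foldr; filter; upTo)
open import Data.List.Relation.Unary.Any using (Any)
open import Data.Nat.Base as ℕ using (ℕ; zero; suc; _≤_; _<_; _⊓_)
import Data.Nat.Coprimality as ℕ-Coprimality
open import Data.Nat.ListAction using (sum)
import Data.Nat.Properties as ℕₚ
open import Data.Nat.Divisibility as ℕ∣ using (_∣_; _∤_; _∣?_)
open import Data.Nat.DivMod using (_%_; _/_; m≡m%n+[m/n]*n)
open import Data.Nat.GCD using (gcd)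
open import Data.Nat.Primality using (Prime; prime?; prime⇒irreducible; euclidsLemma)
open import Data.Parity.Properties using () renaming (+-0-abelianGroup to C₂)
open import Data.Product.Base using (∃; ∃-syntax; Σ-syntax; _×_; _,_; proj₁; proj₂)
open import Data.Sum.Base using (_⊎_; inj₁; inj₂)
open import Data.Unit.Base using (⊤; tt)
open import Data.Vec.Base as Vec using (Vec; []; _∷_; replicate; zipWith; foldr′)
import Data.Vec.Properties as Vecₚ
open import Function.Base using (_∘_)
open import Relation.Binary.Definitions using (_Respects_)
open import Relation.Binary.PropositionalEquality as ≡ using (_≡_; _≢_; cong; cong₂)
open import Relation.Nullary.Decidable using (⌊_⌋; _×-dec_; _→-dec_; toWitness)
open import Relation.Nullary.Negation using (¬_)
open import Relation.Unary using (Pred; _≐_; _∩_; Satisfiable)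

import Algebra.Construct.DirectProduct as DirectProduct
import Algebra.Construct.Pointwise as Pointwise
import Algebra.Definitions.RawMagma as RawMagmaDefinitions
import Algebra.Definitions.RawMonoid as RawMonoidDefinitions
import Algebra.Definitions.RawSemiring as RawSemiringDefinitions
import Algebra.Properties.AbelianGroup as AbelianGroupProperties
import Algebra.Properties.CommutativeSemigroup as CommutativeSemigroupProperties
import Algebra.Properties.Ring as RingProperties
import Algebra.Solver.Ring.NaturalCoefficients.Default as SemiringSolver
import Relation.Binary.Reasoning.Setoid as SetoidReasoning

Group₀ : Set₁
Group₀ = AbelianGroup 0ℓ 0ℓ

-- A quotient keeps the carrier and coarsens the equality, so a set of
-- classes is a predicate on representatives that respects the equality.

record Subgroup (G : Group₀) : Set₁ where
  open AbelianGroup G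
  field
    Member      : Pred Carrier 0ℓ
    resp        : Member Respects _≈_
    ε-closed    : Member ε
    ∙-closed    : ∀ {x y} → Member x → Member y → Member (x ∙ y)
    ⁻¹-closed   : ∀ {x} → Member x → Member (x ⁻¹)

open Subgroup using (Member)

module _ (G : Group₀) where
  open AbelianGroup G
  open AbelianGroupProperties G
  open CommutativeSemigroupProperties commutativeSemigroup using (interchange)
  private module ≈-R = SetoidReasoning setoid

  _·ˢ_ : Subgroup G → Subgroup G → Subgroup G
  A ·ˢ B = record
    { Member    = λ x → ∃[ a ] ∃[ b ] Member A a × Member B b × x ≈ a ∙ b
    ; resp      = λ { x≈y (a , b , a∈ , b∈ , e) → a , b , a∈ , b∈ , trans (sym x≈y) e }
    ; ε-closed  = ε , ε , A.ε-closed , B.ε-closed , sym (identityˡ ε)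
    ; ∙-closed  = λ { (a , b , a∈ , b∈ , e) (a′ , b′ , a′∈ , b′∈ , e′) →
                    a ∙ a′ , b ∙ b′ , A.∙-closed a∈ a′∈ , B.∙-closed b∈ b′∈
                    , trans (∙-cong e e′) (interchange a b a′ b′) }
    ; ⁻¹-closed = λ { (a , b , a∈ , b∈ , e) →
                    a ⁻¹ , b ⁻¹ , A.⁻¹-closed a∈ , B.⁻¹-closed b∈
                    , trans (⁻¹-cong e) (sym (⁻¹-∙-comm a b)) }
    }
    where
    module A = Subgroup A
    module B = Subgroup B

  record Cong (N : Subgroup G) (x y : Carrier) : Set where
    constructor coset
    field
      difference∈ : Member N (x ∙ y ⁻¹)

  _/ˢ_ : Subgroup G → Group₀
  _/ˢ_ N = record
    { Carrier = Carrier
    ; _≈_     = Cong N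
    ; _∙_     = _∙_
    ; ε       = ε
    ; _⁻¹     = _⁻¹
    ; isAbelianGroup = record
      { isGroup = record
        { isMonoid = record
          { isSemigroup = record
            { isMagma = record
              { isEquivalence = record
                { refl  = λ {x} → ≈⇒~ refl
                ; sym   = λ {x} {y} (coset p) → coset (N.resp (⁻¹-anti-homo‿- x y) (N.⁻¹-closed p))
                ; trans = λ {x} {y} {z} (coset p) (coset q) → coset (N.resp (telescope x y z) (N.∙-closed p q))
                }
              ; ∙-cong = λ {x} {y} {u} {v} (coset p) (coset q) → coset (N.resp (split x y u v) (N.∙-closed p q))
              }
            ; assoc = λ x y z → ≈⇒~ (assoc x y z)
            }
          ; identity = (λ x → ≈⇒~ (identityˡ x)) , (λ x → ≈⇒~ (identityʳ x))
          }
        ; inverse = (λ x → ≈⇒~ (inverseˡ x)) , (λ x → ≈⇒~ (inverseʳ x))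
        ; ⁻¹-cong = λ {x} {y} (coset p) → coset (N.resp (sym (⁻¹-∙-comm x (y ⁻¹))) (N.⁻¹-closed p))
        }
      ; comm = λ x y → ≈⇒~ (comm x y)
      }
    }
    where
    module N = Subgroup N
    open ≈-R

    ≈⇒~ : ∀ {x y} → x ≈ y → Cong N x y
    ≈⇒~ {x} {y} e = coset (N.resp (sym (x≈y⇒x∙y⁻¹≈ε e)) N.ε-closed)

    telescope : ∀ x y z → (x ∙ y ⁻¹) ∙ (y ∙ z ⁻¹) ≈ x ∙ z ⁻¹
    telescope x y z = begin
      (x ∙ y ⁻¹) ∙ (y ∙ z ⁻¹)  ≈⟨ assoc x (y ⁻¹) (y ∙ z ⁻¹) ⟩
      x ∙ (y ⁻¹ ∙ (y ∙ z ⁻¹))  ≈⟨ ∙-congˡ (assoc (y ⁻¹) y (z ⁻¹)) ⟨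
      x ∙ ((y ⁻¹ ∙ y) ∙ z ⁻¹)  ≈⟨ ∙-congˡ (∙-congʳ (inverseˡ y)) ⟩
      x ∙ (ε ∙ z ⁻¹)           ≈⟨ ∙-congˡ (identityˡ (z ⁻¹)) ⟩
      x ∙ z ⁻¹                 ∎

    split : ∀ x y u v → (x ∙ y ⁻¹) ∙ (u ∙ v ⁻¹) ≈ (x ∙ u) ∙ (y ∙ v) ⁻¹
    split x y u v = trans (interchange x (y ⁻¹) u (v ⁻¹)) (∙-congˡ (⁻¹-∙-comm y v))

  translate : Pred Carrier 0ℓ → Carrier → Pred Carrier 0ℓ
  translate B g x = ∃[ b ] B b × x ≈ b ∙ g

  sumset : Pred Carrier 0ℓ → Pred Carrier 0ℓ → Pred Carrier 0ℓ
  sumset A B x = ∃[ a ] ∃[ b ] A a × B b × x ≈ a ∙ b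

  stabilizer : (B : Pred Carrier 0ℓ) → B Respects _≈_ → Subgroup G
  stabilizer B B-resp = record
    { Member    = λ g → translate B g ≐ B
    ; resp      = λ { g≈h (to , from) →
                      (λ { (b , b∈ , e) → to (b , b∈ , trans e (∙-congˡ (sym g≈h))) })
                    , (λ x∈ → let b , b∈ , e = from x∈ in b , b∈ , trans e (∙-congˡ g≈h)) }
    ; ε-closed  = (λ { (b , b∈ , e) → B-resp (sym (trans e (identityʳ b))) b∈ })
                , (λ {x} x∈ → x , x∈ , sym (identityʳ x))
    ; ∙-closed  = λ {g} {h} → λ { (to , from) (to′ , from′) →
                      (λ { (b , b∈ , e) →
                             to′ (b ∙ g , to (b , b∈ , refl) , trans e (sym (assoc b g h))) })
                    , (λ x∈ → let b  , b∈  , e  = from′ x∈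
                                  b′ , b′∈ , e′ = from b∈
                              in b′ , b′∈ , trans e (trans (∙-congʳ e′) (assoc b′ g h))) }
    ; ⁻¹-closed = λ {g} → λ { (to , from) →
                      (λ { (b , b∈ , e) → let b′ , b′∈ , e′ = from b∈ in
                             B-resp (sym (trans e (trans (∙-congʳ e′) (//-rightDividesʳ g b′)))) b′∈ })
                    , (λ {x} x∈ → x ∙ g , to (x , x∈ , refl) , sym (//-rightDividesʳ g x)) }
    }

_≅_ : Group₀ → Group₀ → Set
G ≅ G′ = ∃ λ f → IsGroupIsomorphism f
  where open GroupMorphisms (AbelianGroup.rawGroup G) (AbelianGroup.rawGroup G′)

C₂^_ : ℕ → Group₀
C₂^ n = Pointwise.abelianGroup (Fin n) C₂

-- The inverse is carried along, but equality only looks at the value.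

record Unit (M : CommutativeMonoid 0ℓ 0ℓ) : Set where
  open CommutativeMonoid M
  field
    val      : Carrier
    inv      : Carrier
    val∙inv  : val ∙ inv ≈ ε

open Unit using (val; inv; val∙inv)

unitGroup : CommutativeMonoid 0ℓ 0ℓ → Group₀
unitGroup M = record
  { Carrier = Unit M
  ; _≈_     = λ x y → val x ≈ val y
  ; _∙_     = λ x y → record
    { val     = val x ∙ val y
    ; inv     = inv x ∙ inv y
    ; val∙inv = trans (interchange (val x) (val y) (inv x) (inv y))
                      (trans (∙-cong (val∙inv x) (val∙inv y)) (identityˡ ε))
    }
  ; ε   = record { val = ε ; inv = ε ; val∙inv = identityˡ ε }
  ; _⁻¹ = λ x → record { val = inv x ; inv = val x ; val∙inv = inverseˡ x }
  ; isAbelianGroup = record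
    { isGroup = record
      { isMonoid = record
        { isSemigroup = record
          { isMagma = record
            { isEquivalence = record { refl = refl ; sym = sym ; trans = trans }
            ; ∙-cong        = ∙-cong
            }
          ; assoc = λ x y z → assoc (val x) (val y) (val z)
          }
        ; identity = (λ x → identityˡ (val x)) , (λ x → identityʳ (val x))
        }
      ; inverse = inverseˡ , val∙inv
      ; ⁻¹-cong = λ {x} {y} → inv-cong x y
      }
    ; comm = λ x y → comm (val x) (val y)
    }
  }
  where
  open CommutativeMonoid M
  open CommutativeSemigroupProperties commutativeSemigroup using (interchange)
  open SetoidReasoning setoid

  inverseˡ : ∀ (x : Unit M) → inv x ∙ val x ≈ ε
  inverseˡ x = trans (comm (inv x) (val x)) (val∙inv x)

  inv-cong : ∀ (x y : Unit M) → val x ≈ val y → inv x ≈ inv y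
  inv-cong x y e = begin
    inv x                    ≈⟨ identityʳ (inv x) ⟨
    inv x ∙ ε                ≈⟨ ∙-congˡ (val∙inv y) ⟨
    inv x ∙ (val y ∙ inv y)  ≈⟨ assoc (inv x) (val y) (inv y) ⟨
    (inv x ∙ val y) ∙ inv y  ≈⟨ ∙-congʳ (∙-congˡ e) ⟨
    (inv x ∙ val x) ∙ inv y  ≈⟨ ∙-congʳ (inverseˡ x) ⟩
    ε ∙ inv y                ≈⟨ identityˡ (inv y) ⟩
    inv y                    ∎

module Congruence (R : CommutativeRing 0ℓ 0ℓ) where
  open CommutativeRing R
  open RawSemiringDefinitions (Semiring.rawSemiring semiring) using () renaming (_∣_ to _∣ᴿ_) public
  open RingProperties ring using (xyx⁻¹≈y; //-rightDividesˡ; //-rightDividesʳ; -‿distribˡ-*)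
  private
    module S = SemiringSolver commutativeSemiring
  open SetoidReasoning setoid

  record _≡_mod_ (x y n : Carrier) : Set where
    constructor congruent
    field
      modulus∣difference : n ∣ᴿ (x - y)

  mod-intro : ∀ {x y n} k → x ≈ y + k * n → x ≡ y mod n
  mod-intro {x} {y} {n} k e = congruent record { quotient = k ; equality = sym (begin
    x - y            ≈⟨ +-congʳ e ⟩
    y + k * n - y    ≈⟨ xyx⁻¹≈y y (k * n) ⟩
    k * n            ∎) }

  mod-elim : ∀ {x y n} → x ≡ y mod n → ∃[ k ] x ≈ y + k * n
  mod-elim {x} {y} {n} (congruent record { quotient = k ; equality = e }) = k , (begin
    x                ≈⟨ //-rightDividesˡ y x ⟨
    x - y + y        ≈⟨ +-congʳ e ⟨
    k * n + y        ≈⟨ +-comm (k * n) y ⟩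
    y + k * n        ∎)

  module _ (n : Carrier) where

    mod-refl : ∀ {x y} → x ≈ y → x ≡ y mod n
    mod-refl {x} {y} e = mod-intro 0# (trans e
      (sym (trans (+-congˡ (zeroˡ n)) (+-identityʳ y))))

    mod-sym : ∀ {x y} → x ≡ y mod n → y ≡ x mod n
    mod-sym {x} {y} p with mod-elim p
    ... | k , e = mod-intro (- k) (begin
      y                        ≈⟨ //-rightDividesʳ (k * n) y ⟨
      y + k * n + - (k * n)    ≈⟨ +-cong (sym e) (-‿distribˡ-* k n) ⟩
      x + - k * n              ∎)

    mod-trans : ∀ {x y z} → x ≡ y mod n → y ≡ z mod n → x ≡ z mod n
    mod-trans {x} {y} {z} p q with mod-elim p | mod-elim q
    ... | k , e | l , f = mod-intro (l + k) (begin
      x                    ≈⟨ e ⟩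
      y + k * n            ≈⟨ +-congʳ f ⟩
      z + l * n + k * n    ≈⟨ S.solve 4 (λ z l k n → z S.:+ l S.:* n S.:+ k S.:* n
                                S.:= z S.:+ (l S.:+ k) S.:* n) refl z l k n ⟩
      z + (l + k) * n      ∎)

    mod-*-cong : ∀ {x y u v} → x ≡ y mod n → u ≡ v mod n → (x * u) ≡ (y * v) mod n
    mod-*-cong {x} {y} {u} {v} p q with mod-elim p | mod-elim q
    ... | k , e | l , f = mod-intro (y * l + k * v + k * l * n) (begin
      x * u                                    ≈⟨ *-cong e f ⟩
      (y + k * n) * (v + l * n)                ≈⟨ S.solve 5 (λ y v k l n →
        (y S.:+ k S.:* n) S.:* (v S.:+ l S.:* n) S.:=
        y S.:* v S.:+ (y S.:* l S.:+ k S.:* v S.:+ k S.:* l S.:* n) S.:* n) refl y v k l n ⟩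
      y * v + (y * l + k * v + k * l * n) * n  ∎)

    mod-∣ : ∀ {m x y} → m ∣ᴿ n → x ≡ y mod n → x ≡ y mod m
    mod-∣ {m} {x} {y} record { quotient = c ; equality = f } p with mod-elim p
    ... | k , e = mod-intro (k * c) (begin
      x                ≈⟨ e ⟩
      y + k * n        ≈⟨ +-congˡ (*-congˡ f) ⟨
      y + k * (c * m)  ≈⟨ +-congˡ (*-assoc k c m) ⟨
      y + k * c * m    ∎)

    mod-*-commutativeMonoid : CommutativeMonoid 0ℓ 0ℓ
    mod-*-commutativeMonoid = record
      { Carrier = Carrier
      ; _≈_     = λ x y → x ≡ y mod n
      ; _∙_     = _*_
      ; ε       = 1#
      ; isCommutativeMonoid = record
        { isMonoid = record
          { isSemigroup = record
            { isMagma = record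
              { isEquivalence = record
                { refl = mod-refl refl ; sym = mod-sym ; trans = mod-trans }
              ; ∙-cong = mod-*-cong
              }
            ; assoc = λ x y z → mod-refl (*-assoc x y z)
            }
          ; identity = (λ x → mod-refl (*-identityˡ x)) , (λ x → mod-refl (*-identityʳ x))
          }
        ; comm = λ x y → mod-refl (*-comm x y)
        }
      }

    -- (R / nR)^×
    modUnits : Group₀
    modUnits = unitGroup mod-*-commutativeMonoid

ℤ-ring : CommutativeRing 0ℓ 0ℓ
ℤ-ring = ℤₚ.+-*-commutativeRing

infixl 6 _+_ω

record O : Set where
  constructor _+_ω
  field
    re : ℤ
    im : ℤ

fromℤ : ℤ → O
fromℤ a = a + 0ℤ ω

-- uses ω² = - 1 - ω
_*ᴼ_ : Op₂ O
(b + c ω) *ᴼ (b′ + c′ ω) =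
  (b Int.* b′ Int.- c Int.* c′) + (b Int.* c′ Int.+ c Int.* b′ Int.- c Int.* c′) ω

_+ᴼ_ : Op₂ O
(b + c ω) +ᴼ (b′ + c′ ω) = (b Int.+ b′) + (c Int.+ c′) ω

-ᴼ_ : O → O
-ᴼ (b + c ω) = (Int.- b) + (Int.- c) ω

O-ring : CommutativeRing 0ℓ 0ℓ
O-ring = record
  { Carrier = O
  ; _≈_     = _≡_
  ; _+_     = _+ᴼ_
  ; _*_     = _*ᴼ_
  ; -_      = -ᴼ_
  ; 0#      = fromℤ 0ℤ
  ; 1#      = fromℤ 1ℤ
  ; isCommutativeRing = record
    { isRing = record
      { +-isAbelianGroup = record
        { isGroup = record
          { isMonoid = record
            { isSemigroup = record
              { isMagma = record { isEquivalence = ≡.isEquivalence ; ∙-cong = cong₂ _+ᴼ_ }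
              ; assoc   = λ { (a + b ω) (c + d ω) (e + f ω) →
                  cong₂ _+_ω (ℤₚ.+-assoc a c e) (ℤₚ.+-assoc b d f) }
              }
            ; identity = (λ { (a + b ω) → cong₂ _+_ω (ℤₚ.+-identityˡ a) (ℤₚ.+-identityˡ b) })
                       , (λ { (a + b ω) → cong₂ _+_ω (ℤₚ.+-identityʳ a) (ℤₚ.+-identityʳ b) })
            }
          ; inverse = (λ { (a + b ω) → cong₂ _+_ω (ℤₚ.+-inverseˡ a) (ℤₚ.+-inverseˡ b) })
                    , (λ { (a + b ω) → cong₂ _+_ω (ℤₚ.+-inverseʳ a) (ℤₚ.+-inverseʳ b) })
          ; ⁻¹-cong = cong -ᴼ_
          }
        ; comm = λ { (a + b ω) (c + d ω) → cong₂ _+_ω (ℤₚ.+-comm a c) (ℤₚ.+-comm b d) }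
        }
      ; *-cong     = cong₂ _*ᴼ_
      ; *-assoc    = λ { (a + b ω) (c + d ω) (e + f ω) →
          cong₂ _+_ω (assoc₁ a b c d e f) (assoc₂ a b c d e f) }
      ; *-identity = (λ { (a + b ω) → cong₂ _+_ω (idˡ₁ a b) (idˡ₂ a b) })
                   , (λ { (a + b ω) → cong₂ _+_ω (idʳ₁ a b) (idʳ₂ a b) })
      ; distrib    = (λ { (a + b ω) (c + d ω) (e + f ω) →
                        cong₂ _+_ω (distˡ₁ a b c d e f) (distˡ₂ a b c d e f) })
                   , (λ { (a + b ω) (c + d ω) (e + f ω) →
                        cong₂ _+_ω (distʳ₁ a b c d e f) (distʳ₂ a b c d e f) })
      }
    ; *-comm = λ { (a + b ω) (c + d ω) → cong₂ _+_ω (comm₁ a b c d) (comm₂ a b c d) }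
    }
  }
  where
  open Int using (_+_; _*_; _-_)

  assoc₁ : ∀ a b c d e f → (a * c - b * d) * e - (a * d + b * c - b * d) * f
         ≡ a * (c * e - d * f) - b * (c * f + d * e - d * f)
  assoc₁ = ℤ-Solver.solve-∀

  assoc₂ : ∀ a b c d e f →
           (a * c - b * d) * f + (a * d + b * c - b * d) * e - (a * d + b * c - b * d) * f
         ≡ a * (c * f + d * e - d * f) + b * (c * e - d * f) - b * (c * f + d * e - d * f)
  assoc₂ = ℤ-Solver.solve-∀

  idˡ₁ : ∀ a b → + 1 * a - + 0 * b ≡ a
  idˡ₁ = ℤ-Solver.solve-∀

  idˡ₂ : ∀ a b → + 1 * b + + 0 * a - + 0 * b ≡ b
  idˡ₂ = ℤ-Solver.solve-∀

  idʳ₁ : ∀ a b → a * + 1 - b * + 0 ≡ a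
  idʳ₁ = ℤ-Solver.solve-∀

  idʳ₂ : ∀ a b → a * + 0 + b * + 1 - b * + 0 ≡ b
  idʳ₂ = ℤ-Solver.solve-∀

  distˡ₁ : ∀ a b c d e f → a * (c + e) - b * (d + f) ≡ (a * c - b * d) + (a * e - b * f)
  distˡ₁ = ℤ-Solver.solve-∀

  distˡ₂ : ∀ a b c d e f → a * (d + f) + b * (c + e) - b * (d + f)
         ≡ (a * d + b * c - b * d) + (a * f + b * e - b * f)
  distˡ₂ = ℤ-Solver.solve-∀

  distʳ₁ : ∀ a b c d e f → (c + e) * a - (d + f) * b ≡ (c * a - d * b) + (e * a - f * b)
  distʳ₁ = ℤ-Solver.solve-∀

  distʳ₂ : ∀ a b c d e f → (c + e) * b + (d + f) * a - (d + f) * b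
         ≡ (c * b + d * a - d * b) + (e * b + f * a - f * b)
  distʳ₂ = ℤ-Solver.solve-∀

  comm₁ : ∀ a b c d → a * c - b * d ≡ c * a - d * b
  comm₁ = ℤ-Solver.solve-∀

  comm₂ : ∀ a b c d → a * d + b * c - b * d ≡ c * b + d * a - d * b
  comm₂ = ℤ-Solver.solve-∀

module ℤᴿ = Congruence ℤ-ring
module Oᴿ = Congruence O-ring

λᴼ : O
λᴼ = 1ℤ + -1ℤ ω

8λ : O
8λ = fromℤ (+ 8) *ᴼ λᴼ

N : O → ℤ
N (b + c ω) = b Int.* b Int.- b Int.* c Int.+ c Int.* c

μ₆ : Group₀
μ₆ = unitGroup (CommutativeRing.*-commutativeMonoid O-ring)

⟨_⟩ : O → Pred O 0ℓ
⟨ ϖ ⟩ x = ϖ Oᴿ.∣ᴿ x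

record IsPrimeIdeal (I : Pred O 0ℓ) : Set where
  field
    0∈       : I (fromℤ 0ℤ)
    +-closed : ∀ {x y} → I x → I y → I (x +ᴼ y)
    *-absorb : ∀ x {y} → I y → I (x *ᴼ y)
    1∉       : ¬ I (fromℤ 1ℤ)
    split    : ∀ {x y} → I (x *ᴼ y) → I x ⊎ I y

foldCube : ∀ {A : Set} → Op₂ A → ∀ {n} → (Vec Bool n → A) → A
foldCube _∙_ {zero}  f = f []
foldCube _∙_ {suc n} f = foldCube _∙_ (f ∘ (false ∷_)) ∙ foldCube _∙_ (f ∘ (true ∷_))

dot : ∀ {n} → Vec Bool n → Vec Bool n → Bool
dot h g = foldr′ _xor_ false (zipWith _∧_ h g)

module Hadamard (R : CommutativeRing 0ℓ 0ℓ) where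
  open CommutativeRing R
  open Congruence R

  W : ∀ {n} → Vec Bool n → Vec Bool n → Carrier
  W h g = if dot h g then - 1# else 1#

  transform : ∀ {n} → (Vec Bool n → Carrier) → Vec Bool n → Carrier
  transform a h = foldCube _+_ (λ g → W h g * a g)

  -- W a ∈ d R^(2ⁿ)
  record TransformDivisible (d : Carrier) {n} (a : Vec Bool n → Carrier) : Set where
    constructor divisible
    field
      divides : ∀ h → d ∣ᴿ transform a h

Cancellable₂ : CommutativeRing 0ℓ 0ℓ → Set
Cancellable₂ R = ∀ x y → x + x ≈ y + y → x ≈ y
  where open CommutativeRing R

-- If R has no 2-torsion, the vectors a with W a ∈ 2ⁿ R^(2ⁿ) are closed
-- under pointwise products and under inverses modulo 2ⁿ.

module HadamardClosure
  (R : CommutativeRing 0ℓ 0ℓ)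
  (cancel₂ : Cancellable₂ R)
  where

  open CommutativeRing R
  open Congruence R
  open Hadamard R
  open RingProperties ring
    using (-‿distribˡ-*; -‿distribʳ-*; -‿+-comm; -‿involutive; -1*x≈-x; xyx⁻¹≈y
          ; //-rightDividesˡ; //-rightDividesʳ)
  open SetoidReasoning setoid
  open CommutativeSemigroupProperties +-commutativeSemigroup using (interchange)
  private
    module S = SemiringSolver commutativeSemiring

  pow₂ : ℕ → Carrier
  pow₂ zero    = 1#
  pow₂ (suc n) = (1# + 1#) * pow₂ n

  private
    Fun : ℕ → Set
    Fun n = Vec Bool n → Carrier

    _₀ _₁ : ∀ {n} → Fun (suc n) → Fun n
    a ₀ = a ∘ (false ∷_)
    a ₁ = a ∘ (true ∷_)

    T-cong : ∀ {n} {F G : Fun n} → (∀ g → F g ≈ G g) → foldCube _+_ F ≈ foldCube _+_ G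
    T-cong {zero}  e = e []
    T-cong {suc n} e = +-cong (T-cong (e ∘ (false ∷_))) (T-cong (e ∘ (true ∷_)))

    T-neg : ∀ {n} (F : Fun n) → foldCube _+_ (λ g → - F g) ≈ - foldCube _+_ F
    T-neg {zero}  F = refl
    T-neg {suc n} F = trans (+-cong (T-neg (F ₀)) (T-neg (F ₁)))
                            (-‿+-comm (foldCube _+_ (F ₀)) (foldCube _+_ (F ₁)))

    T-add : ∀ {n} (F G : Fun n) →
            foldCube _+_ (λ g → F g + G g) ≈ foldCube _+_ F + foldCube _+_ G
    T-add {zero}  F G = refl
    T-add {suc n} F G = trans (+-cong (T-add (F ₀) (G ₀)) (T-add (F ₁) (G ₁)))
      (interchange (foldCube _+_ (F ₀)) (foldCube _+_ (G ₀))
                   (foldCube _+_ (F ₁)) (foldCube _+_ (G ₁)))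

    transform-cong : ∀ {n} {a b : Fun n} → (∀ g → a g ≈ b g) →
                     ∀ h → transform a h ≈ transform b h
    transform-cong e h = T-cong (λ g → *-congˡ (e g))

    transform-add : ∀ {n} (a b : Fun n) h →
                    transform (λ g → a g + b g) h ≈ transform a h + transform b h
    transform-add a b h = trans (T-cong (λ g → distribˡ (W h g) (a g) (b g)))
      (T-add (λ g → W h g * a g) (λ g → W h g * b g))

    sign-not : ∀ b x → (if not b then - 1# else 1#) * x ≈ - ((if b then - 1# else 1#) * x)
    sign-not false x = sym (-‿distribˡ-* 1# x)
    sign-not true  x = begin
      1# * x             ≈⟨ *-identityˡ x ⟩
      x                  ≈⟨ -‿involutive x ⟨
      - - x              ≈⟨ -‿cong (-1*x≈-x x) ⟨
      - (- 1# * x)       ∎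

    transform-true : ∀ {n} (a : Fun (suc n)) h →
                     transform a (true ∷ h) ≈ transform (a ₀) h - transform (a ₁) h
    transform-true a h = +-congˡ (trans
      (T-cong (λ g → sign-not (dot h g) (a (true ∷ g))))
      (T-neg (λ g → W h g * a (true ∷ g))))

  -- A subtraction-free recursive form of the divisibility.
  Good : ∀ {n} → Fun n → Set
  Good {zero}  a = ⊤
  Good {suc n} a = Good (a ₀) × Good (a ₁) ×
    (∃[ d ] Good d × (∀ h → (a ₀) h ≈ (a ₁) h + (d h + d h)))

  private
    Good-resp : ∀ {n} {a b : Fun n} → (∀ h → a h ≈ b h) → Good a → Good b
    Good-resp {zero}  e _ = tt
    Good-resp {suc n} e (p₀ , p₁ , d , pd , q) =
      Good-resp (e ∘ (false ∷_)) p₀ , Good-resp (e ∘ (true ∷_)) p₁ , d , pd ,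
      λ h → trans (sym (e (false ∷ h))) (trans (q h) (+-congʳ (e (true ∷ h))))

    Good-const : ∀ {n} x → Good {n} (λ _ → x)
    Good-const {zero}  x = tt
    Good-const {suc n} x = Good-const x , Good-const x , (λ _ → 0#) , Good-const 0# ,
      λ _ → sym (trans (+-congˡ (+-identityˡ 0#)) (+-identityʳ x))

    Good-+ : ∀ {n} {a b : Fun n} → Good a → Good b → Good (λ h → a h + b h)
    Good-+ {zero}  _ _ = tt
    Good-+ {suc n} {a} {b} (p₀ , p₁ , d , pd , q) (p₀′ , p₁′ , d′ , pd′ , q′) =
      Good-+ p₀ p₀′ , Good-+ p₁ p₁′ , (λ h → d h + d′ h) , Good-+ pd pd′ ,
      λ h → trans (+-cong (q h) (q′ h)) (S.solve 4 (λ x d x′ d′ →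
        (x S.:+ (d S.:+ d)) S.:+ (x′ S.:+ (d′ S.:+ d′)) S.:=
        (x S.:+ x′) S.:+ ((d S.:+ d′) S.:+ (d S.:+ d′)))
        refl ((a ₁) h) (d h) ((b ₁) h) (d′ h))

    Good-* : ∀ {n} {a b : Fun n} → Good a → Good b → Good (λ h → a h * b h)
    Good-* {zero}  _ _ = tt
    Good-* {suc n} {a} {b} (p₀ , p₁ , d , pd , q) (p₀′ , p₁′ , d′ , pd′ , q′) =
      Good-* p₀ p₀′ , Good-* p₁ p₁′ ,
      (λ h → (a ₁) h * d′ h + d h * (b ₀) h) , Good-+ (Good-* p₁ pd′) (Good-* pd p₀′) ,
      λ h → begin
        (a ₀) h * (b ₀) h                          ≈⟨ *-congʳ (q h) ⟩
        ((a ₁) h + (d h + d h)) * (b ₀) h          ≈⟨ distribʳ ((b ₀) h) ((a ₁) h) (d h + d h) ⟩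
        (a ₁) h * (b ₀) h + (d h + d h) * (b ₀) h  ≈⟨ +-congʳ (*-congˡ (q′ h)) ⟩
        (a ₁) h * ((b ₁) h + (d′ h + d′ h)) + (d h + d h) * (b ₀) h
          ≈⟨ S.solve 5 (λ x y d d′ z →
               x S.:* (y S.:+ (d′ S.:+ d′)) S.:+ (d S.:+ d) S.:* z S.:=
               x S.:* y S.:+ ((x S.:* d′ S.:+ d S.:* z) S.:+ (x S.:* d′ S.:+ d S.:* z)))
               refl ((a ₁) h) ((b ₁) h) (d h) (d′ h) ((b ₀) h) ⟩
        (a ₁) h * (b ₁) h +
          (((a ₁) h * d′ h + d h * (b ₀) h) + ((a ₁) h * d′ h + d h * (b ₀) h)) ∎

    Good-neg : ∀ {n} {a : Fun n} → Good a → Good (λ h → - a h)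
    Good-neg p = Good-resp (λ h → -1*x≈-x _) (Good-* (Good-const (- 1#)) p)

    -- x - y, with the subtraction isolated
    difference : ∀ x y → x ≈ y + (x - y)
    difference x y = sym (trans (sym (+-assoc y x (- y))) (xyx⁻¹≈y y x))

    double : ∀ n x → pow₂ (suc n) * x ≈ pow₂ n * x + pow₂ n * x
    double n x = begin
      (1# + 1#) * pow₂ n * x                  ≈⟨ *-congʳ (distribʳ (pow₂ n) 1# 1#) ⟩
      (1# * pow₂ n + 1# * pow₂ n) * x         ≈⟨ *-congʳ (+-cong (*-identityˡ _) (*-identityˡ _)) ⟩
      (pow₂ n + pow₂ n) * x                   ≈⟨ distribʳ x (pow₂ n) (pow₂ n) ⟩
      pow₂ n * x + pow₂ n * x                 ∎

    Good-pow : ∀ {n} (x : Fun n) → Good (λ h → pow₂ n * x h)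
    Good-pow {zero}  x = tt
    Good-pow {suc n} x =
      half (x ₀) , half (x ₁) , (λ h → pow₂ n * ((x ₀) h - (x ₁) h)) , Good-pow _ ,
      λ h → begin
        pow₂ (suc n) * (x ₀) h                              ≈⟨ *-congˡ (difference ((x ₀) h) ((x ₁) h)) ⟩
        pow₂ (suc n) * ((x ₁) h + ((x ₀) h - (x ₁) h))      ≈⟨ distribˡ _ ((x ₁) h) ((x ₀) h - (x ₁) h) ⟩
        pow₂ (suc n) * (x ₁) h + pow₂ (suc n) * ((x ₀) h - (x ₁) h)
                                                            ≈⟨ +-congˡ (double n _) ⟩
        pow₂ (suc n) * (x ₁) h + (pow₂ n * ((x ₀) h - (x ₁) h) + pow₂ n * ((x ₀) h - (x ₁) h)) ∎
      where
      half : (y : Fun n) → Good (λ h → pow₂ (suc n) * y h)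
      half y = Good-resp (λ h → trans (distribˡ (pow₂ n) (y h) (y h)) (sym (double n (y h))))
                         (Good-pow (λ h → y h + y h))

    Good-inv : ∀ {n} {a b x : Fun n} → (∀ h → a h * b h ≈ 1# + pow₂ n * x h) → Good a → Good b
    Good-inv {zero}  e _ = tt
    Good-inv {suc n} {a} {b} {x} e (p₀ , p₁ , d , pd , q) =
      g₀ , g₁ , D , Good-+ (Good-+ (Good-pow (λ h → (x ₀) h * (b ₁) h)) (Good-neg (Good-pow (λ h → (x ₁) h * (b ₀) h))))
                            (Good-neg (Good-* (Good-* pd g₀) g₁)) , λ h → final h
      where
      reduce : ∀ {a b x : Fun n} → (∀ h → a h * b h ≈ 1# + pow₂ (suc n) * x h) →
               ∀ h → a h * b h ≈ 1# + pow₂ n * (x h + x h)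
      reduce {x = x} e h = trans (e h)
        (+-congˡ (trans (double n (x h)) (sym (distribˡ (pow₂ n) (x h) (x h)))))

      g₀ : Good (b ₀)
      g₀ = Good-inv (reduce (e ∘ (false ∷_))) p₀

      g₁ : Good (b ₁)
      g₁ = Good-inv (reduce (e ∘ (true ∷_))) p₁

      A B C D : Fun n
      A h = pow₂ n * ((x ₀) h * (b ₁) h)
      B h = pow₂ n * ((x ₁) h * (b ₀) h)
      C h = d h * (b ₀) h * (b ₁) h
      D h = (A h - B h) - C h

      expand : ∀ u v y → (1# + pow₂ (suc n) * y) * v ≈ v + (pow₂ n * (y * v) + pow₂ n * (y * v))
      expand _ v y = begin
        (1# + pow₂ (suc n) * y) * v                ≈⟨ distribʳ v 1# _ ⟩
        1# * v + pow₂ (suc n) * y * v              ≈⟨ +-cong (*-identityˡ v) (*-assoc _ y v) ⟩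
        v + pow₂ (suc n) * (y * v)                 ≈⟨ +-congˡ (double n (y * v)) ⟩
        v + (pow₂ n * (y * v) + pow₂ n * (y * v))  ∎

      -- evaluate a₀ b₀ b₁ in two ways
      balance : ∀ h → (b ₁) h + (A h + A h) ≈ ((b ₀) h + (B h + B h)) + (C h + C h)
      balance h = begin
        (b ₁) h + (A h + A h)                          ≈⟨ expand ((b ₀) h) ((b ₁) h) ((x ₀) h) ⟨
        (1# + pow₂ (suc n) * (x ₀) h) * (b ₁) h        ≈⟨ *-congʳ (e (false ∷ h)) ⟨
        (a ₀) h * (b ₀) h * (b ₁) h                    ≈⟨ *-congʳ (*-congʳ (q h)) ⟩
        ((a ₁) h + (d h + d h)) * (b ₀) h * (b ₁) h
          ≈⟨ S.solve 4 (λ u d v w → (u S.:+ (d S.:+ d)) S.:* v S.:* w S.:=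
               u S.:* w S.:* v S.:+ (d S.:* v S.:* w S.:+ d S.:* v S.:* w))
               refl ((a ₁) h) (d h) ((b ₀) h) ((b ₁) h) ⟩
        (a ₁) h * (b ₁) h * (b ₀) h + (C h + C h)      ≈⟨ +-congʳ (*-congʳ (e (true ∷ h))) ⟩
        (1# + pow₂ (suc n) * (x ₁) h) * (b ₀) h + (C h + C h)
                                                       ≈⟨ +-congʳ (expand ((b ₁) h) ((b ₀) h) ((x ₁) h)) ⟩
        ((b ₀) h + (B h + B h)) + (C h + C h)          ∎

      final : ∀ h → (b ₀) h ≈ (b ₁) h + (D h + D h)
      final h = sym (begin
        (b ₁) h + (D h + D h)
          ≈⟨ S.solve 4 (λ w A B C → w S.:+ (((A S.:+ B) S.:+ C) S.:+ ((A S.:+ B) S.:+ C)) S.:=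
               (w S.:+ (A S.:+ A)) S.:+ ((B S.:+ B) S.:+ (C S.:+ C)))
               refl ((b ₁) h) (A h) (- B h) (- C h) ⟩
        ((b ₁) h + (A h + A h)) + ((- B h + - B h) + (- C h + - C h))
          ≈⟨ +-congʳ (balance h) ⟩
        (((b ₀) h + (B h + B h)) + (C h + C h)) + ((- B h + - B h) + (- C h + - C h))
          ≈⟨ S.solve 5 (λ v B C B′ C′ →
               ((v S.:+ (B S.:+ B)) S.:+ (C S.:+ C)) S.:+ ((B′ S.:+ B′) S.:+ (C′ S.:+ C′)) S.:=
               v S.:+ (((B S.:+ B′) S.:+ (B S.:+ B′)) S.:+ ((C S.:+ C′) S.:+ (C S.:+ C′))))
               refl ((b ₀) h) (B h) (C h) (- B h) (- C h) ⟩
        (b ₀) h + (((B h - B h) + (B h - B h)) + ((C h - C h) + (C h - C h)))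
          ≈⟨ +-congˡ (+-cong (vanish (B h)) (vanish (C h))) ⟩
        (b ₀) h + (0# + 0#)                            ≈⟨ +-congˡ (+-identityˡ 0#) ⟩
        (b ₀) h + 0#                                   ≈⟨ +-identityʳ _ ⟩
        (b ₀) h                                        ∎)
        where
        vanish : ∀ y → (y - y) + (y - y) ≈ 0#
        vanish y = trans (+-cong (-‿inverseʳ y) (-‿inverseʳ y)) (+-identityˡ 0#)

    Good-transform : ∀ {n} (b : Fun n) → Good (transform b)
    Good-transform {zero}  b = tt
    Good-transform {suc n} b =
      Good-+ (Good-transform (b ₀)) (Good-transform (b ₁)) ,
      Good-resp (λ h → sym (transform-true b h))
        (Good-+ (Good-transform (b ₀)) (Good-neg (Good-transform (b ₁)))) ,
      transform (b ₁) , Good-transform (b ₁) ,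
      λ h → sym (begin
        transform b (true ∷ h) + (T₁ h + T₁ h)       ≈⟨ +-congʳ (transform-true b h) ⟩
        (transform (b ₀) h - T₁ h) + (T₁ h + T₁ h)   ≈⟨ +-assoc _ (T₁ h) (T₁ h) ⟨
        ((transform (b ₀) h - T₁ h) + T₁ h) + T₁ h   ≈⟨ +-congʳ (//-rightDividesˡ (T₁ h) _) ⟩
        transform (b ₀) h + T₁ h                     ∎)
      where
      T₁ = transform (b ₁)

    halve : ∀ {p s t u v} → s + t ≈ p * u + p * u → s - t ≈ p * v + p * v →
            (s ≈ p * (u + v)) × (t ≈ p * (u - v))
    halve {p} {s} {t} {u} {v} e f = cancel₂ _ _ (begin
        s + s                                     ≈⟨ +-cong (+-identityʳ s) (+-identityʳ s) ⟨
        (s + 0#) + (s + 0#)                       ≈⟨ +-cong (+-congˡ (-‿inverseʳ t)) (+-identityʳ _) ⟨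
        (s + (t - t)) + (s + 0# + 0#)             ≈⟨ +-congˡ (trans (+-identityʳ _) (+-identityʳ s)) ⟩
        (s + (t - t)) + s                         ≈⟨ S.solve 3 (λ s t t′ → (s S.:+ (t S.:+ t′)) S.:+ s S.:=
                                                       (s S.:+ t) S.:+ (s S.:+ t′)) refl s t (- t) ⟩
        (s + t) + (s - t)                         ≈⟨ +-cong e f ⟩
        (p * u + p * u) + (p * v + p * v)         ≈⟨ S.solve 3 (λ p u v →
          (p S.:* u S.:+ p S.:* u) S.:+ (p S.:* v S.:+ p S.:* v) S.:=
          p S.:* (u S.:+ v) S.:+ p S.:* (u S.:+ v)) refl p u v ⟩
        p * (u + v) + p * (u + v)                 ∎)
      , cancel₂ _ _ (begin
        t + t                                     ≈⟨ +-congˡ (-‿involutive t) ⟨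
        t - - t                                   ≈⟨ +-congʳ (xyx⁻¹≈y s t) ⟨
        (s + t - s) - - t                         ≈⟨ +-assoc (s + t) (- s) (- - t) ⟩
        (s + t) + (- s - - t)                     ≈⟨ +-congˡ (-‿+-comm s (- t)) ⟩
        (s + t) - (s - t)                         ≈⟨ +-cong e (-‿cong f) ⟩
        (p * u + p * u) - (p * v + p * v)         ≈⟨ +-congˡ (-‿+-comm (p * v) (p * v)) ⟨
        (p * u + p * u) + (- (p * v) - p * v)     ≈⟨ +-congˡ (+-cong (-‿distribʳ-* p v) (-‿distribʳ-* p v)) ⟩
        (p * u + p * u) + (p * - v + p * - v)     ≈⟨ S.solve 3 (λ p u v →
          (p S.:* u S.:+ p S.:* u) S.:+ (p S.:* v S.:+ p S.:* v) S.:=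
          p S.:* (u S.:+ v) S.:+ p S.:* (u S.:+ v)) refl p u (- v) ⟩
        p * (u - v) + p * (u - v)                 ∎)

    transform-neg : ∀ {n} (a : Fun n) h → transform (λ g → - a g) h ≈ - transform a h
    transform-neg a h = trans (T-cong (λ g → sym (-‿distribʳ-* (W h g) (a g))))
                              (T-neg (λ g → W h g * a g))

    invert : ∀ {n} (x b : Fun n) → (∀ h → transform x h ≈ pow₂ n * b h) →
             ∀ h → x h ≈ transform b h
    invert {zero}  x b e [] = trans (sym (*-identityˡ _)) (e [])
    invert {suc n} x b e = λ where
        (false ∷ h) → trans (invert (x ₀) (λ g → (b ₀) g + (b ₁) g) (λ g → proj₁ (halves g)) h)
                            (transform-add (b ₀) (b ₁) h)
        (true ∷ h)  → trans (invert (x ₁) (λ g → (b ₀) g - (b ₁) g) (λ g → proj₂ (halves g)) h)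
                            (trans (transform-add (b ₀) (λ g → - (b ₁) g) h)
                            (trans (+-congˡ (transform-neg (b ₁) h))
                            (sym (transform-true b h))))
      where
      halves : ∀ g → (transform (x ₀) g ≈ pow₂ n * ((b ₀) g + (b ₁) g))
                   × (transform (x ₁) g ≈ pow₂ n * ((b ₀) g - (b ₁) g))
      halves g = halve (trans (e (false ∷ g)) (double n _))
                       (trans (sym (transform-true x g)) (trans (e (true ∷ g)) (double n _)))

  divisible⇒Good : ∀ {n} {a : Fun n} → TransformDivisible (pow₂ n) a → Good a
  divisible⇒Good {n} {a} (divisible div) = Good-resp (λ h → sym (invert a b eq h)) (Good-transform b)
    where
    b : Fun n
    b h = RawMagmaDefinitions._∣ʳ_.quotient (div h)
    eq : ∀ h → transform a h ≈ pow₂ n * b h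
    eq h = trans (sym (RawMagmaDefinitions._∣ʳ_.equality (div h))) (*-comm (b h) (pow₂ n))

  private
    -- a₀ = a₁ + 2d gives W a₀ + W a₁ = 2 (W a₀ - W d) and W a₀ - W a₁ = 2 W d
    Good⇒scaled : ∀ {n} {a : Fun n} → Good a → ∀ h → ∃[ k ] transform a h ≈ pow₂ n * k
    Good⇒scaled {zero}  {a} _ [] = 1# * a [] , sym (*-identityˡ _)
    Good⇒scaled {suc n} {a} (p₀ , p₁ , d , pd , q) = λ where
        (false ∷ h) → let k , e = Good⇒scaled p₀ h
                          l , f = Good⇒scaled pd h in
          k - l , (begin
            T₀ h + T₁ h                        ≈⟨ +-congˡ (T₁-eq h) ⟩
            T₀ h + (T₀ h - (Td h + Td h))      ≈⟨ +-congˡ (+-congˡ (-‿+-comm (Td h) (Td h))) ⟨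
            T₀ h + (T₀ h + (- Td h - Td h))    ≈⟨ S.solve 2 (λ s t → s S.:+ (s S.:+ (t S.:+ t))
                                                    S.:= (s S.:+ t) S.:+ (s S.:+ t))
                                                    refl (T₀ h) (- Td h) ⟩
            (T₀ h - Td h) + (T₀ h - Td h)      ≈⟨ +-cong (factor e f) (factor e f) ⟩
            pow₂ n * (k - l) + pow₂ n * (k - l)  ≈⟨ double n (k - l) ⟨
            pow₂ (suc n) * (k - l)             ∎)
        (true ∷ h)  → let l , f = Good⇒scaled pd h in
          l , (begin
            transform a (true ∷ h)             ≈⟨ transform-true a h ⟩
            T₀ h - T₁ h                        ≈⟨ +-congʳ (T₀-eq h) ⟩
            T₁ h + (Td h + Td h) - T₁ h        ≈⟨ xyx⁻¹≈y (T₁ h) _ ⟩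
            Td h + Td h                        ≈⟨ +-cong f f ⟩
            pow₂ n * l + pow₂ n * l            ≈⟨ double n l ⟨
            pow₂ (suc n) * l                   ∎)
      where
      T₀ = transform (a ₀)
      T₁ = transform (a ₁)
      Td = transform d

      T₀-eq : ∀ h → T₀ h ≈ T₁ h + (Td h + Td h)
      T₀-eq h = trans (transform-cong q h)
        (trans (transform-add (a ₁) (λ g → d g + d g) h) (+-congˡ (transform-add d d h)))

      T₁-eq : ∀ h → T₁ h ≈ T₀ h - (Td h + Td h)
      T₁-eq h = trans (sym (//-rightDividesʳ (Td h + Td h) (T₁ h))) (+-congʳ (sym (T₀-eq h)))

      factor : ∀ {s t k l} → s ≈ pow₂ n * k → t ≈ pow₂ n * l → s - t ≈ pow₂ n * (k - l)
      factor {k = k} {l} e f = trans (+-cong e (trans (-‿cong f) (-‿distribʳ-* (pow₂ n) l)))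
        (sym (distribˡ (pow₂ n) k (- l)))

  Good⇒divisible : ∀ {n} {a : Fun n} → Good a → TransformDivisible (pow₂ n) a
  Good⇒divisible p = divisible λ h → let k , e = Good⇒scaled p h in
    record { quotient = k ; equality = trans (*-comm k _) (sym e) }

  TransformDivisible-1 : ∀ {n} → TransformDivisible (pow₂ n) {n} (λ _ → 1#)
  TransformDivisible-1 = Good⇒divisible (Good-const 1#)

  TransformDivisible-* : ∀ {n} {a b : Fun n} →
    TransformDivisible (pow₂ n) a → TransformDivisible (pow₂ n) b →
    TransformDivisible (pow₂ n) (λ h → a h * b h)
  TransformDivisible-* p q = Good⇒divisible (Good-* (divisible⇒Good p) (divisible⇒Good q))

  TransformDivisible-inv : ∀ {n} {a b : Fun n} → (∀ h → (a h * b h) ≡ 1# mod (pow₂ n)) →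
    TransformDivisible (pow₂ n) a → TransformDivisible (pow₂ n) b
  TransformDivisible-inv {n} e p = Good⇒divisible (Good-inv
    (λ h → let k , f = mod-elim (e h) in trans f (+-congˡ (*-comm k (pow₂ n))))
    (divisible⇒Good p))

  TransformDivisible-resp : ∀ {n} {a b : Fun n} → (∀ h → a h ≡ b h mod (pow₂ n)) →
    TransformDivisible (pow₂ n) a → TransformDivisible (pow₂ n) b
  TransformDivisible-resp {n} {a} {b} e p = Good⇒divisible
    (Good-resp (λ h → sym (trans (proj₂ (k h)) (+-congˡ (*-comm (proj₁ (k h)) (pow₂ n)))))
      (Good-+ (divisible⇒Good p) (Good-pow (λ h → proj₁ (k h)))))
    where
    k : ∀ h → ∃[ c ] b h ≈ a h + c * pow₂ n
    k h = mod-elim (mod-sym (pow₂ n) (e h))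

-- F₂ is Bool, with _xor_ as addition and _∧_ as multiplication.
Index : Set
Index = Vec Bool 3

origin : Index
origin = replicate 3 false

Γ : Group₀
Γ = Pointwise.abelianGroup Index
      (DirectProduct.abelianGroup (ℤᴿ.modUnits (+ 24)) (Oᴿ.modUnits 8λ))

module Γ = AbelianGroup Γ

open ℤᴿ using () renaming (_≡_mod_ to _≡_modℤ_) public
open Oᴿ using () renaming (_≡_mod_ to _≡_modᴼ_; _∣ᴿ_ to _∣ᴼ_) public
open Hadamard ℤ-ring using () renaming (TransformDivisible to WDivisibleℤ) public
open Hadamard O-ring using () renaming (TransformDivisible to WDivisibleᴼ) public

rat : Γ.Carrier → Index → ℤ
rat g h = val (proj₁ (g h))

eis : Γ.Carrier → Index → O
eis g h = val (proj₂ (g h))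

ℤ-cancel₂ : ∀ x y → x Int.+ x ≡ y Int.+ y → x ≡ y
ℤ-cancel₂ x y e = ℤₚ.*-cancelˡ-≡ (+ 2) x y (≡.trans (twice x) (≡.trans e (≡.sym (twice y))))
  where
  twice : ∀ x → + 2 Int.* x ≡ x Int.+ x
  twice = ℤ-Solver.solve-∀

O-cancel₂ : ∀ x y → x +ᴼ x ≡ y +ᴼ y → x ≡ y
O-cancel₂ (a + b ω) (c + d ω) e =
  cong₂ _+_ω (ℤ-cancel₂ a c (cong O.re e)) (ℤ-cancel₂ b d (cong O.im e))

module ℤᶜ = HadamardClosure ℤ-ring ℤ-cancel₂
module Oᶜ = HadamardClosure O-ring O-cancel₂

fromℤ-* : ∀ x y → fromℤ (x Int.* y) ≡ fromℤ x *ᴼ fromℤ y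
fromℤ-* x y = cong₂ _+_ω (eq₁ x y) (eq₂ x y)
  where
  open Int using (_+_; _*_; _-_)
  eq₁ : ∀ x y → x * y ≡ x * y - + 0 * + 0
  eq₁ = ℤ-Solver.solve-∀
  eq₂ : ∀ x y → + 0 ≡ x * + 0 + + 0 * y - + 0 * + 0
  eq₂ = ℤ-Solver.solve-∀

-- 24 = 8 (2 + ω) λ and 8 λ = 8 · λ
λ∣24 : λᴼ ∣ᴼ fromℤ (+ 24)
λ∣24 = record { quotient = + 16 + + 8 ω ; equality = ≡.refl }

8λ∣24 : 8λ ∣ᴼ fromℤ (+ 24)
8λ∣24 = record { quotient = + 2 + + 1 ω ; equality = ≡.refl }

λ∣8λ : λᴼ ∣ᴼ 8λ
λ∣8λ = record { quotient = fromℤ (+ 8) ; equality = ≡.refl }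

8∣24 : + 8 ℤᴿ.∣ᴿ + 24
8∣24 = record { quotient = + 3 ; equality = ≡.refl }

8∣8λ : fromℤ (+ 8) ∣ᴼ 8λ
8∣8λ = record { quotient = λᴼ ; equality = ≡.refl }

fromℤ-mod : ∀ {x y n} → x ≡ y modℤ n → fromℤ x ≡ fromℤ y modᴼ fromℤ n
fromℤ-mod {x} {y} {n} p with ℤᴿ.mod-elim p
... | k , e = Oᴿ.mod-intro (fromℤ k)
  (≡.trans (cong fromℤ e) (cong (fromℤ y +ᴼ_) (fromℤ-* k n)))

L : Subgroup Γ
L = record
  { Member = λ g → (∀ h → fromℤ (rat g h) ≡ eis g h modᴼ λᴼ)
                 × WDivisibleℤ (+ 8) (rat g)
                 × WDivisibleᴼ (fromℤ (+ 8)) (eis g)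
  ; resp = λ {g} {g′} e → λ { (p , q , r) →
        (λ h → Oᴿ.mod-trans λᴼ (Oᴿ.mod-sym λᴼ (Oᴿ.mod-∣ _ λ∣24 (fromℤ-mod (proj₁ (e h)))))
                 (Oᴿ.mod-trans λᴼ (p h) (Oᴿ.mod-∣ 8λ λ∣8λ (proj₂ (e h)))))
      , ℤᶜ.TransformDivisible-resp {3} (λ h → ℤᴿ.mod-∣ _ 8∣24 (proj₁ (e h))) q
      , Oᶜ.TransformDivisible-resp {3} (λ h → Oᴿ.mod-∣ 8λ 8∣8λ (proj₂ (e h))) r }
  ; ε-closed = (λ h → Oᴿ.mod-refl λᴼ ≡.refl) , ℤᶜ.TransformDivisible-1 {3} , Oᶜ.TransformDivisible-1 {3}
  ; ∙-closed = λ {g} {g′} → λ { (p , q , r) (p′ , q′ , r′) →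
        (λ h → Oᴿ.mod-trans λᴼ (Oᴿ.mod-refl λᴼ (fromℤ-* (rat g h) (rat g′ h)))
                 (Oᴿ.mod-*-cong λᴼ (p h) (p′ h)))
      , ℤᶜ.TransformDivisible-* {3} q q′
      , Oᶜ.TransformDivisible-* {3} r r′ }
  ; ⁻¹-closed = λ {g} → λ { (p , q , r) →
        (λ h → inverse-mod-λ (g h) (p h))
      , ℤᶜ.TransformDivisible-inv {3} (λ h → ℤᴿ.mod-∣ _ 8∣24 (val∙inv (proj₁ (g h)))) q
      , Oᶜ.TransformDivisible-inv {3} (λ h → Oᴿ.mod-∣ 8λ 8∣8λ (val∙inv (proj₂ (g h)))) r }
  }
  where
  module U = AbelianGroup (Oᴿ.modUnits λᴼ)

  inverse-mod-λ : ∀ (x : Unit (ℤᴿ.mod-*-commutativeMonoid (+ 24))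
                       × Unit (Oᴿ.mod-*-commutativeMonoid 8λ)) →
                  fromℤ (val (proj₁ x)) ≡ val (proj₂ x) modᴼ λᴼ →
                  fromℤ (inv (proj₁ x)) ≡ inv (proj₂ x) modᴼ λᴼ
  inverse-mod-λ (u , v) p = U.⁻¹-cong {u′} {v′} p
    where
    u′ v′ : U.Carrier
    u′ = record { val = fromℤ (val u) ; inv = fromℤ (inv u)
                ; val∙inv = Oᴿ.mod-trans λᴼ
                    (Oᴿ.mod-refl λᴼ (≡.sym (fromℤ-* (val u) (inv u))))
                    (Oᴿ.mod-∣ _ λ∣24 (fromℤ-mod (val∙inv u))) }
    v′ = record { val = val v ; inv = inv v ; val∙inv = Oᴿ.mod-∣ 8λ λ∣8λ (val∙inv v) }

E⁺ : Subgroup Γ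
E⁺ = record
  { Member = λ g → Σ[ ϵ ∈ (Index → ℤ) ] Σ[ ξ ∈ (Index → AbelianGroup.Carrier μ₆) ]
                     (∀ h → ϵ h ≡ 1ℤ ⊎ ϵ h ≡ -1ℤ) × foldCube Int._*_ ϵ ≡ 1ℤ
                   × (∀ h → rat g h ≡ ϵ h modℤ (+ 24))
                   × (∀ h → eis g h ≡ val (ξ h) modᴼ 8λ)
  ; resp = λ e → λ { (ϵ , ξ , s , t , p , q) → ϵ , ξ , s , t
      , (λ h → ℤᴿ.mod-trans (+ 24) (ℤᴿ.mod-sym (+ 24) (proj₁ (e h))) (p h))
      , (λ h → Oᴿ.mod-trans 8λ (Oᴿ.mod-sym 8λ (proj₂ (e h))) (q h)) }
  ; ε-closed = (λ _ → 1ℤ) , (λ _ → M.ε) , (λ _ → inj₁ ≡.refl) , ≡.refl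
      , (λ _ → ℤᴿ.mod-refl (+ 24) ≡.refl) , (λ _ → Oᴿ.mod-refl 8λ ≡.refl)
  ; ∙-closed = λ { (ϵ , ξ , s , t , p , q) (ϵ′ , ξ′ , s′ , t′ , p′ , q′) →
        (λ h → ϵ h Int.* ϵ′ h) , (λ h → ξ h M.∙ ξ′ h)
      , (λ h → sign-* (s h) (s′ h))
      , ≡.trans (foldCube-* ϵ ϵ′) (cong₂ Int._*_ t t′)
      , (λ h → ℤᴿ.mod-*-cong (+ 24) (p h) (p′ h))
      , (λ h → Oᴿ.mod-*-cong 8λ (q h) (q′ h)) }
  ; ⁻¹-closed = λ {g} → λ { (ϵ , ξ , s , t , p , q) →
        ϵ , (λ h → ξ h M.⁻¹) , s , t
      , (λ h → ℤᵁ.⁻¹-cong {proj₁ (g h)} {signUnit (s h)} (p h))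
      , (λ h → Oᵁ.⁻¹-cong {proj₂ (g h)} {reduce (ξ h)} (q h)) }
  }
  where
  module M = AbelianGroup μ₆
  module ℤᵁ = AbelianGroup (ℤᴿ.modUnits (+ 24))
  module Oᵁ = AbelianGroup (Oᴿ.modUnits 8λ)

  sign-* : ∀ {x y} → x ≡ 1ℤ ⊎ x ≡ -1ℤ → y ≡ 1ℤ ⊎ y ≡ -1ℤ → x Int.* y ≡ 1ℤ ⊎ x Int.* y ≡ -1ℤ
  sign-* (inj₁ ≡.refl) (inj₁ ≡.refl) = inj₁ ≡.refl
  sign-* (inj₁ ≡.refl) (inj₂ ≡.refl) = inj₂ ≡.refl
  sign-* (inj₂ ≡.refl) (inj₁ ≡.refl) = inj₂ ≡.refl
  sign-* (inj₂ ≡.refl) (inj₂ ≡.refl) = inj₁ ≡.refl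

  foldCube-* : ∀ {n} (F G : Vec Bool n → ℤ) →
    foldCube Int._*_ (λ h → F h Int.* G h) ≡ foldCube Int._*_ F Int.* foldCube Int._*_ G
  foldCube-* {zero}  F G = ≡.refl
  foldCube-* {suc n} F G = ≡.trans
    (cong₂ Int._*_ (foldCube-* (F ∘ (false ∷_)) (G ∘ (false ∷_)))
                   (foldCube-* (F ∘ (true ∷_)) (G ∘ (true ∷_))))
    (swap (foldCube Int._*_ (F ∘ (false ∷_))) (foldCube Int._*_ (G ∘ (false ∷_)))
          (foldCube Int._*_ (F ∘ (true ∷_))) (foldCube Int._*_ (G ∘ (true ∷_))))
    where
    open Int using (_*_)
    swap : ∀ a b c d → a * b * (c * d) ≡ a * c * (b * d)
    swap = ℤ-Solver.solve-∀

  signUnit : ∀ {x} → x ≡ 1ℤ ⊎ x ≡ -1ℤ → ℤᵁ.Carrier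
  signUnit {x} s = record { val = x ; inv = x ; val∙inv = ℤᴿ.mod-refl (+ 24) (square s) }
    where
    square : ∀ {x} → x ≡ 1ℤ ⊎ x ≡ -1ℤ → x Int.* x ≡ 1ℤ
    square (inj₁ ≡.refl) = ≡.refl
    square (inj₂ ≡.refl) = ≡.refl

  reduce : M.Carrier → Oᵁ.Carrier
  reduce ξ = record { val = val ξ ; inv = inv ξ ; val∙inv = Oᴿ.mod-refl 8λ (val∙inv ξ) }

H : Group₀
H = Γ /ˢ (Γ ·ˢ E⁺) L

open AbelianGroup H public using ()
  renaming (Carrier to |H|; _≈_ to _≈ᴴ_; _∙_ to _+ᴴ_; _-_ to _-ᴴ_; ε to 0ᴴ)
open RawMonoidDefinitions (AbelianGroup.rawMonoid H) public using () renaming (_×_ to _·ᴴ_)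

θ : Γ.Carrier → |H|
θ g = g

at : Index → AbelianGroup.Carrier (DirectProduct.abelianGroup (ℤᴿ.modUnits (+ 24)) (Oᴿ.modUnits 8λ)) →
     Γ.Carrier
at h x g = if ⌊ Vecₚ.≡-dec Bool._≟_ g h ⌋ then x else Γ.ε g

θ₁ : Index → AbelianGroup.Carrier (ℤᴿ.modUnits (+ 24)) → |H|
θ₁ h v = θ (at h (v , AbelianGroup.ε (Oᴿ.modUnits 8λ)))

θ₃ : Index → AbelianGroup.Carrier (Oᴿ.modUnits 8λ) → |H|
θ₃ h v = θ (at h (AbelianGroup.ε (ℤᴿ.modUnits (+ 24)) , v))

R[_] : (Index → ℕ) → Pred |H| 0ℓ
R[ e ] x = ∃[ g ] (∀ h → Any (λ u → rat g h ≡ u modℤ (+ 24)) (+ 1 ∷ + 7 ∷ + 13 ∷ + 19 ∷ []))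
                × (∀ h → eis g h ≡ fromℤ (+ (17 ℕ.^ (e h % 2))) modᴼ 8λ)
                × WDivisibleℤ (+ 8) (λ h → + (2 ℕ.^ e h) Int.* rat g h)
                × x ≈ᴴ θ g

Q[_] : (Index → ℕ) → Pred |H| 0ℓ
Q[ f ] x = ∃[ g ] (∀ h → rat g h ≡ 1ℤ modℤ (+ 24))
                × (∀ h → eis g h ≡ fromℤ (+ (2 ℕ.^ f h)) modᴼ λᴼ)
                × WDivisibleᴼ (fromℤ (+ 8)) (λ h → fromℤ (+ (2 ℕ.^ f h)) *ᴼ eis g h)
                × x ≈ᴴ θ g

R⟨_⟩ : ℕ → Pred |H| 0ℓ
R⟨ zero ⟩ x = x ≈ᴴ 0ᴴ
R⟨ a@(suc _) ⟩ x = Σ[ e ∈ (Index → ℕ) ] (∀ h → 0 < e h) × foldCube ℕ._+_ e ≡ a × R[ e ] x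

Q⟨_⟩ : ℕ → Pred |H| 0ℓ
Q⟨ zero ⟩ x = x ≈ᴴ 0ᴴ
Q⟨ r@(suc _) ⟩ x = Σ[ f ∈ (Index → ℕ) ] (∀ h → 0 < f h) × foldCube ℕ._+_ f ≡ r × Q[ f ] x

C : ℕ → Pred |H| 0ℓ
C k x = ∃[ a ] ∃[ r ] (a ≡ 0 ⊎ a ≡ 8 ⊎ 12 ≤ a) × (r ≡ 0 ⊎ r ≡ 8 ⊎ 10 ≤ r)
                    × a ℕ.+ 2 ℕ.* r ≡ k × sumset H R⟨ a ⟩ Q⟨ r ⟩ x

C-resp : ∀ k → C k Respects _≈ᴴ_
C-resp k {x} {y} x≈y (a , r , a-ok , r-ok , eq , u , v , u∈ , v∈ , e) =
  a , r , a-ok , r-ok , eq , u , v , u∈ , v∈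
  , AbelianGroup.trans H {y} {x} {u +ᴴ v} (AbelianGroup.sym H {x} {y} x≈y) e

H/P : ℕ → Group₀
H/P k = H /ˢ stabilizer H (C k) (C-resp k)

module H/P k = AbelianGroup (H/P k)

π : ∀ k → |H| → H/P.Carrier k
π k x = x

πC : ∀ k → Pred (H/P.Carrier k) 0ℓ
πC k y = ∃[ x ] C k x × H/P._≈_ k y (π k x)

residues : ∀ (r : Fin 24) → gcd (toℕ r) 6 ≡ 1 → toℕ r ℕ.* toℕ r % 24 ≡ 1
residues = toWitness {a? = all? (λ r → gcd (toℕ r) 6 ℕₚ.≟ 1 →-dec
                                       toℕ r ℕ.* toℕ r % 24 ℕₚ.≟ 1)} _

square≡1 : ∀ m → Coprime m (+ 6) → (m Int.* m) ≡ 1ℤ modℤ (+ 24)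
square≡1 m cop = ℤᴿ.mod-trans (+ 24) (ℤᴿ.mod-*-cong (+ 24) m≡r m≡r)
  (ℤᴿ.mod-intro (+ (r ℕ.* r / 24)) r*r≡)
  where
  r : ℕ
  r = m %ℕ 24

  r<24 : r < 24
  r<24 = n%ℕd<d m 24

  m≡r : m ≡ + r modℤ (+ 24)
  m≡r = ℤᴿ.mod-intro (m /ℕ 24) (a≡a%ℕn+[a/ℕn]*n m 24)

  coprime-r : ℕ-Coprimality.Coprime r 6
  coprime-r {d} (d∣r , d∣6) = cop (Signed.∣⇒∣ᵤ d∣m , d∣6)
    where
    d∣m : + d Signed.∣ m
    d∣m = ≡.subst (+ d Signed.∣_) (≡.sym (a≡a%ℕn+[a/ℕn]*n m 24))
      (Signed.∣m∣n⇒∣m+n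
        (Signed.∣ᵤ⇒∣ {+ d} {+ r} d∣r)
        (Signed.∣n⇒∣m*n (m /ℕ 24)
          (Signed.∣ᵤ⇒∣ {+ d} {+ 24} (ℕ∣.∣-trans d∣6 (ℕ∣.divides 4 ≡.refl)))))

  r*r%24≡1 : r ℕ.* r % 24 ≡ 1
  r*r%24≡1 = ≡.subst (λ r → r ℕ.* r % 24 ≡ 1) (toℕ-fromℕ< r<24)
    (residues (fromℕ< r<24)
      (≡.trans (cong (λ r → gcd r 6) (toℕ-fromℕ< r<24)) (ℕ-Coprimality.coprime⇒gcd≡1 coprime-r)))

  r*r≡ : + r Int.* + r ≡ 1ℤ Int.+ + (r ℕ.* r / 24) Int.* + 24
  r*r≡ = ≡.trans (≡.sym (ℤₚ.pos-* r r))
    (≡.trans (cong +_ (≡.trans (m≡m%n+[m/n]*n (r ℕ.* r) 24)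
                               (cong (ℕ._+ r ℕ.* r / 24 ℕ.* 24) r*r%24≡1)))
             (cong (λ x → 1ℤ Int.+ x) (ℤₚ.pos-* (r ℕ.* r / 24) 24)))

prime>3⇒coprime6 : ∀ {q} → Prime q → 3 < q → ℕ-Coprimality.Coprime q 6
prime>3⇒coprime6 {q} pr 3<q (d∣q , d∣6) with prime⇒irreducible pr d∣q
... | inj₁ d≡1    = d≡1
... | inj₂ ≡.refl with euclidsLemma 2 3 pr d∣6
...   | inj₁ q∣2 = ⊥-elim (ℕₚ.<⇒≱ 3<q (ℕₚ.≤-trans (ℕ∣.∣⇒≤ q∣2) (ℕₚ.n≤1+n 2)))
...   | inj₂ q∣3 = ⊥-elim (ℕₚ.<⇒≱ 3<q (ℕ∣.∣⇒≤ q∣3))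

coprime-^ : ∀ {q} f → ℕ-Coprimality.Coprime q 6 → ℕ-Coprimality.Coprime (q ℕ.^ f) 6
coprime-^ zero    cop (d∣1 , _) = ℕ∣.∣1⇒≡1 d∣1
coprime-^ (suc f) cop (d∣q^f , d∣6) = coprime-^ f cop
  (ℕ-Coprimality.coprime-divisor
    (λ { (i∣d , i∣q) → cop (i∣q , ℕ∣.∣-trans i∣d d∣6) }) d∣q^f , d∣6)

conj : O → O
conj (b + c ω) = (b Int.- c) + (Int.- c) ω

norm-conj : ∀ π → π *ᴼ conj π ≡ fromℤ (N π)
norm-conj (b + c ω) = cong₂ _+_ω (eq₁ b c) (eq₂ b c)
  where
  open Int using (_+_; _*_; _-_; -_)
  eq₁ : ∀ b c → b * (b - c) - c * (- c) ≡ b * b - b * c + c * c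
  eq₁ = ℤ-Solver.solve-∀
  eq₂ : ∀ b c → b * (- c) + c * (b - c) - c * (- c) ≡ + 0
  eq₂ = ℤ-Solver.solve-∀

-- Squares of integers prime to 6 are 1 modulo 24, so m is its own inverse
-- there, and N(π) π̄ inverts π modulo 8 λ.

ratUnit : ∀ m → Coprime m (+ 6) → AbelianGroup.Carrier (ℤᴿ.modUnits (+ 24))
ratUnit m cop = record { val = m ; inv = m ; val∙inv = square≡1 m cop }

eisUnit : ∀ π → Coprime (N π) (+ 6) → AbelianGroup.Carrier (Oᴿ.modUnits 8λ)
eisUnit π cop = record
  { val     = π
  ; inv     = conj π *ᴼ fromℤ (N π)
  ; val∙inv = Oᴿ.mod-trans 8λ (Oᴿ.mod-refl 8λ eq)
                (Oᴿ.mod-∣ _ 8λ∣24 (fromℤ-mod (square≡1 (N π) cop)))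
  }
  where
  eq : π *ᴼ (conj π *ᴼ fromℤ (N π)) ≡ fromℤ (N π Int.* N π)
  eq = ≡.trans (≡.sym (CommutativeRing.*-assoc O-ring π (conj π) (fromℤ (N π))))
       (≡.trans (cong (_*ᴼ fromℤ (N π)) (norm-conj π)) (≡.sym (fromℤ-* (N π) (N π))))

c : ∀ m → Coprime m (+ 6) → |H|
c m cop = θ₁ origin (ratUnit m cop)

-- A prime ideal 𝔮 with a generator is given by the generator ϖ, and 𝔮 ∣ q means
-- q ∈ 𝔮. All generators are admitted; they differ by elements of μ₆, whose
-- classes θ₃ are trivial, so a move does not depend on the choice.
data Move (q : ℕ) : Set where
  rational   : Prime q → 3 < q → ∀ h → h ≢ origin → Move q
  eisenstein : Prime q → 3 < q → (h : Index) (ϖ : O) (f : ℕ) → IsPrimeIdeal ⟨ ϖ ⟩ →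
               ⟨ ϖ ⟩ (fromℤ (+ q)) → N ϖ ≡ + (q ℕ.^ f) → Move q

value : ∀ {q} → Move q → |H|
value {q} (rational pr 3<q h _) =
  θ₁ h (ratUnit (+ q) q⊥6) -ᴴ θ₁ origin (ratUnit (+ q) q⊥6)
  where
  q⊥6 : Coprime (+ q) (+ 6)
  q⊥6 = prime>3⇒coprime6 pr 3<q
value {q} (eisenstein pr 3<q h ϖ f _ _ Nϖ≡q^f) =
  θ₃ h (eisUnit ϖ N⊥6) -ᴴ f ·ᴴ θ₁ origin (ratUnit (+ q) q⊥6)
  where
  q⊥6 : Coprime (+ q) (+ 6)
  q⊥6 = prime>3⇒coprime6 pr 3<q
  N⊥6 : Coprime (N ϖ) (+ 6)
  N⊥6 = ≡.subst (λ n → Coprime n (+ 6)) (≡.sym Nϖ≡q^f) (coprime-^ f q⊥6)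

cost : ∀ {q} → Move q → ℕ
cost (rational _ _ _ _)           = 1
cost (eisenstein _ _ _ _ f _ _ _) = f

P : ℕ → ℕ → Pred |H| 0ℓ
P q e x = Σ[ ms ∈ List (Move q) ] sum (List.map cost ms) ≤ e
                                × x ≈ᴴ foldr _+ᴴ_ 0ᴴ (List.map value ms)

_^_∥_ : ℕ → ℕ → ℕ → Set
q ^ e ∥ n = (q ℕ.^ e) ∣ n × (q ℕ.^ suc e) ∤ n

primeDivisors : ℕ → List ℕ
primeDivisors n = filter (λ q → prime? q ×-dec q ∣? n) (upTo (suc n))

-- For n ≠ 0 and q prime, q^e ∥ n holds for exactly one e.
primeSum : ℕ → Pred |H| 0ℓ
primeSum n = foldr (sumset H) (_≈ᴴ 0ᴴ)
  (List.map (λ q x → ∃[ e ] q ^ e ∥ n × P q (e ⊓ 26) x) (primeDivisors n))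

OmitsExactly : ∀ k → H/P.Carrier k → Set
OmitsExactly k t = ¬ πC k t × (∀ y → ¬ πC k y → H/P._≈_ k y t)

Represented : ∀ k m → Coprime m (+ 6) → Set
Represented k m m⊥6 = Satisfiable (translate H (primeSum Int.∣ m ∣) (c m m⊥6) ∩ C k)

UsefulMove : ℕ → ℤ → Set
UsefulMove k m = ∃[ q ] Prime q × q ∣ Int.∣ m ∣ × (Σ[ μ ∈ Move q ]
  ¬ H/P._≈_ k (π k (value μ)) (H/P.ε k) × ∃[ e ] q ^ e ∥ Int.∣ m ∣ × cost μ ≤ e)

{-# OPTIONS --safe #-}
module Submission where

-- H has nine quadratic characters that matter: Z, the sum of the χ₄(a_h), and, for each of the affine
-- functions 1, h₁, h₂, h₃ on the cube, the moment Y_i of χ₁₂(a_h) + η(β_h) and the moment K_i of χ₄(N β_h).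
-- Here η is the quadratic character modulo 4λ that is trivial on μ₆ and on 5 + 2ω. For k even C_k is
-- the set where (Z, Y₀, K) ≠ (1, 0, 0), for k odd the set where (Z + Y₀, K) ≠ (0, 0); its stabilizer is
-- then the common kernel of these six or five characters.
--
-- To see that C_k satisfies these conditions, note that K = 0 and Z + Y₀ ≡ a on R_a, and that Z vanishes on
-- R_8 and on every Q_r, so that only Q_8 needs an argument. If W(2γ) ∈ 8 O⁸, then γ modulo 2 is
-- an affine map from the cube to F₄ that avoids 0, hence avoids a second value, and so some linear form F is odd on all γ_h. In
-- terms of F, the sum of the η(γ_h) is expressed by K, and vanishes when K does.
--
-- Conversely, R_a and Q_r (a, r > 0) are stable under the elements congruent to 1 modulo 12 and modulo 4λ,
-- and modulo these, E⁺ and L the nine characters separate the elements of Γ. So it suffices to realise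
-- their values by explicit elements of R_{k-16} + Q_8 and, for k even, of R_8 + Q_{k/2-4}.
--
-- The criterion follows, since a sum of moves changes the projected baseline only if one of the moves has
-- a nonzero projection, and since no move costs more than 2.

open import Defs
import Algebra.Definitions.RawMagma as RawMagmaDefinitions
import Algebra.Properties.AbelianGroup as AbelianGroupProperties
import Algebra.Properties.CommutativeSemigroup as CommutativeSemigroupProperties
import Data.Fin.Properties as Finₚ
import Data.Integer.Base as Int
import Data.Integer.Properties as ℤₚ
import Data.Integer.Tactic.RingSolver as ℤ-Solver
import Data.Nat.Divisibility as ℕ∣
import Data.Nat.Properties as ℕₚ
import Data.Parity.Properties as ℙ
open import Algebra.Bundles using (AbelianGroup; CommutativeRing)
open import Data.Bool.Base using (Bool; true; false)
open import Data.Empty using (⊥-elim)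
open import Data.Fin.Base using (Fin; fromℕ<; suc; toℕ; zero)
open import Data.Fin.Patterns
open import Data.Fin.Properties using (all?)
open import Data.Integer.Base using (ℤ; +_; -[1+_]; 0ℤ; 1ℤ; -1ℤ)
open import Data.Integer.Coprimality using (Coprime)
open import Data.Integer.DivMod using (_/ℕ_; a≡a%ℕn+[a/ℕn]*n; n%ℕd<d)
open import Data.List.Base as List using ([]; _∷_)
open import Data.List.Membership.Propositional using (_∈_)
open import Data.List.Membership.Propositional.Properties using (∈-filter⁺; ∈-filter⁻; ∈-upTo⁺)
open import Data.List.Relation.Unary.Any as Any using (Any; here; there)
open import Data.Nat.Base as ℕ using (ℕ; NonZero; parity; suc; zero)
open import Data.Nat.DivMod using (_mod_)
open import Data.Nat.ListAction using (sum)
open import Data.Nat.Primality using (Prime; prime?; prime⇒nonTrivial)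
open import Data.Parity.Base using (Parity; 0ℙ; 1ℙ)
  renaming (_+_ to infixl 6 _⊕_; _*_ to infixl 7 _⊗_)
open import Data.Product.Base using (_×_; _,_; map; map₂; proj₁; proj₂; ∃-syntax)
open import Data.Product.Properties using (≡-dec)
open import Data.Sum.Base as Sum using (_⊎_; [_,_]′; fromInj₁; inj₁; inj₂)
open import Data.Unit.Base using (tt)
open import Data.Vec.Base as Vec using (Vec; []; _∷_; insertAt)
open import Function.Base using (_∘_)
open import Function.Bundles using (_⇔_; mk⇔)
open import Level using (0ℓ)
open import Relation.Binary.Definitions using (_Respects_)
open import Relation.Binary.PropositionalEquality
open import Relation.Nullary.Decidable
  using (Dec; yes; no; toWitness; decidable-stable; map′; ¬?; _→-dec_; _×-dec_; _⊎-dec_)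
open import Relation.Nullary.Negation using (¬_; contradiction)
open import Relation.Unary using (Pred; Satisfiable; _∩_)

open Unit using (val; inv; val∙inv)

-- Residues and quadratic characters

module Residue (n : ℕ) .{{_ : NonZero n}} where

  res : ℤ → Fin n
  res x = fromℕ< (n%ℕd<d x n)

  ⟦_⟧ : Fin n → ℤ
  ⟦ r ⟧ = + toℕ r

  res-sound : ∀ x → x ≡ ⟦ res x ⟧ modℤ (+ n)
  res-sound x = ℤᴿ.mod-intro (x /ℕ n) (trans (a≡a%ℕn+[a/ℕn]*n x n)
    (cong (λ r → + r Int.+ (x /ℕ n) Int.* + n) (sym (Finₚ.toℕ-fromℕ< (n%ℕd<d x n)))))

  ⟦⟧-injective : ∀ r s → ⟦ r ⟧ ≡ ⟦ s ⟧ modℤ (+ n) → r ≡ s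
  ⟦⟧-injective r s p with k , e ← ℤᴿ.mod-elim p =
    Finₚ.toℕ-injective (ℤₚ.+-injective (ℤₚ.i-j≡0⇒i≡j ⟦ r ⟧ ⟦ s ⟧
      (ℤₚ.∣i∣≡0⇒i≡0 (vanish n∣d d<n))))
    where
    d = ⟦ r ⟧ Int.- ⟦ s ⟧
    d≡kn : d ≡ k Int.* + n
    d≡kn = trans (cong (Int._- ⟦ s ⟧) e) (cancel ⟦ s ⟧ (k Int.* + n))
      where
      open Int using (_+_; _-_)
      cancel : ∀ y z → y + z - y ≡ z
      cancel = ℤ-Solver.solve-∀
    n∣d : n ℕ∣.∣ Int.∣ d ∣
    n∣d = ℕ∣.divides Int.∣ k ∣ (trans (cong Int.∣_∣ d≡kn) (ℤₚ.abs-* k (+ n)))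
    d<n : Int.∣ d ∣ ℕ.< n
    d<n = subst (λ x → Int.∣ x ∣ ℕ.< n) (sym (ℤₚ.m-n≡m⊖n (toℕ r) (toℕ s)))
      (ℕₚ.≤-<-trans (ℤₚ.∣m⊝n∣≤m⊔n (toℕ r) (toℕ s)) (ℕₚ.⊔-pres-<m (Finₚ.toℕ<n r) (Finₚ.toℕ<n s)))
    vanish : ∀ {m} → n ℕ∣.∣ m → m ℕ.< n → m ≡ 0
    vanish {zero}  _   _   = refl
    vanish {suc _} n∣m m<n = contradiction m<n (ℕₚ.≤⇒≯ (ℕ∣.∣⇒≤ n∣m))

  res-cong : ∀ {x y} → x ≡ y modℤ (+ n) → res x ≡ res y
  res-cong {x} {y} p = ⟦⟧-injective (res x) (res y)
    (ℤᴿ.mod-trans (+ n) (ℤᴿ.mod-sym (+ n) (res-sound x))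
      (ℤᴿ.mod-trans (+ n) p (res-sound y)))

  res-reflects : ∀ {x y} → res x ≡ res y → x ≡ y modℤ (+ n)
  res-reflects {x} {y} e = ℤᴿ.mod-trans (+ n) (res-sound x)
    (subst (λ r → ⟦ r ⟧ ≡ y modℤ (+ n)) (sym e) (ℤᴿ.mod-sym (+ n) (res-sound y)))

  res-* : ∀ x y → res (x Int.* y) ≡ res (⟦ res x ⟧ Int.* ⟦ res y ⟧)
  res-* x y = res-cong (ℤᴿ.mod-*-cong (+ n) (res-sound x) (res-sound y))

  res-+ : ∀ x y → res (x Int.+ y) ≡ res (⟦ res x ⟧ Int.+ ⟦ res y ⟧)
  res-+ x y with k , e ← ℤᴿ.mod-elim (res-sound x) | l , f ← ℤᴿ.mod-elim (res-sound y) =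
    res-cong {x Int.+ y} {⟦ res x ⟧ Int.+ ⟦ res y ⟧}
      (ℤᴿ.mod-intro (k Int.+ l) (trans (cong₂ Int._+_ e f) (eq ⟦ res x ⟧ ⟦ res y ⟧ k l (+ n))))
    where
    open Int using (_+_; _*_)
    eq : ∀ a b k l n → (a + k * n) + (b + l * n) ≡ (a + b) + (k + l) * n
    eq = ℤ-Solver.solve-∀

module Mod3 = Residue 3
module Mod4 = Residue 4

-- The characters `κ` and `ψ` factor through O/4O, so identities between them are settled by
-- enumerating these sixteen residues in the basis 1, ω.
Residueᴼ : Set
Residueᴼ = Fin 4 × Fin 4

resᴼ : O → Residueᴼ
resᴼ (b + c ω) = Mod4.res b , Mod4.res c

lift : Residueᴼ → O
lift (b , c) = Mod4.⟦ b ⟧ + Mod4.⟦ c ⟧ ω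

4ᴼ : O
4ᴼ = fromℤ (+ 4)

module _ where
  open Int using (_+_; _*_; _-_)

  *4ᴼ-re : ∀ b p q → b + (p * + 4 - q * + 0) ≡ b + p * + 4
  *4ᴼ-re = ℤ-Solver.solve-∀

  *4ᴼ-im : ∀ c p q → c + (p * + 0 + q * + 4 - q * + 0) ≡ c + q * + 4
  *4ᴼ-im = ℤ-Solver.solve-∀

mod4-re : ∀ {x y} → x ≡ y modᴼ 4ᴼ → O.re x ≡ O.re y modℤ (+ 4)
mod4-re {y = b + c ω} p with (k + l ω) , refl ← Oᴿ.mod-elim p = ℤᴿ.mod-intro k (*4ᴼ-re b k l)

mod4-im : ∀ {x y} → x ≡ y modᴼ 4ᴼ → O.im x ≡ O.im y modℤ (+ 4)
mod4-im {y = b + c ω} p with (k + l ω) , refl ← Oᴿ.mod-elim p = ℤᴿ.mod-intro l (*4ᴼ-im c k l)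

mod4-intro : ∀ {x y} → O.re x ≡ O.re y modℤ (+ 4) → O.im x ≡ O.im y modℤ (+ 4) → x ≡ y modᴼ 4ᴼ
mod4-intro {b + c ω} {b′ + c′ ω} p q with k , refl ← ℤᴿ.mod-elim p | l , refl ← ℤᴿ.mod-elim q =
  Oᴿ.mod-intro (k + l ω) (sym (cong₂ _+_ω (*4ᴼ-re b′ k l) (*4ᴼ-im c′ k l)))

resᴼ-cong : ∀ {x y} → x ≡ y modᴼ 4ᴼ → resᴼ x ≡ resᴼ y
resᴼ-cong p = cong₂ _,_ (Mod4.res-cong (mod4-re p)) (Mod4.res-cong (mod4-im p))

resᴼ-reflects : ∀ {x y} → resᴼ x ≡ resᴼ y → x ≡ y modᴼ 4ᴼ
resᴼ-reflects e = mod4-intro (Mod4.res-reflects (cong proj₁ e)) (Mod4.res-reflects (cong proj₂ e))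

resᴼ-sound : ∀ x → x ≡ lift (resᴼ x) modᴼ 4ᴼ
resᴼ-sound x = mod4-intro (Mod4.res-sound (O.re x)) (Mod4.res-sound (O.im x))

resᴼ-* : ∀ x y → resᴼ (x *ᴼ y) ≡ resᴼ (lift (resᴼ x) *ᴼ lift (resᴼ y))
resᴼ-* x y = resᴼ-cong (Oᴿ.mod-*-cong 4ᴼ (resᴼ-sound x) (resᴼ-sound y))

infix 4 _≟ᴼ_
_≟ᴼ_ : (x y : O) → Dec (x ≡ y)
(b + c ω) ≟ᴼ (b′ + c′ ω) = map′ (λ { (refl , refl) → refl }) (λ { refl → refl , refl })
  (b ℤₚ.≟ b′ ×-dec c ℤₚ.≟ c′)

-- Signs are written additively: the value of a quadratic character is the exponent of -1.

low high : Fin 4 → Parity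
low r = parity (toℕ r)
high r = parity (toℕ r ℕ./ 2)

bit₀ : ℤ → Parity
bit₀ x = low (Mod4.res x)

χ₄ : ℤ → Parity
χ₄ x = high (Mod4.res x)

-- On the nonzero residues this is the Legendre symbol modulo 3. The value at 0 is a default, so
-- multiplicativity is claimed for nonzero residues only.
sign₃ : Fin 3 → Parity
sign₃ r = parity (toℕ r ℕ./ 2)

χ₃ : ℤ → Parity
χ₃ x = sign₃ (Mod3.res x)

-- Since ω ≡ 1 modulo λ, the reduction O → O/λ = F₃ sends b + cω to b + c.
χλ : O → Parity
χλ (b + c ω) = χ₃ (b Int.+ c)

-- As 2 is inert in O, the units modulo 4 are exactly the residues of odd norm.
oddR κR ψR : Residueᴼ → Parity
oddR x = bit₀ (N (lift x))
κR x = χ₄ (N (lift x))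
-- A unit modulo 4 is uniquely ω^i (-1)^j (√-3)^k; ψ reads off j and κ reads off k.
ψR (b , c) with low c
... | 0ℙ = high b
... | 1ℙ = high c ⊕ low b ⊕ ((1ℙ ⊕ low b) ⊗ κR (b , c))

odd κ ψ : O → Parity
odd = oddR ∘ resᴼ
κ = κR ∘ resᴼ
ψ = ψR ∘ resᴼ

infix 4 _≟ᴿ_
_≟ᴿ_ : (x y : Residueᴼ) → Dec (x ≡ y)
_≟ᴿ_ = ≡-dec Finₚ._≟_ Finₚ._≟_

allᴿ? : ∀ {P : Residueᴼ → Set} → (∀ x → Dec (P x)) → Dec (∀ x → P x)
allᴿ? P? = map′ (λ f x → f (proj₁ x) (proj₂ x)) (λ f b c → f (b , c))
  (all? λ b → all? λ c → P? (b , c))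

χ₄-residues : ∀ r s → low r ≡ 1ℙ → low s ≡ 1ℙ →
              χ₄ (Mod4.⟦ r ⟧ Int.* Mod4.⟦ s ⟧) ≡ high r ⊕ high s
χ₄-residues = toWitness {a? = all? λ r → all? λ s → low r ℙ.≟ 1ℙ →-dec low s ℙ.≟ 1ℙ →-dec _ ℙ.≟ _} _

χ₄-* : ∀ x y → bit₀ x ≡ 1ℙ → bit₀ y ≡ 1ℙ → χ₄ (x Int.* y) ≡ χ₄ x ⊕ χ₄ y
χ₄-* x y p q = trans (cong high (Mod4.res-* x y)) (χ₄-residues (Mod4.res x) (Mod4.res y) p q)

χ₃-residues : ∀ r s → r ≢ 0F → s ≢ 0F → χ₃ (Mod3.⟦ r ⟧ Int.* Mod3.⟦ s ⟧) ≡ sign₃ r ⊕ sign₃ s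
χ₃-residues = toWitness {a? = all? λ r → all? λ s →
  ¬? (r Finₚ.≟ 0F) →-dec ¬? (s Finₚ.≟ 0F) →-dec _ ℙ.≟ _} _

χ₃-* : ∀ x y → Mod3.res x ≢ 0F → Mod3.res y ≢ 0F → χ₃ (x Int.* y) ≡ χ₃ x ⊕ χ₃ y
χ₃-* x y p q = trans (cong sign₃ (Mod3.res-* x y)) (χ₃-residues (Mod3.res x) (Mod3.res y) p q)

κψ-residues : ∀ x y → oddR x ≡ 1ℙ → oddR y ≡ 1ℙ →
              κ (lift x *ᴼ lift y) ≡ κR x ⊕ κR y × ψ (lift x *ᴼ lift y) ≡ ψR x ⊕ ψR y
κψ-residues = toWitness {a? = allᴿ? λ x → allᴿ? λ y →
  oddR x ℙ.≟ 1ℙ →-dec oddR y ℙ.≟ 1ℙ →-dec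
  κ (lift x *ᴼ lift y) ℙ.≟ κR x ⊕ κR y ×-dec ψ (lift x *ᴼ lift y) ℙ.≟ ψR x ⊕ ψR y} _

κ-* : ∀ x y → odd x ≡ 1ℙ → odd y ≡ 1ℙ → κ (x *ᴼ y) ≡ κ x ⊕ κ y
κ-* x y p q = trans (cong κR (resᴼ-* x y)) (proj₁ (κψ-residues (resᴼ x) (resᴼ y) p q))

ψ-* : ∀ x y → odd x ≡ 1ℙ → odd y ≡ 1ℙ → ψ (x *ᴼ y) ≡ ψ x ⊕ ψ y
ψ-* x y p q = trans (cong ψR (resᴼ-* x y)) (proj₂ (κψ-residues (resᴼ x) (resᴼ y) p q))

τ : O → ℤ
τ (b + c ω) = b Int.+ c

mod-λ⇒τ : ∀ {x y} → x ≡ y modᴼ λᴼ → τ x ≡ τ y modℤ (+ 3)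
mod-λ⇒τ {y = b + c ω} p with (k + l ω) , refl ← Oᴿ.mod-elim p = ℤᴿ.mod-intro l (eq b c k l)
  where
  open Int using (_+_; _*_; _-_)
  eq : ∀ b c k l → (b + (k * + 1 - l * -1ℤ)) + (c + (k * -1ℤ + l * + 1 - l * -1ℤ)) ≡ (b + c) + l * + 3
  eq = ℤ-Solver.solve-∀

τ⇒mod-λ : ∀ {x y} → τ x ≡ τ y modℤ (+ 3) → x ≡ y modᴼ λᴼ
τ⇒mod-λ {b + c ω} {b′ + c′ ω} p with l , e ← ℤᴿ.mod-elim p =
  -- A multiple (k + lω)λ has real part k + l and τ-value 3l; the real parts therefore determine k
  -- once l is known.
  Oᴿ.mod-intro ((b Int.- b′ Int.- l) + l ω) (cong₂ _+_ω (eq₁ b b′ l) (trans (eq₂ b c b′ l)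
    (trans (cong (λ s → s Int.- b Int.+ (b′ Int.- b′)) e) (eq₃ b c′ b′ l))))
  where
  open Int using (_+_; _*_; _-_)
  eq₁ : ∀ b b′ l → b ≡ b′ + ((b - b′ - l) * + 1 - l * -1ℤ)
  eq₁ = ℤ-Solver.solve-∀
  eq₂ : ∀ b c b′ l → c ≡ (b + c) - b + (b′ - b′)
  eq₂ = ℤ-Solver.solve-∀
  eq₃ : ∀ b c′ b′ l → (b′ + c′ + l * + 3) - b + (b′ - b′) ≡
        c′ + ((b - b′ - l) * -1ℤ + l * + 1 - l * -1ℤ)
  eq₃ = ℤ-Solver.solve-∀

τ-* : ∀ x y → τ (x *ᴼ y) ≡ τ x Int.* τ y modℤ (+ 3)
τ-* (b + c ω) (d + e ω) = ℤᴿ.mod-intro (Int.- (c Int.* e)) (eq b c d e)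
  where
  open Int using (_+_; _*_; _-_; -_)
  eq : ∀ b c d e → (b * d - c * e) + (b * e + c * d - c * e) ≡ (b + c) * (d + e) + (- (c * e)) * + 3
  eq = ℤ-Solver.solve-∀

χλ-cong : ∀ {x y} → x ≡ y modᴼ λᴼ → χλ x ≡ χλ y
χλ-cong p = cong sign₃ (Mod3.res-cong (mod-λ⇒τ p))

χλ-* : ∀ x y → Mod3.res (τ x) ≢ 0F → Mod3.res (τ y) ≢ 0F → χλ (x *ᴼ y) ≡ χλ x ⊕ χλ y
χλ-* x y p q = trans (cong sign₃ (Mod3.res-cong (τ-* x y))) (χ₃-* (τ x) (τ y) p q)

odd-unit : ∀ x y → (x Int.* y) ≡ 1ℤ modℤ (+ 4) → bit₀ x ≡ 1ℙ
odd-unit x y p = table (Mod4.res x) (Mod4.res y) (trans (sym (Mod4.res-* x y)) (Mod4.res-cong p))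
  where
  table : ∀ r s → Mod4.res (Mod4.⟦ r ⟧ Int.* Mod4.⟦ s ⟧) ≡ 1F → low r ≡ 1ℙ
  table = toWitness {a? = all? λ r → all? λ s → _ Finₚ.≟ _ →-dec _ ℙ.≟ _} _

nonzero-unit : ∀ x y → (x Int.* y) ≡ 1ℤ modℤ (+ 3) → Mod3.res x ≢ 0F
nonzero-unit x y p = table (Mod3.res x) (Mod3.res y) (trans (sym (Mod3.res-* x y)) (Mod3.res-cong p))
  where
  table : ∀ r s → Mod3.res (Mod3.⟦ r ⟧ Int.* Mod3.⟦ s ⟧) ≡ 1F → r ≢ 0F
  table = toWitness {a? = all? λ r → all? λ s → _ Finₚ.≟ _ →-dec ¬? (r Finₚ.≟ 0F)} _

odd-unitᴼ : ∀ x y → (x *ᴼ y) ≡ fromℤ 1ℤ modᴼ 4ᴼ → odd x ≡ 1ℙ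
odd-unitᴼ x y p = table (resᴼ x) (resᴼ y) (trans (sym (resᴼ-* x y)) (resᴼ-cong p))
  where
  table : ∀ r s → resᴼ (lift r *ᴼ lift s) ≡ (1F , 0F) → oddR r ≡ 1ℙ
  table = toWitness {a? = allᴿ? λ r → allᴿ? λ s → resᴼ (lift r *ᴼ lift s) ≟ᴿ (1F , 0F) →-dec oddR r ℙ.≟ 1ℙ} _

4∣24 : + 4 ℤᴿ.∣ᴿ + 24
4∣24 = record { quotient = + 6 ; equality = refl }

3∣24 : + 3 ℤᴿ.∣ᴿ + 24
3∣24 = record { quotient = + 8 ; equality = refl }

4∣8λ : 4ᴼ ∣ᴼ 8λ
4∣8λ = record { quotient = fromℤ (+ 2) *ᴼ λᴼ ; equality = refl }

mod24⇒mod4 : ∀ {x y} → x ≡ y modℤ (+ 24) → x ≡ y modℤ (+ 4)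
mod24⇒mod4 = ℤᴿ.mod-∣ (+ 24) 4∣24

mod24⇒mod3 : ∀ {x y} → x ≡ y modℤ (+ 24) → x ≡ y modℤ (+ 3)
mod24⇒mod3 = ℤᴿ.mod-∣ (+ 24) 3∣24

mod8λ⇒mod4 : ∀ {x y} → x ≡ y modᴼ 8λ → x ≡ y modᴼ 4ᴼ
mod8λ⇒mod4 = Oᴿ.mod-∣ 8λ 4∣8λ

mod8λ⇒modλ : ∀ {x y} → x ≡ y modᴼ 8λ → x ≡ y modᴼ λᴼ
mod8λ⇒modλ = Oᴿ.mod-∣ 8λ λ∣8λ

χ₄-cong : ∀ {x y} → x ≡ y modℤ (+ 24) → χ₄ x ≡ χ₄ y
χ₄-cong p = cong high (Mod4.res-cong (mod24⇒mod4 p))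

χ₃-cong : ∀ {x y} → x ≡ y modℤ (+ 24) → χ₃ x ≡ χ₃ y
χ₃-cong p = cong sign₃ (Mod3.res-cong (mod24⇒mod3 p))

κ-cong : ∀ {x y} → x ≡ y modᴼ 8λ → κ x ≡ κ y
κ-cong p = cong κR (resᴼ-cong (mod8λ⇒mod4 p))

ψ-cong : ∀ {x y} → x ≡ y modᴼ 8λ → ψ x ≡ ψ y
ψ-cong p = cong ψR (resᴼ-cong (mod8λ⇒mod4 p))

-- χ₁₂ is trivial on ±1, and η on μ₆.
χ₁₂ : ℤ → Parity
χ₁₂ x = χ₄ x ⊕ χ₃ x

η : O → Parity
η x = ψ x ⊕ χλ x

module ℤ₂₄ = AbelianGroup (ℤᴿ.modUnits (+ 24))
module O₈ = AbelianGroup (Oᴿ.modUnits 8λ)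

interchange : ∀ a b c d → (a ⊕ b) ⊕ (c ⊕ d) ≡ (a ⊕ c) ⊕ (b ⊕ d)
interchange = CommutativeSemigroupProperties.interchange ℙ.+-commutativeSemigroup

rational-odd : ∀ (u : ℤ₂₄.Carrier) → bit₀ (val u) ≡ 1ℙ
rational-odd u = odd-unit (val u) (inv u) (mod24⇒mod4 (val∙inv u))

rational-nonzero : ∀ (u : ℤ₂₄.Carrier) → Mod3.res (val u) ≢ 0F
rational-nonzero u = nonzero-unit (val u) (inv u) (mod24⇒mod3 (val∙inv u))

eisenstein-odd : ∀ (u : O₈.Carrier) → odd (val u) ≡ 1ℙ
eisenstein-odd u = odd-unitᴼ (val u) (inv u) (mod8λ⇒mod4 (val∙inv u))

eisenstein-nonzero : ∀ (u : O₈.Carrier) → Mod3.res (τ (val u)) ≢ 0F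
eisenstein-nonzero u = nonzero-unit (τ (val u)) (τ (inv u))
  (ℤᴿ.mod-trans (+ 3) (ℤᴿ.mod-sym (+ 3) (τ-* (val u) (inv u))) (mod-λ⇒τ (mod8λ⇒modλ (val∙inv u))))

χ₄-∙ : ∀ u v → χ₄ (val (u ℤ₂₄.∙ v)) ≡ χ₄ (val u) ⊕ χ₄ (val v)
χ₄-∙ u v = χ₄-* (val u) (val v) (rational-odd u) (rational-odd v)

χ₃-∙ : ∀ u v → χ₃ (val (u ℤ₂₄.∙ v)) ≡ χ₃ (val u) ⊕ χ₃ (val v)
χ₃-∙ u v = χ₃-* (val u) (val v) (rational-nonzero u) (rational-nonzero v)

χ₁₂-∙ : ∀ u v → χ₁₂ (val (u ℤ₂₄.∙ v)) ≡ χ₁₂ (val u) ⊕ χ₁₂ (val v)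
χ₁₂-∙ u v = trans (cong₂ _⊕_ (χ₄-∙ u v) (χ₃-∙ u v))
  (interchange (χ₄ (val u)) (χ₄ (val v)) (χ₃ (val u)) (χ₃ (val v)))

κ-∙ : ∀ u v → κ (val (u O₈.∙ v)) ≡ κ (val u) ⊕ κ (val v)
κ-∙ u v = κ-* (val u) (val v) (eisenstein-odd u) (eisenstein-odd v)

ψ-∙ : ∀ u v → ψ (val (u O₈.∙ v)) ≡ ψ (val u) ⊕ ψ (val v)
ψ-∙ u v = ψ-* (val u) (val v) (eisenstein-odd u) (eisenstein-odd v)

χλ-∙ : ∀ u v → χλ (val (u O₈.∙ v)) ≡ χλ (val u) ⊕ χλ (val v)
χλ-∙ u v = χλ-* (val u) (val v) (eisenstein-nonzero u) (eisenstein-nonzero v)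

η-∙ : ∀ u v → η (val (u O₈.∙ v)) ≡ η (val u) ⊕ η (val v)
η-∙ u v = trans (cong₂ _⊕_ (ψ-∙ u v) (χλ-∙ u v))
  (interchange (ψ (val u)) (ψ (val v)) (χλ (val u)) (χλ (val v)))

foldCube-cong : ∀ {n} {v w : Vec Bool n → Parity} → (∀ h → v h ≡ w h) →
                foldCube _⊕_ v ≡ foldCube _⊕_ w
foldCube-cong {zero}  e = e []
foldCube-cong {suc n} e =
  cong₂ _⊕_ (foldCube-cong (e ∘ (false ∷_))) (foldCube-cong (e ∘ (true ∷_)))

foldCube-⊕ : ∀ {n} (v w : Vec Bool n → Parity) →
             foldCube _⊕_ (λ h → v h ⊕ w h) ≡ foldCube _⊕_ v ⊕ foldCube _⊕_ w
foldCube-⊕ {zero}  v w = refl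
foldCube-⊕ {suc n} v w = trans
  (cong₂ _⊕_ (foldCube-⊕ (v ∘ (false ∷_)) (w ∘ (false ∷_))) (foldCube-⊕ (v ∘ (true ∷_)) (w ∘ (true ∷_))))
  (interchange (foldCube _⊕_ (v ∘ (false ∷_))) (foldCube _⊕_ (w ∘ (false ∷_)))
               (foldCube _⊕_ (v ∘ (true ∷_))) (foldCube _⊕_ (w ∘ (true ∷_))))

-- These are the pairings of `v` with the basis 1, h₁, h₂, h₃ of the affine functions on the cube; a
-- coordinate function restricts the sum to a face.
moment : Fin 4 → (Index → Parity) → Parity
moment zero    v = foldCube _⊕_ v
moment (suc i) v = foldCube _⊕_ λ (h : Vec Bool 2) → v (insertAt h i true)

moment-cong : ∀ i {v w} → (∀ h → v h ≡ w h) → moment i v ≡ moment i w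
moment-cong zero    e = foldCube-cong e
moment-cong (suc i) e = foldCube-cong λ (h : Vec Bool 2) → e (insertAt h i true)

moment-⊕ : ∀ i v w → moment i (λ h → v h ⊕ w h) ≡ moment i v ⊕ moment i w
moment-⊕ zero    v w = foldCube-⊕ v w
moment-⊕ (suc i) v w = foldCube-⊕ {2} (λ h → v (insertAt h i true)) (λ h → w (insertAt h i true))

-- Good vectors on the faces of the cube

module Faces (R : CommutativeRing 0ℓ 0ℓ) (cancel₂ : Cancellable₂ R) where
  open CommutativeRing R using (Carrier; _≈_; _+_; +-congˡ; +-cong) renaming (trans to ≈-trans)
  open HadamardClosure R cancel₂ using (Good)

  -- On a two-dimensional face of the cube, Good amounts to even differences and a - b - c + x = 4f.
  record Face (a b c x : Carrier) : Set where
    field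
      d e f : Carrier
      a≈ : a ≈ c + ((d + (f + f)) + (d + (f + f)))
      b≈ : b ≈ x + (d + d)
      c≈ : c ≈ x + (e + e)

  FaceOf : (Vec Bool 2 → Carrier) → Set
  FaceOf v = Face (v (false ∷ false ∷ [])) (v (false ∷ true ∷ []))
                  (v (true ∷ false ∷ [])) (v (true ∷ true ∷ []))

  Good-face : ∀ v → Good {2} v → FaceOf v
  Good-face _ (_ , (_ , _ , e , _ , qe) , d , (_ , _ , f , _ , qf) , q) = record
    { a≈ = ≈-trans (q (false ∷ [])) (+-congˡ (+-cong (qf []) (qf [])))
    ; b≈ = q (true ∷ [])
    ; c≈ = qe []
    }

  -- `Good` splits along the first coordinate. For the other two directions its data are regrouped:
  -- the half-difference `d` along the first coordinate is itself `Good`, and its own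
  -- half-differences supply the term 4f.
  Good-faces : ∀ v → Good {3} v →
    FaceOf (λ h → v (false ∷ h)) × (∀ i → FaceOf (λ h → v (insertAt h i true)))
  Good-faces v (g₀ , g₁@(_ , (_ , _ , e , _ , qe) , d₁ , _ , q₁) , d ,
              (_ , (_ , _ , f₁ , _ , qf₁) , f , _ , qf) , q) =
    Good-face (λ h → v (false ∷ h)) g₀ , λ where
      0F → Good-face (λ h → v (true ∷ h)) g₁
      1F → record
        { a≈ = ≈-trans (q (true ∷ false ∷ [])) (+-congˡ (+-cong (qf₁ []) (qf₁ [])))
        ; b≈ = q (true ∷ true ∷ [])
        ; c≈ = qe []
        }
      2F → record
        { a≈ = ≈-trans (q (false ∷ true ∷ [])) (+-congˡ (+-cong (qf (true ∷ [])) (qf (true ∷ []))))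
        ; b≈ = q (true ∷ true ∷ [])
        ; c≈ = q₁ (true ∷ [])
        }

module ℤᶠ = Faces ℤ-ring ℤ-cancel₂
module Oᶠ = Faces O-ring O-cancel₂

-- The cube is the disjoint union of the first face and its opposite, so four faces account for all
-- four moments.
vanishing-moments : ∀ v → foldCube _⊕_ (λ (h : Vec Bool 2) → v (false ∷ h)) ≡ 0ℙ →
  (∀ i → foldCube _⊕_ (λ (h : Vec Bool 2) → v (insertAt h i true)) ≡ 0ℙ) → ∀ i → moment i v ≡ 0ℙ
vanishing-moments v p q zero    = cong₂ _⊕_ p (q 0F)
vanishing-moments v p q (suc i) = q i

module Mod2 = Residue 2

module _ where
  open Int using (_+_; _*_)

  -- Modulo 4 the corner x + 2e + 2d + 4f of a face depends only on x modulo 4 and on d and e modulo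
  -- 2, which leaves finitely many faces to check.
  face-cong : ∀ {x y e e′ d d′} f → x ≡ y modℤ (+ 4) → e ≡ e′ modℤ (+ 2) → d ≡ d′ modℤ (+ 2) →
    ((x + (e + e)) + ((d + (f + f)) + (d + (f + f)))) ≡ (y + (e′ + e′)) + (d′ + d′) modℤ (+ 4)
  face-cong {y = y} {e′ = e′} {d′ = d′} f p q r
    with k , refl ← ℤᴿ.mod-elim p | l , refl ← ℤᴿ.mod-elim q | m , refl ← ℤᴿ.mod-elim r =
    ℤᴿ.mod-intro (k + l + m + f) (eq y e′ d′ f k l m)
    where
    eq : ∀ y e d f k l m →
      (y + k * + 4 + ((e + l * + 2) + (e + l * + 2))) +
        ((d + m * + 2 + (f + f)) + (d + m * + 2 + (f + f))) ≡
      (y + (e + e)) + (d + d) + (k + l + m + f) * + 4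
    eq = ℤ-Solver.solve-∀

  edge-cong : ∀ {x y d d′} → x ≡ y modℤ (+ 4) → d ≡ d′ modℤ (+ 2) →
    (x + (d + d)) ≡ y + (d′ + d′) modℤ (+ 4)
  edge-cong {y = y} {d′ = d′} p r
    with k , refl ← ℤᴿ.mod-elim p | m , refl ← ℤᴿ.mod-elim r =
    ℤᴿ.mod-intro (k + m) (eq y d′ k m)
    where
    eq : ∀ y d k m →
      y + k * + 4 + ((d + m * + 2) + (d + m * + 2)) ≡ y + (d + d) + (k + m) * + 4
    eq = ℤ-Solver.solve-∀

-- Adding 2d to an odd integer changes `χ₄` by the parity of d. Over the corners x, x + 2d, x + 2e
-- and x + 2d + 2e these changes cancel.
χ₄-face : ∀ {a b c x} → bit₀ x ≡ 1ℙ → ℤᶠ.Face a b c x → (χ₄ a ⊕ χ₄ b) ⊕ (χ₄ c ⊕ χ₄ x) ≡ 0ℙ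
χ₄-face {x = x} odd-x record { d = d ; e = e ; f = f ; a≈ = refl ; b≈ = refl ; c≈ = refl } = trans
  (cong₂ _⊕_
    (cong₂ (λ a b → high a ⊕ high b)
      (Mod4.res-cong (face-cong f x≡ e≡ d≡)) (Mod4.res-cong (edge-cong x≡ d≡)))
    (cong (λ c → high c ⊕ χ₄ x) (Mod4.res-cong (edge-cong x≡ e≡))))
  (table (Mod4.res x) (Mod2.res e) (Mod2.res d) odd-x)
  where
  open Int using (_+_)
  x≡ = Mod4.res-sound x
  e≡ = Mod2.res-sound e
  d≡ = Mod2.res-sound d
  table : ∀ x e d → low x ≡ 1ℙ →
    (χ₄ (Mod4.⟦ x ⟧ + (Mod2.⟦ e ⟧ + Mod2.⟦ e ⟧) + (Mod2.⟦ d ⟧ + Mod2.⟦ d ⟧)) ⊕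
     χ₄ (Mod4.⟦ x ⟧ + (Mod2.⟦ d ⟧ + Mod2.⟦ d ⟧))) ⊕
    (χ₄ (Mod4.⟦ x ⟧ + (Mod2.⟦ e ⟧ + Mod2.⟦ e ⟧)) ⊕ high x) ≡ 0ℙ
  table = toWitness {a? = all? λ x → all? λ e → all? λ d → low x ℙ.≟ 1ℙ →-dec _ ℙ.≟ _} _

lift₂ : Fin 2 × Fin 2 → O
lift₂ (b , c) = Mod2.⟦ b ⟧ + Mod2.⟦ c ⟧ ω

-- Write the corners as x(1 + 2u). As (1 + 2u)(1 + 2v) ≡ 1 + 2(u + v) modulo 4, a character modulo 4
-- is additive in u, and u runs through 0, d/x, e/x and (d + e)/x modulo 2.
κψ-face : ∀ {a b c x} → odd x ≡ 1ℙ → Oᶠ.Face a b c x →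
  (κ a ⊕ κ b) ⊕ (κ c ⊕ κ x) ≡ 0ℙ × (ψ a ⊕ ψ b) ⊕ (ψ c ⊕ ψ x) ≡ 0ℙ
κψ-face {x = x} odd-x record { d = d ; e = e ; f = f ; a≈ = refl ; b≈ = refl ; c≈ = refl } =
  trans (reduce κR) (proj₁ values) , trans (reduce ψR) (proj₂ values)
  where
  res₂ : O → Fin 2 × Fin 2
  res₂ (b + c ω) = Mod2.res b , Mod2.res c
  edge : Residueᴼ → Fin 2 × Fin 2 → O
  edge x d = lift x +ᴼ (lift₂ d +ᴼ lift₂ d)
  corner : Residueᴼ → Fin 2 × Fin 2 → Fin 2 × Fin 2 → O
  corner x e d = edge x e +ᴼ (lift₂ d +ᴼ lift₂ d)
  reduce : ∀ (β : Residueᴼ → Parity) → _ ≡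
    (β (resᴼ (corner (resᴼ x) (res₂ e) (res₂ d))) ⊕ β (resᴼ (edge (resᴼ x) (res₂ d)))) ⊕
    (β (resᴼ (edge (resᴼ x) (res₂ e))) ⊕ β (resᴼ x))
  reduce β = cong₂ _⊕_
    (cong₂ (λ a b → β a ⊕ β b)
      (resᴼ-cong (mod4-intro
        (face-cong (O.re f) (Mod4.res-sound (O.re x)) (Mod2.res-sound (O.re e)) (Mod2.res-sound (O.re d)))
        (face-cong (O.im f) (Mod4.res-sound (O.im x)) (Mod2.res-sound (O.im e)) (Mod2.res-sound (O.im d)))))
      (resᴼ-cong (mod4-intro
        (edge-cong (Mod4.res-sound (O.re x)) (Mod2.res-sound (O.re d)))
        (edge-cong (Mod4.res-sound (O.im x)) (Mod2.res-sound (O.im d))))))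
    (cong (λ c → β c ⊕ β (resᴼ x))
      (resᴼ-cong (mod4-intro
        (edge-cong (Mod4.res-sound (O.re x)) (Mod2.res-sound (O.re e)))
        (edge-cong (Mod4.res-sound (O.im x)) (Mod2.res-sound (O.im e))))))
  Table : Residueᴼ → Fin 2 × Fin 2 → Fin 2 × Fin 2 → (Residueᴼ → Parity) → Set
  Table x e d β = (β (resᴼ (corner x e d)) ⊕ β (resᴼ (edge x d))) ⊕ (β (resᴼ (edge x e)) ⊕ β x) ≡ 0ℙ
  table : ∀ x e₁ e₂ d₁ d₂ → oddR x ≡ 1ℙ →
    Table x (e₁ , e₂) (d₁ , d₂) κR × Table x (e₁ , e₂) (d₁ , d₂) ψR
  table = toWitness {a? = allᴿ? λ x → all? λ e₁ → all? λ e₂ → all? λ d₁ → all? λ d₂ →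
    oddR x ℙ.≟ 1ℙ →-dec _ ℙ.≟ _ ×-dec _ ℙ.≟ _} _
  values = table (resᴼ x) (Mod2.res (O.re e)) (Mod2.res (O.im e)) (Mod2.res (O.re d)) (Mod2.res (O.im d)) odd-x

-- Characters of H

module _ (G : Group₀) where
  private module G = AbelianGroup G

  record Character (φ : G.Carrier → Parity) : Set where
    field
      homo   : ∀ x y → φ (x G.∙ y) ≡ φ x ⊕ φ y
      φ-cong : ∀ {x y} → x G.≈ y → φ x ≡ φ y

    φ-ε : φ G.ε ≡ 0ℙ
    φ-ε = ℙ.+-cancelˡ-≡ (φ G.ε) _ _ (trans (sym (homo G.ε G.ε))
      (trans (φ-cong (G.identityˡ G.ε)) (sym (ℙ.+-identityʳ _))))

    φ-⁻¹ : ∀ x → φ (x G.⁻¹) ≡ φ x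
    φ-⁻¹ x = ℙ.+-cancelˡ-≡ (φ x) _ _ (trans (sym (homo x (x G.⁻¹)))
      (trans (φ-cong (G.inverseʳ x)) (trans φ-ε (sym (ℙ.p+p≡0ℙ (φ x))))))

module _ {G : Group₀} {A B : Subgroup G} where
  private module G = AbelianGroup G

  descend : ∀ {φ} → Character G φ → (∀ x → Subgroup.Member A x → φ x ≡ 0ℙ) →
            (∀ x → Subgroup.Member B x → φ x ≡ 0ℙ) → Character (G /ˢ (G ·ˢ A) B) φ
  descend {φ} record { homo = homo ; φ-cong = φ-cong } on-A on-B = record
    { homo   = homo
    ; φ-cong = λ { {x} {y} (coset (a , b , a∈ , b∈ , e)) →
        trans (sym (φ-cong (AbelianGroupProperties.//-rightDividesˡ G y x)))
        (trans (homo (x G.- y) y)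
        (cong (_⊕ φ y) (trans (φ-cong e) (trans (homo a b) (cong₂ _⊕_ (on-A a a∈) (on-B b b∈)))))) }
    }

Z : |H| → Parity
Z g = foldCube _⊕_ λ h → χ₄ (rat g h)

y : |H| → Index → Parity
y g h = χ₁₂ (rat g h) ⊕ η (eis g h)

Y K : Fin 4 → |H| → Parity
Y i g = moment i (y g)
K i g = moment i λ h → κ (eis g h)

foldCube-0 : ∀ {n} {v : Vec Bool n → Parity} → (∀ h → v h ≡ 0ℙ) → foldCube _⊕_ v ≡ 0ℙ
foldCube-0 {zero}  e = e []
foldCube-0 {suc n} e = cong₂ _⊕_ (foldCube-0 (e ∘ (false ∷_))) (foldCube-0 (e ∘ (true ∷_)))

moment-0 : ∀ i {v} → (∀ h → v h ≡ 0ℙ) → moment i v ≡ 0ℙ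
moment-0 zero    e = foldCube-0 e
moment-0 (suc i) e = foldCube-0 {2} λ h → e (insertAt h i true)

-- That the product is again a sign is carried through the induction, since `χ₄` is additive on
-- products of odd integers only.
sign-product : ∀ {n} (ϵ : Vec Bool n → ℤ) → (∀ h → ϵ h ≡ 1ℤ ⊎ ϵ h ≡ -1ℤ) →
  (foldCube Int._*_ ϵ ≡ 1ℤ ⊎ foldCube Int._*_ ϵ ≡ -1ℤ) ×
  χ₄ (foldCube Int._*_ ϵ) ≡ foldCube _⊕_ (χ₄ ∘ ϵ)
sign-product {zero}  ϵ s = s [] , refl
sign-product {suc n} ϵ s with sign-product (ϵ ∘ (false ∷_)) (s ∘ (false ∷_))
                            | sign-product (ϵ ∘ (true ∷_)) (s ∘ (true ∷_))
... | p , e | q , f = combine p q e f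
  where
  combine : ∀ {a b α β} → a ≡ 1ℤ ⊎ a ≡ -1ℤ → b ≡ 1ℤ ⊎ b ≡ -1ℤ → χ₄ a ≡ α → χ₄ b ≡ β →
    (a Int.* b ≡ 1ℤ ⊎ a Int.* b ≡ -1ℤ) × χ₄ (a Int.* b) ≡ α ⊕ β
  combine (inj₁ refl) (inj₁ refl) refl refl = inj₁ refl , refl
  combine (inj₁ refl) (inj₂ refl) refl refl = inj₂ refl , refl
  combine (inj₂ refl) (inj₁ refl) refl refl = inj₂ refl , refl
  combine (inj₂ refl) (inj₂ refl) refl refl = inj₁ refl , refl

N-* : ∀ x y → N (x *ᴼ y) ≡ N x Int.* N y
N-* (a + b ω) (c + d ω) = eq a b c d
  where
  open Int using (_+_; _*_; _-_)
  eq : ∀ a b c d → (a * c - b * d) * (a * c - b * d)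
       - (a * c - b * d) * (a * d + b * c - b * d)
       + (a * d + b * c - b * d) * (a * d + b * c - b * d)
     ≡ (a * a - a * b + b * b) * (c * c - c * d + d * d)
  eq = ℤ-Solver.solve-∀

square-abs : ∀ a → a Int.* a ≡ + (Int.∣ a ∣ ℕ.* Int.∣ a ∣)
square-abs (+ n)    = sym (ℤₚ.pos-* n n)
square-abs -[1+ n ] = refl

-- A sum of squares gives both the positivity of the norm form and a bound on the coordinates of a
-- unit.
2N : ∀ b c → + 2 Int.* N (b + c ω) ≡
  + (Int.∣ b Int.- c ∣ ℕ.* Int.∣ b Int.- c ∣ ℕ.+ Int.∣ b ∣ ℕ.* Int.∣ b ∣ ℕ.+ Int.∣ c ∣ ℕ.* Int.∣ c ∣)
2N b c = trans (eq b c) (cong₂ Int._+_ (cong₂ Int._+_ (square-abs (b Int.- c)) (square-abs b)) (square-abs c))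
  where
  open Int using (_+_; _*_; _-_)
  eq : ∀ b c → + 2 * (b * b - b * c + c * c) ≡ (b - c) * (b - c) + b * b + c * c
  eq = ℤ-Solver.solve-∀

∣i∣≡1⇒i≡±1 : ∀ i → Int.∣ i ∣ ≡ 1 → i ≡ 1ℤ ⊎ i ≡ -1ℤ
∣i∣≡1⇒i≡±1 (+ 1)      _ = inj₁ refl
∣i∣≡1⇒i≡±1 -[1+ 0 ]   _ = inj₂ refl

N≢-1 : ∀ x → N x ≢ -1ℤ
N≢-1 (b + c ω) e = negative (trans (cong (+ 2 Int.*_) (sym e)) (2N b c))
  where
  negative : ∀ {n} → -[1+ 1 ] ≢ + n
  negative ()

N-unit : ∀ x y → x *ᴼ y ≡ fromℤ 1ℤ → N x ≡ 1ℤ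
N-unit x y e = fromInj₁ (⊥-elim ∘ N≢-1 x) (∣i∣≡1⇒i≡±1 (N x) (ℕₚ.m*n≡1⇒m≡1 Int.∣ N x ∣ Int.∣ N y ∣
  (trans (sym (ℤₚ.abs-* (N x) (N y))) (cong Int.∣_∣ (trans (sym (N-* x y)) (cong N e))))))

unit-bound : ∀ b c → N (b + c ω) ≡ 1ℤ → Int.∣ b ∣ ℕ.≤ 1 × Int.∣ c ∣ ℕ.≤ 1
unit-bound b c e = bound Int.∣ b ∣ (ℕₚ.≤-trans (ℕₚ.≤-trans (ℕₚ.m≤n+m _ s) (ℕₚ.m≤m+n _ _)) sum≤2)
                     , bound Int.∣ c ∣ (ℕₚ.≤-trans (ℕₚ.m≤n+m _ _) sum≤2)
  where
  s = Int.∣ b Int.- c ∣ ℕ.* Int.∣ b Int.- c ∣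
  sum≤2 : s ℕ.+ Int.∣ b ∣ ℕ.* Int.∣ b ∣ ℕ.+ Int.∣ c ∣ ℕ.* Int.∣ c ∣ ℕ.≤ 2
  sum≤2 = ℕₚ.≤-reflexive (ℤₚ.+-injective (trans (sym (2N b c)) (cong (+ 2 Int.*_) e)))
  bound : ∀ n → n ℕ.* n ℕ.≤ 2 → n ℕ.≤ 1
  bound 0 _ = ℕ.z≤n
  bound 1 _ = ℕ.s≤s ℕ.z≤n
  bound (suc (suc n)) p = contradiction
    (ℕₚ.≤-trans (ℕₚ.*-mono-≤ {2} {suc (suc n)} {2} {suc (suc n)} 2≤ 2≤) p) λ { (ℕ.s≤s (ℕ.s≤s ())) }
    where
    2≤ : 2 ℕ.≤ suc (suc n)
    2≤ = ℕ.s≤s (ℕ.s≤s ℕ.z≤n)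

characters-of-μ₆ : ∀ x → N x ≡ 1ℤ → κ x ≡ 0ℙ × η x ≡ 0ℙ
characters-of-μ₆ x@(b + c ω) e = cases b c (unit-bound b c e) e
  where
  cases : ∀ b c → Int.∣ b ∣ ℕ.≤ 1 × Int.∣ c ∣ ℕ.≤ 1 → N (b + c ω) ≡ 1ℤ →
          κ (b + c ω) ≡ 0ℙ × η (b + c ω) ≡ 0ℙ
  cases (+ 0) (+ 0) _ ()
  cases (+ 0) (+ 1) _ _ = refl , refl
  cases (+ 0) -[1+ 0 ] _ _ = refl , refl
  cases (+ 1) (+ 0) _ _ = refl , refl
  cases (+ 1) (+ 1) _ _ = refl , refl
  cases (+ 1) -[1+ 0 ] _ ()
  cases -[1+ 0 ] (+ 0) _ _ = refl , refl
  cases -[1+ 0 ] (+ 1) _ ()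
  cases -[1+ 0 ] -[1+ 0 ] _ _ = refl , refl
  cases (+ suc (suc _)) _ (ℕ.s≤s () , _)
  cases -[1+ suc _ ] _ (ℕ.s≤s () , _)
  cases (+ 0) (+ suc (suc _)) (_ , ℕ.s≤s ())
  cases (+ 1) (+ suc (suc _)) (_ , ℕ.s≤s ())
  cases -[1+ 0 ] (+ suc (suc _)) (_ , ℕ.s≤s ())
  cases (+ 0) -[1+ suc _ ] (_ , ℕ.s≤s ())
  cases (+ 1) -[1+ suc _ ] (_ , ℕ.s≤s ())
  cases -[1+ 0 ] -[1+ suc _ ] (_ , ℕ.s≤s ())

module _ (g : |H|) (g∈ : Subgroup.Member L g) where
  private
    rat-faces = ℤᶠ.Good-faces (rat g) (ℤᶜ.divisible⇒Good (proj₁ (proj₂ g∈)))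
    eis-faces = Oᶠ.Good-faces (eis g) (Oᶜ.divisible⇒Good (proj₂ (proj₂ g∈)))

    χ₄-moments : ∀ i → moment i (χ₄ ∘ rat g) ≡ 0ℙ
    χ₄-moments = vanishing-moments (χ₄ ∘ rat g)
      (χ₄-face (rational-odd (proj₁ (g _))) (proj₁ rat-faces))
      λ i → χ₄-face (rational-odd (proj₁ (g (insertAt (true ∷ true ∷ []) i true)))) (proj₂ rat-faces i)

    ψ-moments : ∀ i → moment i (ψ ∘ eis g) ≡ 0ℙ
    ψ-moments = vanishing-moments (ψ ∘ eis g)
      (proj₂ (κψ-face (eisenstein-odd (proj₂ (g _))) (proj₁ eis-faces)))
      λ i → proj₂ (κψ-face (eisenstein-odd (proj₂ (g (insertAt (true ∷ true ∷ []) i true)))) (proj₂ eis-faces i))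

  Z-L : Z g ≡ 0ℙ
  Z-L = χ₄-moments 0F

  K-L : ∀ i → K i g ≡ 0ℙ
  K-L = vanishing-moments (κ ∘ eis g)
    (proj₁ (κψ-face (eisenstein-odd (proj₂ (g _))) (proj₁ eis-faces)))
    λ i → proj₁ (κψ-face (eisenstein-odd (proj₂ (g (insertAt (true ∷ true ∷ []) i true)))) (proj₂ eis-faces i))

  -- The congruence of the two components modulo λ makes `χ₃` and `χλ` cancel; what remains are the
  -- moments of `χ₄` and `ψ`, which vanish by the face relations.
  Y-L : ∀ i → Y i g ≡ 0ℙ
  Y-L i = trans (moment-cong i {w = λ h → χ₄ (rat g h) ⊕ ψ (eis g h)} λ h →
      trans (interchange (χ₄ (rat g h)) (χ₃ (rat g h)) (ψ (eis g h)) (χλ (eis g h)))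
      (trans (cong ((χ₄ (rat g h) ⊕ ψ (eis g h)) ⊕_)
        (trans (cong (χ₃ (rat g h) ⊕_) (sym (same h))) (ℙ.p+p≡0ℙ (χ₃ (rat g h)))))
             (ℙ.+-identityʳ _)))
    (trans (moment-⊕ i (χ₄ ∘ rat g) (ψ ∘ eis g)) (cong₂ _⊕_ (χ₄-moments i) (ψ-moments i)))
    where
    same : ∀ h → χ₃ (rat g h) ≡ χλ (eis g h)
    same h = trans (cong χ₃ (sym (ℤₚ.+-identityʳ (rat g h)))) (χλ-cong (proj₁ g∈ h))

ξ-characters : ∀ g → Subgroup.Member E⁺ g → ∀ h → κ (eis g h) ≡ 0ℙ × η (eis g h) ≡ 0ℙ
ξ-characters g (_ , ξ , _ , _ , _ , q) h =
  trans (κ-cong (q h)) (proj₁ trivial) ,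
  trans (cong₂ _⊕_ (ψ-cong (q h)) (χλ-cong (mod8λ⇒modλ (q h)))) (proj₂ trivial)
  where trivial = characters-of-μ₆ (val (ξ h)) (N-unit (val (ξ h)) (inv (ξ h)) (val∙inv (ξ h)))

-- This is where the product of the signs being 1 enters: each sign -1 contributes 1 to `Z`.
Z-E⁺ : ∀ g → Subgroup.Member E⁺ g → Z g ≡ 0ℙ
Z-E⁺ g (ϵ , _ , s , t , p , _) =
  trans (foldCube-cong (λ h → χ₄-cong (p h))) (trans (sym (proj₂ (sign-product ϵ s))) (cong χ₄ t))

K-E⁺ : ∀ g → Subgroup.Member E⁺ g → ∀ i → K i g ≡ 0ℙ
K-E⁺ g g∈ i = moment-0 i (proj₁ ∘ ξ-characters g g∈)

Y-E⁺ : ∀ g → Subgroup.Member E⁺ g → ∀ i → Y i g ≡ 0ℙ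
Y-E⁺ g g∈@(ϵ , _ , s , _ , p , _) i = moment-0 i λ h →
  cong₂ _⊕_ (trans (cong₂ _⊕_ (χ₄-cong (p h)) (χ₃-cong (p h))) (χ₁₂-sign (s h))) (proj₂ (ξ-characters g g∈ h))
  where
  χ₁₂-sign : ∀ {x} → x ≡ 1ℤ ⊎ x ≡ -1ℤ → χ₁₂ x ≡ 0ℙ
  χ₁₂-sign (inj₁ refl) = refl
  χ₁₂-sign (inj₂ refl) = refl

y-∙ : ∀ x x′ h → y (x Γ.∙ x′) h ≡ y x h ⊕ y x′ h
y-∙ x x′ h = trans
  (cong₂ _⊕_ (χ₁₂-∙ (proj₁ (x h)) (proj₁ (x′ h))) (η-∙ (proj₂ (x h)) (proj₂ (x′ h))))
  (interchange (χ₁₂ (rat x h)) (χ₁₂ (rat x′ h)) (η (eis x h)) (η (eis x′ h)))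

Z-character : Character H Z
Z-character = descend {Γ} {E⁺} {L} record
  { homo   = λ x x′ → trans (foldCube-cong λ h → χ₄-∙ (proj₁ (x h)) (proj₁ (x′ h)))
                            (foldCube-⊕ (χ₄ ∘ rat x) (χ₄ ∘ rat x′))
  ; φ-cong = λ e → foldCube-cong λ h → χ₄-cong (proj₁ (e h))
  } Z-E⁺ Z-L

Y-character : ∀ i → Character H (Y i)
Y-character i = descend {Γ} {E⁺} {L} record
  { homo   = λ x x′ → trans (moment-cong i (y-∙ x x′)) (moment-⊕ i (y x) (y x′))
  ; φ-cong = λ e → moment-cong i λ h →
      cong₂ _⊕_ (cong₂ _⊕_ (χ₄-cong (proj₁ (e h))) (χ₃-cong (proj₁ (e h))))
                (cong₂ _⊕_ (ψ-cong (proj₂ (e h))) (χλ-cong (mod8λ⇒modλ (proj₂ (e h)))))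
  } (λ x x∈ → Y-E⁺ x x∈ i) (λ x x∈ → Y-L x x∈ i)

K-character : ∀ i → Character H (K i)
K-character i = descend {Γ} {E⁺} {L} record
  { homo   = λ x x′ → trans (moment-cong i λ h → κ-∙ (proj₂ (x h)) (proj₂ (x′ h)))
                            (moment-⊕ i (κ ∘ eis x) (κ ∘ eis x′))
  ; φ-cong = λ e → moment-cong i λ h → κ-cong (proj₂ (e h))
  } (λ x x∈ → K-E⁺ x x∈ i) (λ x x∈ → K-L x x∈ i)

-- Balanced vectors

allℙ? : ∀ {P : Parity → Set} → (∀ p → Dec (P p)) → Dec (∀ p → P p)
allℙ? P? = map′ (λ { (p₀ , p₁) → λ { 0ℙ → p₀ ; 1ℙ → p₁ } }) (λ p → p 0ℙ , p 1ℙ) (P? 0ℙ ×-dec P? 1ℙ)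

-- A first-order copy of the functions on the cube. `allBits?` can run through it, and results are
-- carried back pointwise, without function extensionality.
Bits : ℕ → Set
Bits zero    = Parity
Bits (suc n) = Bits n × Bits n

cube : ∀ {n} → Bits n → Vec Bool n → Parity
cube p       []          = p
cube (p , _) (false ∷ h) = cube p h
cube (_ , q) (true ∷ h)  = cube q h

bits : ∀ {n} → (Vec Bool n → Parity) → Bits n
bits {zero}  v = v []
bits {suc n} v = bits (v ∘ (false ∷_)) , bits (v ∘ (true ∷_))

cube-bits : ∀ {n} (v : Vec Bool n → Parity) h → cube (bits v) h ≡ v h
cube-bits v []          = refl
cube-bits v (false ∷ h) = cube-bits (v ∘ (false ∷_)) h
cube-bits v (true ∷ h)  = cube-bits (v ∘ (true ∷_)) h

allBits? : ∀ {n} {P : Bits n → Set} → (∀ p → Dec (P p)) → Dec (∀ p → P p)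
allBits? {zero}  P? = allℙ? P?
allBits? {suc n} P? = map′ (λ f p → f (proj₁ p) (proj₂ p)) (λ f p q → f (p , q))
  (allBits? λ p → allBits? λ q → P? (p , q))

allVertices? : ∀ {n} {P : Vec Bool n → Set} → (∀ h → Dec (P h)) → Dec (∀ h → P h)
allVertices? {zero}  P? = map′ (λ { p [] → p }) (λ p → p []) (P? [])
allVertices? {suc n} P? =
  map′ (λ { (p , q) (false ∷ h) → p h ; (p , q) (true ∷ h) → q h }) (λ p → (p ∘ (false ∷_)) , (p ∘ (true ∷_)))
    (allVertices? (λ h → P? (false ∷ h)) ×-dec allVertices? (λ h → P? (true ∷ h)))

Balanced : (Index → Parity) → Set
Balanced v = ∀ i → moment i v ≡ 0ℙ

balanced? : ∀ v → Dec (Balanced v)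
balanced? v = all? λ i → moment i v ℙ.≟ 0ℙ

balanced-bits : ∀ v → Balanced v → Balanced (cube (bits v))
balanced-bits v p i = trans (moment-cong i (cube-bits v)) (p i)

-- The balanced vectors are the affine functions, a self-dual code.
balanced-⊗ : ∀ v w → Balanced v → Balanced w → foldCube _⊕_ (λ h → v h ⊗ w h) ≡ 0ℙ
balanced-⊗ v w p q = trans (foldCube-cong λ h → sym (cong₂ _⊗_ (cube-bits v h) (cube-bits w h)))
  (table (bits v) (balanced-bits v p) (bits w) (balanced-bits w q))
  where
  table : ∀ v → Balanced (cube v) → ∀ w → Balanced (cube w) →
          foldCube _⊕_ (λ (h : Index) → cube v h ⊗ cube w h) ≡ 0ℙ
  table = toWitness {a? = allBits? λ v → balanced? (cube v) →-dec
    (allBits? λ w → balanced? (cube w) →-dec foldCube _⊕_ (λ (h : Index) → cube v h ⊗ cube w h) ℙ.≟ 0ℙ)} _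

-- An affine map to F₄ that omits 0 omits a second value.
omits-0 : ∀ v w → Balanced v → Balanced w → (∀ h → v h ≡ 1ℙ ⊎ w h ≡ 1ℙ) →
  (∀ h → w h ≡ 1ℙ) ⊎ (∀ h → v h ≡ 1ℙ) ⊎ (∀ h → v h ⊕ w h ≡ 1ℙ)
omits-0 v w p q r = Sum.map
  (λ f h → trans (sym (cube-bits w h)) (f h))
  (Sum.map (λ f h → trans (sym (cube-bits v h)) (f h))
           (λ f h → trans (sym (cong₂ _⊕_ (cube-bits v h) (cube-bits w h))) (f h)))
  (table (bits v) (balanced-bits v p) (bits w) (balanced-bits w q)
    λ h → Sum.map (trans (cube-bits v h)) (trans (cube-bits w h)) (r h))
  where
  table : ∀ v → Balanced (cube v) → ∀ w → Balanced (cube w) →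
          (∀ h → cube {3} v h ≡ 1ℙ ⊎ cube {3} w h ≡ 1ℙ) →
          (∀ h → cube {3} w h ≡ 1ℙ) ⊎ (∀ h → cube {3} v h ≡ 1ℙ) ⊎ (∀ h → cube {3} v h ⊕ cube {3} w h ≡ 1ℙ)
  table = toWitness {a? = allBits? λ v → balanced? (cube v) →-dec
    (allBits? λ w → balanced? (cube w) →-dec
      (allVertices? λ h → cube v h ℙ.≟ 1ℙ ⊎-dec cube w h ℙ.≟ 1ℙ) →-dec
      ((allVertices? λ h → cube w h ℙ.≟ 1ℙ) ⊎-dec (allVertices? λ h → cube v h ℙ.≟ 1ℙ)
        ⊎-dec (allVertices? λ h → cube v h ⊕ cube w h ℙ.≟ 1ℙ)))} _

-- This is the coordinate of the transform W v at the all-ones vector.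
alt : ∀ {n} → (Vec Bool n → ℤ) → ℤ
alt {zero}  v = v []
alt {suc n} v = alt (v ∘ (false ∷_)) Int.- alt (v ∘ (true ∷_))

alt-cong : ∀ {n} {v w : Vec Bool n → ℤ} → (∀ h → v h ≡ w h) → alt v ≡ alt w
alt-cong {zero}  e = e []
alt-cong {suc n} e = cong₂ Int._-_ (alt-cong (e ∘ (false ∷_))) (alt-cong (e ∘ (true ∷_)))

alt-+ : ∀ {n} (v w : Vec Bool n → ℤ) → alt (λ h → v h Int.+ w h) ≡ alt v Int.+ alt w
alt-+ {zero}  v w = refl
alt-+ {suc n} v w = trans
  (cong₂ Int._-_ (alt-+ (v ∘ (false ∷_)) (w ∘ (false ∷_))) (alt-+ (v ∘ (true ∷_)) (w ∘ (true ∷_))))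
  (eq (alt (v ∘ (false ∷_))) (alt (w ∘ (false ∷_))) (alt (v ∘ (true ∷_))) (alt (w ∘ (true ∷_))))
  where
  open Int using (_+_; _-_)
  eq : ∀ a b c d → (a + b) - (c + d) ≡ (a - c) + (b - d)
  eq = ℤ-Solver.solve-∀

-- Substituting v₀ = v₁ + 2d cancels the contribution of v₁, so each dimension yields one factor 2.
Good-alt : ∀ {n} (v : Vec Bool n → ℤ) → ℤᶜ.Good v → ∃[ f ] alt v ≡ f Int.* + (2 ℕ.^ n)
Good-alt {zero}  v _ = v [] , sym (ℤₚ.*-identityʳ (v []))
Good-alt {suc n} v (_ , _ , d , good-d , q) with f , e ← Good-alt d good-d = f , (begin
  alt v₀ - alt v₁                          ≡⟨ cong (_- alt v₁) (alt-cong q) ⟩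
  alt (λ h → v₁ h + (d h + d h)) - alt v₁  ≡⟨ cong (_- alt v₁) (alt-+ v₁ (λ h → d h + d h)) ⟩
  alt v₁ + alt (λ h → d h + d h) - alt v₁  ≡⟨ cong (λ x → alt v₁ + x - alt v₁) (alt-+ d d) ⟩
  alt v₁ + (alt d + alt d) - alt v₁        ≡⟨ cong (λ x → alt v₁ + (x + x) - alt v₁) e ⟩
  alt v₁ + (f * + (2 ℕ.^ n) + f * + (2 ℕ.^ n)) - alt v₁
                                           ≡⟨ eq (alt v₁) f (+ (2 ℕ.^ n)) ⟩
  f * (+ 2 * + (2 ℕ.^ n))                  ≡⟨ cong (f *_) (ℤₚ.pos-* 2 (2 ℕ.^ n)) ⟨
  f * + (2 ℕ.^ suc n)                      ∎)
  where
  open Int using (_+_; _*_; _-_)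
  open ≡-Reasoning
  v₀ = v ∘ (false ∷_)
  v₁ = v ∘ (true ∷_)
  eq : ∀ a f p → a + (f * p + f * p) - a ≡ f * (+ 2 * p)
  eq = ℤ-Solver.solve-∀

res₄-difference : ∀ x y → Mod4.res (x Int.- y) ≡ Mod4.res (Mod4.⟦ Mod4.res x ⟧ Int.- Mod4.⟦ Mod4.res y ⟧)
res₄-difference x y with k , e ← ℤᴿ.mod-elim (Mod4.res-sound x) | l , f ← ℤᴿ.mod-elim (Mod4.res-sound y) =
  Mod4.res-cong {x - y} {Mod4.⟦ Mod4.res x ⟧ - Mod4.⟦ Mod4.res y ⟧} (ℤᴿ.mod-intro (k - l)
    (trans (cong₂ _-_ e f) (eq Mod4.⟦ Mod4.res x ⟧ Mod4.⟦ Mod4.res y ⟧ k l)))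
  where
  open Int using (_+_; _*_; _-_)
  eq : ∀ a b k l → (a + k * + 4) - (b + l * + 4) ≡ (a - b) + (k - l) * + 4
  eq = ℤ-Solver.solve-∀

-- When the low bits agree, subtraction modulo 4 has no borrow, and the high bits add.
difference : ∀ x y → bit₀ x ≡ bit₀ y → bit₀ (x Int.- y) ≡ 0ℙ × χ₄ (x Int.- y) ≡ χ₄ x ⊕ χ₄ y
difference x y p = map (trans (cong low (res₄-difference x y))) (trans (cong high (res₄-difference x y)))
  (table (Mod4.res x) (Mod4.res y) p)
  where
  table : ∀ r s → low r ≡ low s → bit₀ (Mod4.⟦ r ⟧ Int.- Mod4.⟦ s ⟧) ≡ 0ℙ ×
                                  χ₄ (Mod4.⟦ r ⟧ Int.- Mod4.⟦ s ⟧) ≡ high r ⊕ high s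
  table = toWitness {a? = all? λ r → all? λ s → low r ℙ.≟ low s →-dec
    bit₀ (Mod4.⟦ r ⟧ Int.- Mod4.⟦ s ⟧) ℙ.≟ 0ℙ ×-dec χ₄ (Mod4.⟦ r ⟧ Int.- Mod4.⟦ s ⟧) ℙ.≟ high r ⊕ high s} _

-- After the first subtraction all terms are even, so `difference` keeps applying. On the even
-- number `alt v`, `χ₄` is merely the second binary digit.
χ₄-alt : ∀ {n} (v : Vec Bool (suc n) → ℤ) → (∀ h → bit₀ (v h) ≡ 1ℙ) →
  bit₀ (alt v) ≡ 0ℙ × χ₄ (alt v) ≡ foldCube _⊕_ (χ₄ ∘ v)
χ₄-alt {zero}  v odd-v = difference (v (false ∷ [])) (v (true ∷ []))
  (trans (odd-v (false ∷ [])) (sym (odd-v (true ∷ []))))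
χ₄-alt {suc n} v odd-v
  with p , e ← χ₄-alt (v ∘ (false ∷_)) (odd-v ∘ (false ∷_)) | q , f ← χ₄-alt (v ∘ (true ∷_)) (odd-v ∘ (true ∷_)) =
  map₂ (λ g → trans g (cong₂ _⊕_ e f)) (difference (alt (v ∘ (false ∷_))) (alt (v ∘ (true ∷_))) (trans p (sym q)))

bit₀-+ : ∀ x y → bit₀ (x Int.+ y) ≡ bit₀ x ⊕ bit₀ y
bit₀-+ x y = trans (cong low (Mod4.res-+ x y)) (table (Mod4.res x) (Mod4.res y))
  where
  table : ∀ r s → bit₀ (Mod4.⟦ r ⟧ Int.+ Mod4.⟦ s ⟧) ≡ low r ⊕ low s
  table = toWitness {a? = all? λ r → all? λ s → bit₀ (Mod4.⟦ r ⟧ Int.+ Mod4.⟦ s ⟧) ℙ.≟ low r ⊕ low s} _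

halve-multiple : ∀ x f → x Int.+ x ≡ f Int.* + 8 → x ≡ 0ℤ modℤ (+ 4)
halve-multiple x f e = ℤᴿ.mod-intro f (trans (ℤ-cancel₂ x (f * + 4) (trans e (eq f)))
  (sym (ℤₚ.+-identityˡ (f * + 4))))
  where
  open Int using (_+_; _*_)
  eq : ∀ f → f * + 8 ≡ f * + 4 + f * + 4
  eq = ℤ-Solver.solve-∀

halve-sum : ∀ a c d → a Int.+ a ≡ c Int.+ c Int.+ (d Int.+ d) → bit₀ a ≡ bit₀ c ⊕ bit₀ d
halve-sum a c d e = trans (cong bit₀ (ℤ-cancel₂ a (c + d) (trans e (eq c d)))) (bit₀-+ c d)
  where
  open Int using (_+_)
  eq : ∀ x d → x + x + (d + d) ≡ (x + d) + (x + d)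
  eq = ℤ-Solver.solve-∀

bit₀-+-double : ∀ d f → bit₀ (d Int.+ (f Int.+ f)) ≡ bit₀ d
bit₀-+-double d f = trans (bit₀-+ d (f Int.+ f))
  (trans (cong (bit₀ d ⊕_) (trans (bit₀-+ f f) (ℙ.p+p≡0ℙ (bit₀ f)))) (ℙ.+-identityʳ (bit₀ d)))

-- Vectors v with W v ∈ 4 ℤ⁸.
module _ (v : Index → ℤ) (good : ℤᶜ.Good {3} (λ h → v h Int.+ v h)) where

  -- Divisibility of `alt` of the doubled vector by 8 makes `alt v` a multiple of 4, and its second
  -- binary digit is the sum in question.
  Good₂-χ₄ : (∀ h → bit₀ (v h) ≡ 1ℙ) → foldCube _⊕_ (χ₄ ∘ v) ≡ 0ℙ
  Good₂-χ₄ odd-v = let f , e = Good-alt (λ h → v h Int.+ v h) good in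
    trans (sym (proj₂ (χ₄-alt v odd-v)))
      (cong high (Mod4.res-cong {alt v} {0ℤ} (halve-multiple (alt v) f (trans (sym (alt-+ v v)) e))))

  -- Halving the face relations gives a = c + d + 2f and b = x + d, so a + b + c + x is even on
  -- every face.
  Good₂-balanced : Balanced (bit₀ ∘ v)
  Good₂-balanced = vanishing-moments (bit₀ ∘ v)
    (face (λ h → v (false ∷ h)) (proj₁ faces)) (λ i → face (λ h → v (insertAt h i true)) (proj₂ faces i))
    where
    open Int using (_+_)
    faces = ℤᶠ.Good-faces (λ h → v h + v h) good
    face-sum : ∀ {a b} {c x d : Parity} → a ≡ c ⊕ d → b ≡ x ⊕ d → (a ⊕ b) ⊕ (c ⊕ x) ≡ 0ℙ
    face-sum {c = c} {x} {d} refl refl = table c x d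
      where
      table : ∀ c x d → ((c ⊕ d) ⊕ (x ⊕ d)) ⊕ (c ⊕ x) ≡ 0ℙ
      table = toWitness {a? = allℙ? λ c → allℙ? λ x → allℙ? λ d → ((c ⊕ d) ⊕ (x ⊕ d)) ⊕ (c ⊕ x) ℙ.≟ 0ℙ} _
    face : ∀ (w : Vec Bool 2 → ℤ) → ℤᶠ.FaceOf (λ h → w h + w h) → foldCube _⊕_ (bit₀ ∘ w) ≡ 0ℙ
    face w record { d = d ; f = f ; a≈ = a≈ ; b≈ = b≈ } = face-sum
      {c = bit₀ (w (true ∷ false ∷ []))} {bit₀ (w (true ∷ true ∷ []))} {bit₀ d}
      (trans (halve-sum (w (false ∷ false ∷ [])) (w (true ∷ false ∷ [])) (d + (f + f)) a≈)
             (cong (bit₀ (w (true ∷ false ∷ [])) ⊕_) (bit₀-+-double d f)))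
      (halve-sum (w (false ∷ true ∷ [])) (w (true ∷ true ∷ [])) d b≈)

Good-map : ∀ (F : O → ℤ) → (∀ x y → F (x +ᴼ y) ≡ F x Int.+ F y) →
           ∀ {n} (v : Vec Bool n → O) → Oᶜ.Good v → ℤᶜ.Good (F ∘ v)
Good-map F F-+ {zero}  v _ = tt
Good-map F F-+ {suc n} v (g₀ , g₁ , d , good-d , q) =
  Good-map F F-+ (v ∘ (false ∷_)) g₀ , Good-map F F-+ (v ∘ (true ∷_)) g₁ , F ∘ d , Good-map F F-+ d good-d ,
  λ h → trans (cong F (q h)) (trans (F-+ (v (true ∷ h)) (d h +ᴼ d h))
    (cong (λ x → F (v (true ∷ h)) Int.+ x) (F-+ (d h) (d h))))

-- Constraints on R and Q

foldCube-parity : ∀ {n} (e : Vec Bool n → ℕ) → foldCube _⊕_ (parity ∘ e) ≡ parity (foldCube ℕ._+_ e)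
foldCube-parity {zero}  e = refl
foldCube-parity {suc n} e = trans
  (cong₂ _⊕_ (foldCube-parity (e ∘ (false ∷_))) (foldCube-parity (e ∘ (true ∷_))))
  (sym (ℙ.+-homo-+ (foldCube ℕ._+_ (e ∘ (false ∷_))) (foldCube ℕ._+_ (e ∘ (true ∷_)))))

foldCube-≥ : ∀ {n} (e : Vec Bool n → ℕ) → (∀ h → 0 ℕ.< e h) → 2 ℕ.^ n ℕ.≤ foldCube ℕ._+_ e
foldCube-≥ {zero}  e p = p []
foldCube-≥ {suc n} e p = ℕₚ.≤-trans (ℕₚ.≤-reflexive (cong (2 ℕ.^ n ℕ.+_) (ℕₚ.+-identityʳ (2 ℕ.^ n))))
  (ℕₚ.+-mono-≤ (foldCube-≥ (e ∘ (false ∷_)) (p ∘ (false ∷_))) (foldCube-≥ (e ∘ (true ∷_)) (p ∘ (true ∷_))))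

-- Applied with total 8: on `R⟨ 8 ⟩` and `Q⟨ 8 ⟩` all exponents are 1, so the divisibility condition
-- becomes one on a doubled vector.
foldCube-minimal : ∀ {n} (e : Vec Bool n → ℕ) → (∀ h → 0 ℕ.< e h) →
                   foldCube ℕ._+_ e ℕ.≤ 2 ℕ.^ n → ∀ h → e h ≡ 1
foldCube-minimal {zero}  e p q [] = ℕₚ.≤-antisym q (p [])
foldCube-minimal {suc n} e p q = λ where
    (false ∷ h) → foldCube-minimal (e ∘ (false ∷_)) (p ∘ (false ∷_))
      (ℕₚ.+-cancelʳ-≤ (2 ℕ.^ n) _ _ (ℕₚ.≤-trans (ℕₚ.+-monoʳ-≤ (foldCube ℕ._+_ (e ∘ (false ∷_))) lower₁) q′)) h
    (true ∷ h)  → foldCube-minimal (e ∘ (true ∷_)) (p ∘ (true ∷_))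
      (ℕₚ.+-cancelˡ-≤ (2 ℕ.^ n) _ _ (ℕₚ.≤-trans (ℕₚ.+-monoˡ-≤ (foldCube ℕ._+_ (e ∘ (true ∷_))) lower₀) q′)) h
  where
  lower₀ = foldCube-≥ (e ∘ (false ∷_)) (p ∘ (false ∷_))
  lower₁ = foldCube-≥ (e ∘ (true ∷_)) (p ∘ (true ∷_))
  q′ : foldCube ℕ._+_ e ℕ.≤ 2 ℕ.^ n ℕ.+ 2 ℕ.^ n
  q′ = ℕₚ.≤-trans q (ℕₚ.≤-reflexive (cong (2 ℕ.^ n ℕ.+_) (ℕₚ.+-identityʳ (2 ℕ.^ n))))

-- 17 is 1 modulo 4 and -1 modulo λ.
characters-of-17^ : ∀ n → κ (fromℤ (+ (17 ℕ.^ (n ℕ.% 2)))) ≡ 0ℙ × η (fromℤ (+ (17 ℕ.^ (n ℕ.% 2)))) ≡ parity n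
characters-of-17^ zero          = refl , refl
characters-of-17^ (suc zero)    = refl , refl
characters-of-17^ (suc (suc n)) = characters-of-17^ n

χ₃-of-1mod6 : ∀ {x} → Any (λ u → x ≡ u modℤ (+ 24)) (+ 1 ∷ + 7 ∷ + 13 ∷ + 19 ∷ []) → χ₃ x ≡ 0ℙ
χ₃-of-1mod6 (here p)                         = χ₃-cong p
χ₃-of-1mod6 (there (here p))                 = χ₃-cong p
χ₃-of-1mod6 (there (there (here p)))         = χ₃-cong p
χ₃-of-1mod6 (there (there (there (here p)))) = χ₃-cong p

module Zᶜʰ = Character Z-character
module Yᶜʰ i = Character (Y-character i)
module Kᶜʰ i = Character (K-character i)

K-of-R[] : ∀ e x → R[ e ] x → ∀ i → K i x ≡ 0ℙ
K-of-R[] e x (g , _ , q , _ , x≈g) i = trans (Kᶜʰ.φ-cong i {x} {g} x≈g)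
  (moment-0 i λ h → trans (κ-cong (q h)) (proj₁ (characters-of-17^ (e h))))

cancel : ∀ a {b c d} → b ≡ 0ℙ → c ≡ d → a ⊕ ((a ⊕ b) ⊕ c) ≡ d
cancel 0ℙ refl refl = refl
cancel 1ℙ refl refl = ℙ.⁻¹-involutive _

-- At each vertex the two copies of χ₄(u_h) cancel and χ₃(u_h) vanishes, which leaves η(17^e_h), the
-- parity of e_h.
ZY-of-R[] : ∀ e x → R[ e ] x → Z x ⊕ Y 0F x ≡ parity (foldCube ℕ._+_ e)
ZY-of-R[] e x (g , p , q , _ , x≈g) = trans (cong₂ _⊕_ (Zᶜʰ.φ-cong {x} {g} x≈g) (Yᶜʰ.φ-cong 0F {x} {g} x≈g))
  (trans (sym (foldCube-⊕ (χ₄ ∘ rat g) (y g)))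
  (trans (foldCube-cong {w = parity ∘ e} at-h) (foldCube-parity e)))
  where
  η-γ : ∀ h → η (eis g h) ≡ parity (e h)
  η-γ h = trans (cong₂ _⊕_ (ψ-cong (q h)) (χλ-cong (mod8λ⇒modλ (q h)))) (proj₂ (characters-of-17^ (e h)))
  at-h : ∀ h → χ₄ (rat g h) ⊕ y g h ≡ parity (e h)
  at-h h = cancel (χ₄ (rat g h)) (χ₃-of-1mod6 (p h)) (η-γ h)

K-of-R : ∀ a x → R⟨ a ⟩ x → ∀ i → K i x ≡ 0ℙ
K-of-R zero    x x≈0 i = trans (Kᶜʰ.φ-cong i {x} {0ᴴ} x≈0) (Kᶜʰ.φ-ε i)
K-of-R (suc _) x (e , _ , _ , x∈) i = K-of-R[] e x x∈ i

ZY-of-R : ∀ a x → R⟨ a ⟩ x → Z x ⊕ Y 0F x ≡ parity a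
ZY-of-R zero    x x≈0 = cong₂ _⊕_ (trans (Zᶜʰ.φ-cong {x} {0ᴴ} x≈0) Zᶜʰ.φ-ε)
                                  (trans (Yᶜʰ.φ-cong 0F {x} {0ᴴ} x≈0) (Yᶜʰ.φ-ε 0F))
ZY-of-R (suc a) x (e , _ , total , x∈) = trans (ZY-of-R[] e x x∈) (cong parity total)

double : ∀ x {n} → n ≡ 1 → + (2 ℕ.^ n) Int.* x ≡ x Int.+ x
double x refl = eq x
  where
  open Int using (_+_; _*_)
  eq : ∀ x → + 2 * x ≡ x + x
  eq = ℤ-Solver.solve-∀

doubleᴼ : ∀ x {n} → n ≡ 1 → fromℤ (+ (2 ℕ.^ n)) *ᴼ x ≡ x +ᴼ x
doubleᴼ (b + c ω) refl = cong₂ _+_ω (eq₁ b c) (eq₂ b c)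
  where
  open Int using (_+_; _*_; _-_)
  eq₁ : ∀ b c → + 2 * b - + 0 * c ≡ b + b
  eq₁ = ℤ-Solver.solve-∀
  eq₂ : ∀ b c → + 2 * c + + 0 * b - + 0 * c ≡ c + c
  eq₂ = ℤ-Solver.solve-∀

Z-of-R₈ : ∀ x → R⟨ 8 ⟩ x → Z x ≡ 0ℙ
Z-of-R₈ x (e , e>0 , total , g , _ , _ , W-div , x≈g) = trans (Zᶜʰ.φ-cong {x} {g} x≈g)
  (Good₂-χ₄ (rat g)
    (ℤᶜ.divisible⇒Good {3} (ℤᶜ.TransformDivisible-resp {3} (λ h → ℤᴿ.mod-refl (+ 8) (double (rat g h) (e≡1 h))) W-div))
    (λ h → rational-odd (proj₁ (g h))))
  where
  e≡1 : ∀ h → e h ≡ 1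
  e≡1 = foldCube-minimal e e>0 (ℕₚ.≤-reflexive total)

Z-of-Q : ∀ r x → Q⟨ r ⟩ x → Z x ≡ 0ℙ
Z-of-Q zero    x x≈0 = trans (Zᶜʰ.φ-cong {x} {0ᴴ} x≈0) Zᶜʰ.φ-ε
Z-of-Q (suc _) x (_ , _ , _ , g , p , _ , _ , x≈g) =
  trans (Zᶜʰ.φ-cong {x} {g} x≈g) (foldCube-0 λ h → χ₄-cong (p h))

-- Where a linear form is odd, `ψ` is `χ₄` of that form up to correction terms that sum to zero in
-- `Good₂-ψ`. The forms im, re and re + im are treated in turn.
ψ-im : ∀ x → bit₀ (O.im x) ≡ 1ℙ → ψ x ≡ χ₄ (O.im x) ⊕ ((bit₀ (O.re x) ⊕ κ x) ⊕ bit₀ (O.re x) ⊗ κ x)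
ψ-im (b + c ω) = table (Mod4.res b) (Mod4.res c)
  where
  table : ∀ b c → low c ≡ 1ℙ → ψR (b , c) ≡ high c ⊕ ((low b ⊕ κR (b , c)) ⊕ low b ⊗ κR (b , c))
  table = toWitness {a? = all? λ b → all? λ c → low c ℙ.≟ 1ℙ →-dec
    ψR (b , c) ℙ.≟ high c ⊕ ((low b ⊕ κR (b , c)) ⊕ low b ⊗ κR (b , c))} _

ψ-re : ∀ x → bit₀ (O.re x) ≡ 1ℙ → ψ x ≡ χ₄ (O.re x) ⊕ (bit₀ (O.im x) ⊕ bit₀ (O.im x) ⊗ κ x)
ψ-re (b + c ω) = table (Mod4.res b) (Mod4.res c)
  where
  table : ∀ b c → low b ≡ 1ℙ → ψR (b , c) ≡ high b ⊕ (low c ⊕ low c ⊗ κR (b , c))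
  table = toWitness {a? = all? λ b → all? λ c → low b ℙ.≟ 1ℙ →-dec
    ψR (b , c) ℙ.≟ high b ⊕ (low c ⊕ low c ⊗ κR (b , c))} _

ψ-τ : ∀ x → bit₀ (O.re x) ⊕ bit₀ (O.im x) ≡ 1ℙ → ψ x ≡ χ₄ (τ x) ⊕ (κ x ⊕ bit₀ (O.im x) ⊗ κ x)
ψ-τ (b + c ω) p = trans (table (Mod4.res b) (Mod4.res c) p)
  (cong (_⊕ (κ (b + c ω) ⊕ bit₀ c ⊗ κ (b + c ω))) (cong high (sym (Mod4.res-+ b c))))
  where
  table : ∀ b c → low b ⊕ low c ≡ 1ℙ →
    ψR (b , c) ≡ χ₄ (Mod4.⟦ b ⟧ Int.+ Mod4.⟦ c ⟧) ⊕ (κR (b , c) ⊕ low c ⊗ κR (b , c))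
  table = toWitness {a? = all? λ b → all? λ c → low b ⊕ low c ℙ.≟ 1ℙ →-dec
    ψR (b , c) ℙ.≟ χ₄ (Mod4.⟦ b ⟧ Int.+ Mod4.⟦ c ⟧) ⊕ (κR (b , c) ⊕ low c ⊗ κR (b , c))} _

odd⇒re⊎im : ∀ x → odd x ≡ 1ℙ → bit₀ (O.re x) ≡ 1ℙ ⊎ bit₀ (O.im x) ≡ 1ℙ
odd⇒re⊎im (b + c ω) = table (Mod4.res b) (Mod4.res c)
  where
  table : ∀ b c → oddR (b , c) ≡ 1ℙ → low b ≡ 1ℙ ⊎ low c ≡ 1ℙ
  table = toWitness {a? = all? λ b → all? λ c → oddR (b , c) ℙ.≟ 1ℙ →-dec (low b ℙ.≟ 1ℙ ⊎-dec low c ℙ.≟ 1ℙ)} _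

module _ (γ : Index → O) (odd-γ : ∀ h → odd (γ h) ≡ 1ℙ) (good : Oᶜ.Good {3} (λ h → γ h +ᴼ γ h))
         (κ-balanced : Balanced (κ ∘ γ)) where
  private
    τ-+ : ∀ x y → τ (x +ᴼ y) ≡ τ x Int.+ τ y
    τ-+ (a + b ω) (c + d ω) = eq a b c d
      where
      open Int using (_+_)
      eq : ∀ a b c d → a + c + (b + d) ≡ a + b + (c + d)
      eq = ℤ-Solver.solve-∀

    good-re : ℤᶜ.Good {3} (λ h → O.re (γ h) Int.+ O.re (γ h))
    good-re = Good-map O.re (λ _ _ → refl) (λ h → γ h +ᴼ γ h) good

    good-im : ℤᶜ.Good {3} (λ h → O.im (γ h) Int.+ O.im (γ h))
    good-im = Good-map O.im (λ _ _ → refl) (λ h → γ h +ᴼ γ h) good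

    r i : Index → Parity
    r = bit₀ ∘ O.re ∘ γ
    i = bit₀ ∘ O.im ∘ γ

    r-balanced : Balanced r
    r-balanced = Good₂-balanced (O.re ∘ γ) good-re

    i-balanced : Balanced i
    i-balanced = Good₂-balanced (O.im ∘ γ) good-im

    good-τ : ℤᶜ.Good {3} (λ h → τ (γ h) Int.+ τ (γ h))
    good-τ = ℤᶜ.divisible⇒Good {3} (ℤᶜ.TransformDivisible-resp {3}
      (λ h → ℤᴿ.mod-refl (+ 8) (τ-+ (γ h) (γ h)))
      (ℤᶜ.Good⇒divisible {3} (Good-map τ τ-+ (λ h → γ h +ᴼ γ h) good)))

    -- Here `u` will be `χ₄` of an odd linear form, and the product of `w` with `κ` sums to zero
    -- because balanced vectors are mutually orthogonal.
    ψ-sum : ∀ u v w → foldCube _⊕_ u ≡ 0ℙ → Balanced v → Balanced w →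
          (∀ h → ψ (γ h) ≡ u h ⊕ (v h ⊕ w h ⊗ κ (γ h))) → foldCube _⊕_ (ψ ∘ γ) ≡ 0ℙ
    ψ-sum u v w p q s e = trans (foldCube-cong e)
      (trans (foldCube-⊕ u (λ h → v h ⊕ w h ⊗ κ (γ h))) (cong₂ _⊕_ p
        (trans (foldCube-⊕ v (λ h → w h ⊗ κ (γ h))) (cong₂ _⊕_ (q 0F) (balanced-⊗ w (κ ∘ γ) s κ-balanced)))))

  Good₂-ψ : foldCube _⊕_ (ψ ∘ γ) ≡ 0ℙ
  -- The residues modulo 2 form an affine map to F₄ that avoids 0. A second omitted value spans,
  -- together with 0, the kernel of one of the forms im, re, re + im, which is then odd throughout.
  Good₂-ψ = [ im-odd , [ re-odd , τ-odd ]′ ]′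
    (omits-0 r i r-balanced i-balanced (λ h → odd⇒re⊎im (γ h) (odd-γ h)))
    where
    im-odd : (∀ h → i h ≡ 1ℙ) → foldCube _⊕_ (ψ ∘ γ) ≡ 0ℙ
    im-odd p = ψ-sum (χ₄ ∘ O.im ∘ γ) (λ h → r h ⊕ κ (γ h)) r (Good₂-χ₄ (O.im ∘ γ) good-im p)
      (λ j → trans (moment-⊕ j r (κ ∘ γ)) (cong₂ _⊕_ (r-balanced j) (κ-balanced j)))
      r-balanced (λ h → ψ-im (γ h) (p h))
    re-odd : (∀ h → r h ≡ 1ℙ) → foldCube _⊕_ (ψ ∘ γ) ≡ 0ℙ
    re-odd p = ψ-sum (χ₄ ∘ O.re ∘ γ) i i (Good₂-χ₄ (O.re ∘ γ) good-re p)
      i-balanced i-balanced (λ h → ψ-re (γ h) (p h))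
    τ-odd : (∀ h → r h ⊕ i h ≡ 1ℙ) → foldCube _⊕_ (ψ ∘ γ) ≡ 0ℙ
    τ-odd p = ψ-sum (χ₄ ∘ τ ∘ γ) (κ ∘ γ) i
      (Good₂-χ₄ (τ ∘ γ) good-τ (λ h → trans (bit₀-+ (O.re (γ h)) (O.im (γ h))) (p h)))
      κ-balanced i-balanced (λ h → ψ-τ (γ h) (p h))

Y-of-Q₈ : ∀ x → Q⟨ 8 ⟩ x → (∀ i → K i x ≡ 0ℙ) → Y 0F x ≡ 0ℙ
Y-of-Q₈ x (f , f>0 , total , g , p , q , W-div , x≈g) K≡0 = trans (Yᶜʰ.φ-cong 0F {x} {g} x≈g)
  (trans (foldCube-cong {w = λ h → ψ (eis g h) ⊕ 1ℙ} at-h)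
  -- Each of the eight vertices contributes χλ(2) = 1, and these cancel.
  (trans (foldCube-⊕ (ψ ∘ eis g) (λ _ → 1ℙ)) (cong (_⊕ 0ℙ) Σψ)))
  where
  f≡1 : ∀ h → f h ≡ 1
  f≡1 = foldCube-minimal f f>0 (ℕₚ.≤-reflexive total)
  at-h : ∀ h → y g h ≡ ψ (eis g h) ⊕ 1ℙ
  at-h h = cong₂ _⊕_ (cong₂ _⊕_ (χ₄-cong (p h)) (χ₃-cong (p h)))
    (cong (ψ (eis g h) ⊕_) (trans (χλ-cong (q h)) (cong (λ n → χλ (fromℤ (+ (2 ℕ.^ n)))) (f≡1 h))))
  Σψ : foldCube _⊕_ (ψ ∘ eis g) ≡ 0ℙ
  Σψ = Good₂-ψ (eis g) (λ h → eisenstein-odd (proj₂ (g h)))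
    (Oᶜ.divisible⇒Good {3} (Oᶜ.TransformDivisible-resp {3}
      (λ h → Oᴿ.mod-refl (fromℤ (+ 8)) (doubleᴼ (eis g h) (f≡1 h))) W-div))
    λ i → trans (sym (Kᶜʰ.φ-cong i {x} {g} x≈g)) (K≡0 i)

-- Elements of E⁺ and L

infixl 8 _^ᶻ_ _^ᴼ_ _^ᵘ_

_^ᶻ_ : ℤ₂₄.Carrier → Parity → ℤ₂₄.Carrier
u ^ᶻ 0ℙ = ℤ₂₄.ε
u ^ᶻ 1ℙ = u

_^ᴼ_ : O₈.Carrier → Parity → O₈.Carrier
u ^ᴼ 0ℙ = O₈.ε
u ^ᴼ 1ℙ = u

module μ₆ = AbelianGroup μ₆

_^ᵘ_ : μ₆.Carrier → Parity → μ₆.Carrier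
u ^ᵘ 0ℙ = μ₆.ε
u ^ᵘ 1ℙ = u

-- 7 is -1 modulo 8 and 1 modulo 3, while 17 is 1 modulo 8 and -1 modulo 3; each changes exactly one
-- of `χ₄` and `χ₃`.
-1ᶻ 7ᶻ 17ᶻ : ℤ₂₄.Carrier
-1ᶻ = record { val = -1ℤ ; inv = -1ℤ ; val∙inv = ℤᴿ.mod-refl (+ 24) refl }
7ᶻ  = record { val = + 7 ; inv = + 7 ; val∙inv = ℤᴿ.mod-intro (+ 2) refl }
17ᶻ = record { val = + 17 ; inv = + 17 ; val∙inv = ℤᴿ.mod-intro (+ 12) refl }

-1ᵘ : μ₆.Carrier
-1ᵘ = record { val = fromℤ -1ℤ ; inv = fromℤ -1ℤ ; val∙inv = refl }

ω^ : Fin 3 → μ₆.Carrier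
ω^ 0F = μ₆.ε
ω^ 1F = record { val = + 0 + + 1 ω ; inv = -1ℤ + -1ℤ ω ; val∙inv = refl }
ω^ 2F = record { val = -1ℤ + -1ℤ ω ; inv = + 0 + + 1 ω ; val∙inv = refl }

reduce : μ₆.Carrier → O₈.Carrier
reduce ξ = record { val = val ξ ; inv = inv ξ ; val∙inv = Oᴿ.mod-refl 8λ (val∙inv ξ) }

-- σ = 5 + 2ω is congruent to √-3 modulo 4 and to 1 modulo λ.
σᴼ 7ᴼ 17ᴼ : O₈.Carrier
σᴼ  = record { val = + 5 + + 2 ω ; inv = conj (+ 5 + + 2 ω) *ᴼ fromℤ (+ 19)
              ; val∙inv = Oᴿ.mod-intro (+ 30 + + 15 ω) refl }
7ᴼ  = record { val = fromℤ (+ 7) ; inv = fromℤ (+ 7) ; val∙inv = Oᴿ.mod-intro (+ 4 + + 2 ω) refl }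
17ᴼ = record { val = fromℤ (+ 17) ; inv = fromℤ (+ 17) ; val∙inv = Oᴿ.mod-intro (+ 24 + + 12 ω) refl }

17ᴼ^-% : ∀ n → val (17ᴼ ^ᴼ parity n) ≡ fromℤ (+ (17 ℕ.^ (n ℕ.% 2)))
17ᴼ^-% zero          = refl
17ᴼ^-% (suc zero)    = refl
17ᴼ^-% (suc (suc n)) = 17ᴼ^-% n

17ᴼ^-square : ∀ p → (17ᴼ ^ᴼ p) O₈.∙ (17ᴼ ^ᴼ p) O₈.≈ O₈.ε
17ᴼ^-square 0ℙ = Oᴿ.mod-refl 8λ refl
17ᴼ^-square 1ℙ = val∙inv 17ᴼ

transformᴼ : ∀ {n} → (Vec Bool n → O) → Vec Bool n → O
transformᴼ = Hadamard.transform O-ring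

transformℤ : ∀ {n} → (Vec Bool n → ℤ) → Vec Bool n → ℤ
transformℤ = Hadamard.transform ℤ-ring

quot8 : O → O
quot8 (b + c ω) = (b /ℕ 8) + (c /ℕ 8) ω

-- Floor division proposes the quotient, so that divisibility becomes an equation decidable vertex
-- by vertex.
8∣W : (Index → O) → Set
8∣W a = ∀ h → quot8 (transformᴼ a h) *ᴼ fromℤ (+ 8) ≡ transformᴼ a h

8∣W? : ∀ a → Dec (8∣W a)
8∣W? a = allVertices? λ h → quot8 (transformᴼ a h) *ᴼ fromℤ (+ 8) ≟ᴼ transformᴼ a h

8∣W⇒divisible : ∀ a → 8∣W a → WDivisibleᴼ (fromℤ (+ 8)) a
8∣W⇒divisible a p = Hadamard.divisible λ h → record { quotient = quot8 (transformᴼ a h) ; equality = p h }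

8∣Wℤ : (Index → ℤ) → Set
8∣Wℤ a = ∀ h → (transformℤ a h /ℕ 8) Int.* + 8 ≡ transformℤ a h

8∣Wℤ? : ∀ a → Dec (8∣Wℤ a)
8∣Wℤ? a = allVertices? λ h → (transformℤ a h /ℕ 8) Int.* + 8 ℤₚ.≟ transformℤ a h

8∣Wℤ⇒divisible : ∀ a → 8∣Wℤ a → WDivisibleℤ (+ 8) a
8∣Wℤ⇒divisible a p = Hadamard.divisible λ h → record { quotient = transformℤ a h /ℕ 8 ; equality = p h }

balanced-divisible : ∀ (u : Parity → O) → (∀ v → Balanced (cube v) → 8∣W (u ∘ cube v)) →
                     ∀ v → Balanced v → WDivisibleᴼ (fromℤ (+ 8)) (u ∘ v)
balanced-divisible u table v p = Oᶜ.TransformDivisible-resp {3}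
  (λ h → Oᴿ.mod-refl (fromℤ (+ 8)) (cong u (cube-bits v h)))
  (8∣W⇒divisible (u ∘ cube (bits v)) (table (bits v) (balanced-bits v p)))

-- For affine v the vector (-1)^v is, up to sign, a row of W, whose transform has the single nonzero
-- entry 8 or -8.
balanced-signs : ∀ v → Balanced v → WDivisibleᴼ (fromℤ (+ 8)) (λ h → val (reduce -1ᵘ ^ᴼ v h))
balanced-signs = balanced-divisible (λ p → val (reduce -1ᵘ ^ᴼ p)) (toWitness {a? = allBits? λ v →
  balanced? (cube v) →-dec 8∣W? (λ h → val (reduce -1ᵘ ^ᴼ cube v h))} _)

-- As σ - 1 = 2(2 + ω), the vector σ^v equals (3 + ω) - (2 + ω)(-1)^v, an O-linear combination of
-- the constant 1 and the signs (-1)^v.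
balanced-σ : ∀ v → Balanced v → WDivisibleᴼ (fromℤ (+ 8)) (λ h → val (σᴼ ^ᴼ v h))
balanced-σ = balanced-divisible (λ p → val (σᴼ ^ᴼ p)) (toWitness {a? = allBits? λ v →
  balanced? (cube v) →-dec 8∣W? (λ h → val (σᴼ ^ᴼ cube v h))} _)

17ᴼ^≡1 : ∀ x p → (x *ᴼ val (17ᴼ ^ᴼ p)) ≡ x modᴼ fromℤ (+ 8)
17ᴼ^≡1 x p = Oᴿ.mod-trans 8ᴼ (Oᴿ.mod-*-cong 8ᴼ {x} {x} {val (17ᴼ ^ᴼ p)} {fromℤ 1ℤ} (Oᴿ.mod-refl 8ᴼ refl) (table p))
  (Oᴿ.mod-refl 8ᴼ (CommutativeRing.*-identityʳ O-ring x))
  where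
  8ᴼ = fromℤ (+ 8)
  table : ∀ p → val (17ᴼ ^ᴼ p) ≡ fromℤ 1ℤ modᴼ 8ᴼ
  table 0ℙ = Oᴿ.mod-refl 8ᴼ refl
  table 1ℙ = Oᴿ.mod-intro (+ 2 + + 0 ω) refl

module _ (v k q : Index → Parity) (v-balanced : Balanced v) (k-balanced : Balanced k) where

  -- The factors 17 are 1 modulo 8 and do not affect the transforms. Modulo λ, both -1 and 17 are -1
  -- and σ is 1, whence the rational exponent v + q.
  L-element : Γ.Carrier
  L-element h = 17ᶻ ^ᶻ (v h ⊕ q h) , ((reduce -1ᵘ ^ᴼ v h) O₈.∙ (σᴼ ^ᴼ k h)) O₈.∙ (17ᴼ ^ᴼ q h)

  L-element∈L : Subgroup.Member L L-element
  L-element∈L = (λ h → τ⇒mod-λ (Mod3.res-reflects (same-sign (v h) (k h) (q h))))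
    , ℤᶜ.TransformDivisible-resp {3} (λ h → ℤᴿ.mod-sym (+ 8) (17≡1 (v h ⊕ q h))) (ℤᶜ.TransformDivisible-1 {3})
    , Oᶜ.TransformDivisible-resp {3} (λ h → Oᴿ.mod-sym (fromℤ (+ 8))
        (17ᴼ^≡1 (val ((reduce -1ᵘ ^ᴼ v h) O₈.∙ (σᴼ ^ᴼ k h))) (q h)))
        (Oᶜ.TransformDivisible-* {3} (balanced-signs v v-balanced) (balanced-σ k k-balanced))
    where
    same-sign : ∀ v k q → Mod3.res (τ (fromℤ (val (17ᶻ ^ᶻ (v ⊕ q))))) ≡
      Mod3.res (τ (val (((reduce -1ᵘ ^ᴼ v) O₈.∙ (σᴼ ^ᴼ k)) O₈.∙ (17ᴼ ^ᴼ q))))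
    same-sign = toWitness {a? = allℙ? λ v → allℙ? λ k → allℙ? λ q →
      Mod3.res (τ (fromℤ (val (17ᶻ ^ᶻ (v ⊕ q))))) Finₚ.≟
      Mod3.res (τ (val (((reduce -1ᵘ ^ᴼ v) O₈.∙ (σᴼ ^ᴼ k)) O₈.∙ (17ᴼ ^ᴼ q))))} _
    17≡1 : ∀ p → val (17ᶻ ^ᶻ p) ≡ 1ℤ modℤ (+ 8)
    17≡1 0ℙ = ℤᴿ.mod-refl (+ 8) refl
    17≡1 1ℙ = ℤᴿ.mod-intro (+ 2) refl

module _ (z s : Index → Parity) (i : Index → Fin 3) (Σz≡0 : foldCube _⊕_ z ≡ 0ℙ) where

  E⁺-element : Γ.Carrier
  E⁺-element h = -1ᶻ ^ᶻ z h , reduce (ω^ (i h) μ₆.∙ -1ᵘ ^ᵘ s h)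

  E⁺-element∈E⁺ : Subgroup.Member E⁺ E⁺-element
  E⁺-element∈E⁺ = (λ h → val (-1ᶻ ^ᶻ z h)) , (λ h → ω^ (i h) μ₆.∙ -1ᵘ ^ᵘ s h)
    , (λ h → sign (z h)) , trans (product z) (cong (λ p → val (-1ᶻ ^ᶻ p)) Σz≡0)
    , (λ h → ℤᴿ.mod-refl (+ 24) refl) , (λ h → Oᴿ.mod-refl 8λ refl)
    where
    sign : ∀ p → val (-1ᶻ ^ᶻ p) ≡ 1ℤ ⊎ val (-1ᶻ ^ᶻ p) ≡ -1ℤ
    sign 0ℙ = inj₁ refl
    sign 1ℙ = inj₂ refl
    sign-⊕ : ∀ p q → val (-1ᶻ ^ᶻ p) Int.* val (-1ᶻ ^ᶻ q) ≡ val (-1ᶻ ^ᶻ (p ⊕ q))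
    sign-⊕ 0ℙ 0ℙ = refl
    sign-⊕ 0ℙ 1ℙ = refl
    sign-⊕ 1ℙ 0ℙ = refl
    sign-⊕ 1ℙ 1ℙ = refl
    product : ∀ {n} (z : Vec Bool n → Parity) →
      foldCube Int._*_ (λ h → val (-1ᶻ ^ᶻ z h)) ≡ val (-1ᶻ ^ᶻ foldCube _⊕_ z)
    product {zero}  z = refl
    product {suc n} z = trans (cong₂ Int._*_ (product (z ∘ (false ∷_))) (product (z ∘ (true ∷_))))
      (sign-⊕ (foldCube _⊕_ (z ∘ (false ∷_))) (foldCube _⊕_ (z ∘ (true ∷_))))

-- Realising the values of the characters

-- This describes an element of R_a by its units modulo 4 only; `Cover` chooses the residues modulo
-- 3. Accordingly `Y-bits` are the values of `y` for a rational part that is 1 modulo 3 and an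
-- Eisenstein part 17^e.
record RWitness (a : ℕ) : Set where
  field
    e         : Index → ℕ
    e>0       : ∀ h → 0 ℕ.< e h
    total     : foldCube ℕ._+_ e ≡ a
    u         : Index → ℤ₂₄.Carrier
    divisible : WDivisibleℤ (+ 8) (λ h → + (2 ℕ.^ e h) Int.* val (u h))

  Z-bits Y-bits : Index → Parity
  Z-bits h = χ₄ (val (u h))
  Y-bits h = χ₄ (val (u h)) ⊕ parity (e h)

record QWitness (r : ℕ) : Set where
  field
    f         : Index → ℕ
    f>0       : ∀ h → 0 ℕ.< f h
    total     : foldCube ℕ._+_ f ≡ r
    γ         : Index → O₈.Carrier
    residue   : ∀ h → Mod3.res (τ (val (γ h))) ≡ Mod3.res (τ (fromℤ (+ (2 ℕ.^ f h))))
    divisible : WDivisibleᴼ (fromℤ (+ 8)) (λ h → fromℤ (+ (2 ℕ.^ f h)) *ᴼ val (γ h))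

  Y-bits K-bits : Index → Parity
  Y-bits h = η (val (γ h))
  K-bits h = κ (val (γ h))

module _ {G : Group₀} {A B : Subgroup G} where
  private module G = AbelianGroup G

  absorb : ∀ {x z a b} → Subgroup.Member A a → Subgroup.Member B b →
           x G.∙ (a G.∙ b) G.≈ z → Cong G ((G ·ˢ A) B) x z
  absorb {x} {z} {a} {b} a∈ b∈ e = AbelianGroup.sym (G /ˢ (G ·ˢ A) B) {z} {x}
    (coset (a , b , a∈ , b∈ ,
      G.trans (G.∙-congʳ (G.sym e)) (AbelianGroupProperties.xyx⁻¹≈y G x (a G.∙ b))))

module Mod24 = Residue 24

1mod6 : ∀ x → bit₀ x ≡ 1ℙ → Mod3.res x ≢ 0F → χ₃ x ≡ 0ℙ →
        Any (λ u → x ≡ u modℤ (+ 24)) (+ 1 ∷ + 7 ∷ + 13 ∷ + 19 ∷ [])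
1mod6 x p q s = Any.map (λ e → subst (λ u → x ≡ u modℤ (+ 24)) e (Mod24.res-sound x))
  (table r (trans (cong low (sym (Mod4.res-cong (mod24⇒mod4 x≡r)))) p)
           (λ z → q (trans (Mod3.res-cong (mod24⇒mod3 x≡r)) z))
           (trans (cong sign₃ (sym (Mod3.res-cong (mod24⇒mod3 x≡r)))) s))
  where
  r = Mod24.res x
  x≡r = Mod24.res-sound x
  table : ∀ r → bit₀ Mod24.⟦ r ⟧ ≡ 1ℙ → Mod3.res Mod24.⟦ r ⟧ ≢ 0F → χ₃ Mod24.⟦ r ⟧ ≡ 0ℙ →
          Any (Mod24.⟦ r ⟧ ≡_) (+ 1 ∷ + 7 ∷ + 13 ∷ + 19 ∷ [])
  table = toWitness {a? = all? λ r → bit₀ Mod24.⟦ r ⟧ ℙ.≟ 1ℙ →-dec ¬? (Mod3.res Mod24.⟦ r ⟧ Finₚ.≟ 0F) →-dec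
    χ₃ Mod24.⟦ r ⟧ ℙ.≟ 0ℙ →-dec Any.any? (Mod24.⟦ r ⟧ ℤₚ.≟_) (+ 1 ∷ + 7 ∷ + 13 ∷ + 19 ∷ [])} _

odd-residues : ∀ x y → bit₀ x ≡ 1ℙ → bit₀ y ≡ 1ℙ → χ₄ x ≡ χ₄ y → x ≡ y modℤ (+ 4)
odd-residues x y p q e = Mod4.res-reflects (table (Mod4.res x) (Mod4.res y) p q e)
  where
  table : ∀ r s → low r ≡ 1ℙ → low s ≡ 1ℙ → high r ≡ high s → r ≡ s
  table = toWitness {a? = all? λ r → all? λ s → low r ℙ.≟ 1ℙ →-dec low s ℙ.≟ 1ℙ →-dec
    high r ℙ.≟ high s →-dec r Finₚ.≟ s} _

nonzero-residues : ∀ r s → r ≢ 0F → s ≢ 0F → sign₃ r ≡ sign₃ s → r ≡ s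
nonzero-residues = toWitness {a? = all? λ r → all? λ s → ¬? (r Finₚ.≟ 0F) →-dec ¬? (s Finₚ.≟ 0F) →-dec
  sign₃ r ℙ.≟ sign₃ s →-dec r Finₚ.≟ s} _

-- One factor 2 raises a congruence modulo 4 to one modulo 8, so with positive exponents the
-- divisibility conditions see the units modulo 4 only.
scale : ∀ {x y n} → 0 ℕ.< n → x ≡ y modℤ (+ 4) → (+ (2 ℕ.^ n) Int.* x) ≡ + (2 ℕ.^ n) Int.* y modℤ (+ 8)
scale {x} {y} {suc n} _ p = let k , e = ℤᴿ.mod-elim p in
  ℤᴿ.mod-intro (k * + (2 ℕ.^ n))
    (trans (cong₂ _*_ (ℤₚ.pos-* 2 (2 ℕ.^ n)) e) (trans (eq y k (+ (2 ℕ.^ n)))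
      (cong (λ t → t * y + k * + (2 ℕ.^ n) * + 8) (sym (ℤₚ.pos-* 2 (2 ℕ.^ n))))))
  where
  open Int using (_+_; _*_)
  eq : ∀ y k p → (+ 2 * p) * (y + k * + 4) ≡ (+ 2 * p) * y + k * p * + 8
  eq = ℤ-Solver.solve-∀

mod8-intro : ∀ {x y} → O.re x ≡ O.re y modℤ (+ 8) → O.im x ≡ O.im y modℤ (+ 8) → x ≡ y modᴼ fromℤ (+ 8)
mod8-intro {b + c ω} {b′ + c′ ω} p q = let k , e = ℤᴿ.mod-elim p ; l , f = ℤᴿ.mod-elim q in
  Oᴿ.mod-intro (k + l ω) (cong₂ _+_ω (trans e (eq₁ b′ k l)) (trans f (eq₂ c′ k l)))
  where
  open Int using (_+_; _*_; _-_)
  eq₁ : ∀ b k l → b + k * + 8 ≡ b + (k * + 8 - l * + 0)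
  eq₁ = ℤ-Solver.solve-∀
  eq₂ : ∀ c k l → c + l * + 8 ≡ c + (k * + 0 + l * + 8 - l * + 0)
  eq₂ = ℤ-Solver.solve-∀

fromℤ-*ᴼ : ∀ m x → fromℤ m *ᴼ x ≡ (m Int.* O.re x) + (m Int.* O.im x) ω
fromℤ-*ᴼ m (b + c ω) = cong₂ _+_ω (eq₁ m b c) (eq₂ m b c)
  where
  open Int using (_+_; _*_; _-_)
  eq₁ : ∀ m b c → m * b - + 0 * c ≡ m * b
  eq₁ = ℤ-Solver.solve-∀
  eq₂ : ∀ m b c → m * c + + 0 * b - + 0 * c ≡ m * c
  eq₂ = ℤ-Solver.solve-∀

scaleᴼ : ∀ {x y n} → 0 ℕ.< n → x ≡ y modᴼ 4ᴼ →
         (fromℤ (+ (2 ℕ.^ n)) *ᴼ x) ≡ fromℤ (+ (2 ℕ.^ n)) *ᴼ y modᴼ fromℤ (+ 8)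
scaleᴼ {x} {y} {n} n>0 p = subst₂ (λ s t → s ≡ t modᴼ fromℤ (+ 8))
  (sym (fromℤ-*ᴼ (+ (2 ℕ.^ n)) x)) (sym (fromℤ-*ᴼ (+ (2 ℕ.^ n)) y))
  (mod8-intro (scale {O.re x} {O.re y} {n} n>0 (mod4-re p)) (scale {O.im x} {O.im y} {n} n>0 (mod4-im p)))

-- ω^i x and y agree modulo 4 up to sign and a power of √-3.
ω-index : Residueᴼ → Residueᴼ → Fin 3
ω-index x y = (class y ℕ.+ 2 ℕ.* class x) mod 3
  where
  class : Residueᴼ → ℕ
  class (b , c) with low b | low c
  ... | 1ℙ | 0ℙ = 0
  ... | 0ℙ | 1ℙ = 1
  ... | _  | _  = 2

correctionᶻ : Parity → Parity → ℤ₂₄.Carrier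
correctionᶻ z w = (-1ᶻ ^ᶻ z) ℤ₂₄.∙ (17ᶻ ^ᶻ w)

χ₄-correctionᶻ : ∀ z w → χ₄ (val (correctionᶻ z w)) ≡ z
χ₄-correctionᶻ = toWitness {a? = allℙ? λ z → allℙ? λ w → χ₄ (val (correctionᶻ z w)) ℙ.≟ z} _

χ₃-correctionᶻ : ∀ z w → χ₃ (val (correctionᶻ z w)) ≡ z ⊕ w
χ₃-correctionᶻ = toWitness {a? = allℙ? λ z → allℙ? λ w → χ₃ (val (correctionᶻ z w)) ℙ.≟ z ⊕ w} _

correctionᴼ : Fin 3 → (s v k q : Parity) → O₈.Carrier
correctionᴼ i s v k q =
  reduce (ω^ i μ₆.∙ -1ᵘ ^ᵘ s) O₈.∙ (((reduce -1ᵘ ^ᴼ v) O₈.∙ (σᴼ ^ᴼ k)) O₈.∙ (17ᴼ ^ᴼ q))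

χλ-correctionᴼ : ∀ i s v k q → χλ (val (correctionᴼ i s v k q)) ≡ (s ⊕ v) ⊕ q
χλ-correctionᴼ = toWitness {a? = all? λ i → allℙ? λ s → allℙ? λ v → allℙ? λ k → allℙ? λ q →
  χλ (val (correctionᴼ i s v k q)) ℙ.≟ (s ⊕ v) ⊕ q} _

-- By the form ω^i (-1)^j (√-3)^k of the units modulo 4, with σ in place of √-3. A sign may come
-- from E⁺ or from L, hence the free parameter `v`; powers of 17 are 1 modulo 4.
correctᴼ : ∀ (x γ : Residueᴼ) (v q t : Parity) → oddR x ≡ 1ℙ → oddR γ ≡ 1ℙ →
  resᴼ ((lift x *ᴼ val (correctionᴼ (ω-index x γ) ((ψR x ⊕ ψR γ) ⊕ v) v (κR x ⊕ κR γ) q)) *ᴼ val (17ᴼ ^ᴼ t)) ≡ γ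
correctᴼ = toWitness {a? = allᴿ? λ x → allᴿ? λ γ → allℙ? λ v → allℙ? λ q → allℙ? λ t →
  oddR x ℙ.≟ 1ℙ →-dec oddR γ ℙ.≟ 1ℙ →-dec
  resᴼ ((lift x *ᴼ val (correctionᴼ (ω-index x γ) ((ψR x ⊕ ψR γ) ⊕ v) v (κR x ⊕ κR γ) q)) *ᴼ val (17ᴼ ^ᴼ t)) ≟ᴿ γ} _

module Cover {a r : ℕ} (ρ : RWitness (suc a)) (q : QWitness (suc r)) (x : |H|)
  (Z≡ : Z x ≡ foldCube _⊕_ (RWitness.Z-bits ρ))
  (Y≡ : ∀ i → Y i x ≡ moment i (λ h → RWitness.Y-bits ρ h ⊕ QWitness.Y-bits q h))
  (K≡ : ∀ i → K i x ≡ moment i (QWitness.K-bits q)) where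
  private
    module ρ = RWitness ρ
    module q = QWitness q

    b : ∀ h → O₈.Carrier
    b h = proj₂ (x h)

    -- The hypotheses make `z` sum to zero and `v`, `k` balanced, so they can be exponents of -1 in
    -- the rational part of E⁺ and of -1 and σ in L. Then `s` is forced by `ψ` and `w` by `χλ`, and
    -- since `v` measures the discrepancy in `y`, the rational part ends up 1 modulo 3.
    z v k p t w s : Index → Parity
    z h = χ₄ (rat x h) ⊕ ρ.Z-bits h
    v h = y x h ⊕ (ρ.Y-bits h ⊕ q.Y-bits h)
    k h = κ (eis x h) ⊕ q.K-bits h
    p h = ψ (eis x h) ⊕ ψ (val (q.γ h))
    t h = (χλ (eis x h) ⊕ χλ (val (q.γ h))) ⊕ parity (ρ.e h)
    w h = p h ⊕ t h
    s h = p h ⊕ v h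

    i : Index → Fin 3
    i h = ω-index (resᴼ (eis x h)) (resᴼ (val (q.γ h)))

    cancel-⊕ : ∀ {m n} → m ≡ n → m ⊕ n ≡ 0ℙ
    cancel-⊕ {m} refl = ℙ.p+p≡0ℙ m

    z-sum : foldCube _⊕_ z ≡ 0ℙ
    z-sum = trans (foldCube-⊕ (χ₄ ∘ rat x) ρ.Z-bits) (cancel-⊕ Z≡)

    v-balanced : Balanced v
    v-balanced j = trans (moment-⊕ j (y x) (λ h → ρ.Y-bits h ⊕ q.Y-bits h)) (cancel-⊕ (Y≡ j))

    k-balanced : Balanced k
    k-balanced j = trans (moment-⊕ j (κ ∘ eis x) q.K-bits) (cancel-⊕ (K≡ j))

    εᶻ : Index → ℤ₂₄.Carrier
    εᶻ h = correctionᶻ (z h) (v h ⊕ w h)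

    εᴼ : Index → O₈.Carrier
    εᴼ h = correctionᴼ (i h) (s h) (v h) (k h) (w h)

    ρ′ : Index → ℤ₂₄.Carrier
    ρ′ h = proj₁ (x h) ℤ₂₄.∙ εᶻ h

    17^e : Index → O₈.Carrier
    17^e h = 17ᴼ ^ᴼ parity (ρ.e h)

    -- The extra factor 17^e cancels the one in `g₁`, as 17² ≡ 1 modulo 8λ.
    γ′ : Index → O₈.Carrier
    γ′ h = (b h O₈.∙ εᴼ h) O₈.∙ 17^e h

    g₁ g₂ : Γ.Carrier
    g₁ h = ρ′ h , 17^e h
    g₂ h = ℤ₂₄.ε , γ′ h

    χ₃-ρ′ : ∀ h → χ₃ (val (ρ′ h)) ≡ 0ℙ
    χ₃-ρ′ h = trans (χ₃-∙ (proj₁ (x h)) (εᶻ h)) (trans (cong (χ₃ (rat x h) ⊕_) (χ₃-correctionᶻ (z h) (v h ⊕ w h)))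
      (identity (χ₄ (rat x h)) (χ₃ (rat x h)) (ψ (eis x h)) (χλ (eis x h)) (ρ.Z-bits h)
        (ψ (val (q.γ h))) (χλ (val (q.γ h))) (parity (ρ.e h))))
      where
      identity : ∀ a₄ a₃ b₁ b₂ u g₁ g₂ e → a₃ ⊕ ((a₄ ⊕ u) ⊕
        ((((a₄ ⊕ a₃) ⊕ (b₁ ⊕ b₂)) ⊕ ((u ⊕ e) ⊕ (g₁ ⊕ g₂))) ⊕ ((b₁ ⊕ g₁) ⊕ ((b₂ ⊕ g₂) ⊕ e)))) ≡ 0ℙ
      identity = toWitness {a? = allℙ? λ a₄ → allℙ? λ a₃ → allℙ? λ b₁ → allℙ? λ b₂ → allℙ? λ u →
        allℙ? λ g₁ → allℙ? λ g₂ → allℙ? λ e → a₃ ⊕ ((a₄ ⊕ u) ⊕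
        ((((a₄ ⊕ a₃) ⊕ (b₁ ⊕ b₂)) ⊕ ((u ⊕ e) ⊕ (g₁ ⊕ g₂))) ⊕ ((b₁ ⊕ g₁) ⊕ ((b₂ ⊕ g₂) ⊕ e)))) ℙ.≟ 0ℙ} _

    χ₄-ρ′ : ∀ h → χ₄ (val (ρ′ h)) ≡ ρ.Z-bits h
    χ₄-ρ′ h = trans (χ₄-∙ (proj₁ (x h)) (εᶻ h)) (trans (cong (χ₄ (rat x h) ⊕_) (χ₄-correctionᶻ (z h) (v h ⊕ w h)))
      (trans (sym (ℙ.+-assoc (χ₄ (rat x h)) (χ₄ (rat x h)) (ρ.Z-bits h)))
             (cong (_⊕ ρ.Z-bits h) (ℙ.p+p≡0ℙ (χ₄ (rat x h))))))

    ρ′≡u : ∀ h → val (ρ′ h) ≡ val (ρ.u h) modℤ (+ 4)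
    ρ′≡u h = odd-residues (val (ρ′ h)) (val (ρ.u h)) (rational-odd (ρ′ h)) (rational-odd (ρ.u h)) (χ₄-ρ′ h)

    γ′≡γ : ∀ h → val (γ′ h) ≡ val (q.γ h) modᴼ 4ᴼ
    γ′≡γ h = resᴼ-reflects (trans
      (resᴼ-cong {val (γ′ h)} {(lift (resᴼ (eis x h)) *ᴼ val (εᴼ h)) *ᴼ val (17^e h)}
        (Oᴿ.mod-*-cong 4ᴼ {eis x h *ᴼ val (εᴼ h)} {lift (resᴼ (eis x h)) *ᴼ val (εᴼ h)} {val (17^e h)} {val (17^e h)}
          (Oᴿ.mod-*-cong 4ᴼ {eis x h} {lift (resᴼ (eis x h))} {val (εᴼ h)} {val (εᴼ h)}
            (resᴼ-sound (eis x h)) (Oᴿ.mod-refl 4ᴼ refl))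
          (Oᴿ.mod-refl 4ᴼ refl)))
      (correctᴼ (resᴼ (eis x h)) (resᴼ (val (q.γ h))) (v h) (w h) (parity (ρ.e h))
        (eisenstein-odd (b h)) (eisenstein-odd (q.γ h))))

    χλ-17^ : ∀ p → χλ (val (17ᴼ ^ᴼ p)) ≡ p
    χλ-17^ 0ℙ = refl
    χλ-17^ 1ℙ = refl

    χλ-γ′ : ∀ h → χλ (val (γ′ h)) ≡ χλ (val (q.γ h))
    χλ-γ′ h = trans (χλ-∙ (b h O₈.∙ εᴼ h) (17^e h)) (trans (cong₂ _⊕_
      (trans (χλ-∙ (b h) (εᴼ h)) (cong (χλ (eis x h) ⊕_) (χλ-correctionᴼ (i h) (s h) (v h) (k h) (w h))))
      (χλ-17^ (parity (ρ.e h))))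
      (identity (χλ (eis x h)) (χλ (val (q.γ h))) (parity (ρ.e h)) (p h) (v h)))
      where
      identity : ∀ b g e p v → (b ⊕ (((p ⊕ v) ⊕ v) ⊕ (p ⊕ ((b ⊕ g) ⊕ e)))) ⊕ e ≡ g
      identity = toWitness {a? = allℙ? λ b → allℙ? λ g → allℙ? λ e → allℙ? λ p → allℙ? λ v →
        (b ⊕ (((p ⊕ v) ⊕ v) ⊕ (p ⊕ ((b ⊕ g) ⊕ e)))) ⊕ e ℙ.≟ g} _

    g₁∈R : R⟨ suc a ⟩ g₁
    g₁∈R = ρ.e , ρ.e>0 , ρ.total , g₁
      , (λ h → 1mod6 (val (ρ′ h)) (rational-odd (ρ′ h)) (rational-nonzero (ρ′ h)) (χ₃-ρ′ h))
      , (λ h → Oᴿ.mod-refl 8λ (17ᴼ^-% (ρ.e h)))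
      , ℤᶜ.TransformDivisible-resp {3} (λ h → scale {val (ρ.u h)} {val (ρ′ h)} {ρ.e h} (ρ.e>0 h)
          (ℤᴿ.mod-sym (+ 4) (ρ′≡u h))) ρ.divisible
      , AbelianGroup.refl H {g₁}

    g₂∈Q : Q⟨ suc r ⟩ g₂
    g₂∈Q = q.f , q.f>0 , q.total , g₂
      , (λ h → ℤᴿ.mod-refl (+ 24) refl)
      , (λ h → τ⇒mod-λ (Mod3.res-reflects (trans
          (nonzero-residues (Mod3.res (τ (val (γ′ h)))) (Mod3.res (τ (val (q.γ h))))
            (eisenstein-nonzero (γ′ h)) (eisenstein-nonzero (q.γ h)) (χλ-γ′ h))
          (q.residue h))))
      , Oᶜ.TransformDivisible-resp {3} (λ h → scaleᴼ {val (q.γ h)} {val (γ′ h)} {q.f h} (q.f>0 h)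
          (Oᴿ.mod-sym 4ᴼ (γ′≡γ h))) q.divisible
      , AbelianGroup.refl H {g₂}

    product : x Γ.∙ (E⁺-element z s i z-sum Γ.∙ L-element v k w v-balanced k-balanced) Γ.≈ g₁ Γ.∙ g₂
    product h = ℤ₂₄.sym {ρ′ h ℤ₂₄.∙ ℤ₂₄.ε} {ρ′ h} (ℤ₂₄.identityʳ (ρ′ h))
      , O₈.sym {17^e h O₈.∙ γ′ h} {b h O₈.∙ εᴼ h}
          (square-absorb (b h O₈.∙ εᴼ h) (17^e h) (17ᴼ^-square (parity (ρ.e h))))
      where
      square-absorb : ∀ c d → d O₈.∙ d O₈.≈ O₈.ε → d O₈.∙ (c O₈.∙ d) O₈.≈ c
      square-absorb c d e = O₈.trans {d O₈.∙ (c O₈.∙ d)} {(d O₈.∙ d) O₈.∙ c} {c}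
        (O₈.trans {d O₈.∙ (c O₈.∙ d)} {d O₈.∙ (d O₈.∙ c)} {(d O₈.∙ d) O₈.∙ c}
          (O₈.∙-congˡ {d} {c O₈.∙ d} {d O₈.∙ c} (O₈.comm c d))
          (O₈.sym {(d O₈.∙ d) O₈.∙ c} {d O₈.∙ (d O₈.∙ c)} (O₈.assoc d d c)))
        (O₈.trans {(d O₈.∙ d) O₈.∙ c} {O₈.ε O₈.∙ c} {c}
          (O₈.∙-congʳ {c} {d O₈.∙ d} {O₈.ε} e) (O₈.identityˡ c))

  cover : sumset H R⟨ suc a ⟩ Q⟨ suc r ⟩ x
  cover = g₁ , g₂ , g₁∈R , g₂∈Q , absorb {Γ} {E⁺} {L} {x} {g₁ Γ.∙ g₂}
    {E⁺-element z s i z-sum} {L-element v k w v-balanced k-balanced}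
    (E⁺-element∈E⁺ z s i z-sum) (L-element∈L v k w v-balanced k-balanced) product

-- Each row of a witness table lists eight hexadecimal digits, from the vertex 000 to the vertex 111.
-- In a row for R_e the digit at h is e_h, increased by 8 if u_h is 7 and not 1. In a row for Q_f the
-- digit 4i + 2k + j at h stands for γ_h ≡ ω^i (-1)^j (√-3)^k modulo 4. The rows of a table are indexed
-- by the four parities that the row realises, and unrealisable combinations hold an arbitrary row.

digit : ℕ → Index → ℕ
digit row (b₁ ∷ b₂ ∷ b₃ ∷ []) = shift b₁ 4 (shift b₂ 2 (shift b₃ 1 row)) ℕ.% 16
  where
  shift : Bool → ℕ → ℕ → ℕ
  shift true  _ n = n
  shift false k n = (n ℕ./ (16 ℕ.^ k)) {{ℕₚ.m^n≢0 16 k}}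

R-rows : Fin 4 → Vec ℕ 16
R-rows 0F =
  0x11112222 ∷ 0x111122aa ∷ 0x11112a2a ∷ 0x11112aa2 ∷
  0x112a112a ∷ 0x112a11a2 ∷ 0x121a1a12 ∷ 0x112aa211 ∷
  0xa2221111 ∷ 0x2a221111 ∷ 0x22a21111 ∷ 0x222a1111 ∷
  0x1111a222 ∷ 0x11112a22 ∷ 0x111122a2 ∷ 0x1111222a ∷ []
R-rows 1F =
  0x11111111 ∷ 0x93121212 ∷ 0x91321122 ∷ 0x19321122 ∷
  0x91113222 ∷ 0x19113222 ∷ 0x11913222 ∷ 0x11193222 ∷
  0x1119322a ∷ 0x111932a2 ∷ 0x11193a22 ∷ 0x1119b222 ∷
  0x322a1119 ∷ 0x322a1191 ∷ 0x322a1911 ∷ 0x322a9111 ∷ []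
R-rows 2F =
  0x111133aa ∷ 0x11113322 ∷ 0x11113ba2 ∷ 0x11113b2a ∷
  0x113b11a2 ∷ 0x113b112a ∷ 0x131b121a ∷ 0x113b2a11 ∷
  0x3b221111 ∷ 0xb3221111 ∷ 0x332a1111 ∷ 0x33a21111 ∷
  0x11113b22 ∷ 0x1111b322 ∷ 0x1111332a ∷ 0x111133a2 ∷ []
R-rows 3F =
  0x11114b22 ∷ 0x1111c322 ∷ 0x1111432a ∷ 0x111143a2 ∷
  0x1143112a ∷ 0x114311a2 ∷ 0x14131a12 ∷ 0x1143a211 ∷
  0x43221199 ∷ 0x43221111 ∷ 0x43221991 ∷ 0x43221919 ∷
  0x111143aa ∷ 0x11114322 ∷ 0x11114ba2 ∷ 0x11114b2a ∷ []

-- The parity is the moment 0 of `Y-bits`. Both alternatives realise the same moments of κ but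
-- different moments of η, and `cover-R+Q₈` chooses between them.
Q₈-rows : Parity → Bool → Vec ℕ 16
Q₈-rows 0ℙ false =
  0x00000000 ∷ 0x00000022 ∷ 0x00000202 ∷ 0x00000220 ∷
  0x00020002 ∷ 0x00020020 ∷ 0x00020200 ∷ 0x00020222 ∷
  0x868585b7 ∷ 0x494b4b5a ∷ 0x449b45ba ∷ 0x494b4958 ∷
  0x44459bba ∷ 0x49494b58 ∷ 0x449945b8 ∷ 0x4949495a ∷ []
Q₈-rows 0ℙ true =
  0x00010001 ∷ 0x00010023 ∷ 0x00010203 ∷ 0x00010221 ∷
  0x00030003 ∷ 0x00030021 ∷ 0x00030201 ∷ 0x00030223 ∷
  0x868485b6 ∷ 0x494a4b5b ∷ 0x449a45bb ∷ 0x494a4959 ∷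
  0x44459abb ∷ 0x49484b59 ∷ 0x449845b9 ∷ 0x4948495b ∷ []
Q₈-rows 1ℙ false =
  0x11111111 ∷ 0x4949497b ∷ 0x4499479b ∷ 0x49494b79 ∷
  0x4447999b ∷ 0x494b4979 ∷ 0x449b4799 ∷ 0x494b4b7b ∷
  0x494b4b68 ∷ 0x449b469a ∷ 0x494b496a ∷ 0x49974895 ∷
  0x49494b6a ∷ 0x44994698 ∷ 0x49494968 ∷ 0x49944896 ∷ []
Q₈-rows 1ℙ true =
  0x11111111 ∷ 0x4948497a ∷ 0x4498479a ∷ 0x49484b78 ∷
  0x4447989a ∷ 0x494a4978 ∷ 0x449a4798 ∷ 0x494a4b7a ∷
  0x494a4b69 ∷ 0x449a469b ∷ 0x494a496b ∷ 0x49964894 ∷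
  0x49484b6b ∷ 0x44984699 ∷ 0x49484969 ∷ 0x49954897 ∷ []

R₈-rows : Vec ℕ 16
R₈-rows =
  0x11111111 ∷ 0x11111199 ∷ 0x11111919 ∷ 0x11111991 ∷
  0x11191119 ∷ 0x11191191 ∷ 0x11191911 ∷ 0x11191999 ∷
  0x11111111 ∷ 0x11111199 ∷ 0x11111919 ∷ 0x11111991 ∷
  0x11191119 ∷ 0x11191191 ∷ 0x11191911 ∷ 0x11191999 ∷ []

bit : Parity → ℕ
bit 0ℙ = 0
bit 1ℙ = 1

row-at : Vec ℕ 16 → (Fin 4 → Parity) → ℕ
row-at rows p = Vec.lookup rows ((8 ℕ.* bit (p 0F) ℕ.+ 4 ℕ.* bit (p 1F) ℕ.+ 2 ℕ.* bit (p 2F) ℕ.+ bit (p 3F)) mod 16)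

quad : Bits 2 → Fin 4 → Parity
quad ((p₀ , p₁) , (p₂ , p₃)) = λ { 0F → p₀ ; 1F → p₁ ; 2F → p₂ ; 3F → p₃ }

unquad : (Fin 4 → Parity) → Bits 2
unquad p = (p 0F , p 1F) , (p 2F , p 3F)

quad-unquad : ∀ p i → quad (unquad p) i ≡ p i
quad-unquad p 0F = refl
quad-unquad p 1F = refl
quad-unquad p 2F = refl
quad-unquad p 3F = refl

module R-row (row : ℕ) where
  e : Index → ℕ
  e h = digit row h ℕ.% 8

  u : Index → ℤ₂₄.Carrier
  u h = 7ᶻ ^ᶻ parity (digit row h ℕ./ 8)

  Z-bits Y-bits : Index → Parity
  Z-bits h = χ₄ (val (u h))
  Y-bits h = χ₄ (val (u h)) ⊕ parity (e h)

  Valid : ℕ → Set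
  Valid a = (∀ h → 0 ℕ.< e h) × foldCube ℕ._+_ e ≡ a × 8∣Wℤ (λ h → + (2 ℕ.^ e h) Int.* val (u h))

  valid? : ∀ a → Dec (Valid a)
  valid? a = allVertices? (λ h → 0 ℕₚ.<? e h) ×-dec foldCube ℕ._+_ e ℕₚ.≟ a ×-dec
    8∣Wℤ? (λ h → + (2 ℕ.^ e h) Int.* val (u h))

  witness : ∀ {a} → Valid a → RWitness a
  witness (e>0 , total , W-div) = record
    { e = e ; e>0 = e>0 ; total = total ; u = u ; divisible = 8∣Wℤ⇒divisible _ W-div }

module Q-row (exponents row : ℕ) where
  f : Index → ℕ
  f = digit exponents

  γ : Index → O₈.Carrier
  -- Modulo λ the elements ω, 7 and σ are 1, so 17^f alone produces the residue of 2^f; modulo 4, 7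
  -- serves as -1 and 17 as 1.
  γ h = ((reduce (ω^ ((d ℕ./ 4) mod 3)) O₈.∙ (7ᴼ ^ᴼ parity d)) O₈.∙ (σᴼ ^ᴼ parity (d ℕ./ 2))) O₈.∙ (17ᴼ ^ᴼ parity (f h))
    where d = digit row h

  Y-bits K-bits : Index → Parity
  Y-bits h = η (val (γ h))
  K-bits h = κ (val (γ h))

  Valid : ℕ → Set
  Valid r = (∀ h → 0 ℕ.< f h) × foldCube ℕ._+_ f ≡ r ×
    (∀ h → Mod3.res (τ (val (γ h))) ≡ Mod3.res (τ (fromℤ (+ (2 ℕ.^ f h))))) ×
    8∣W (λ h → fromℤ (+ (2 ℕ.^ f h)) *ᴼ val (γ h))

  valid? : ∀ r → Dec (Valid r)
  valid? r = allVertices? (λ h → 0 ℕₚ.<? f h) ×-dec foldCube ℕ._+_ f ℕₚ.≟ r ×-dec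
    allVertices? (λ h → Mod3.res (τ (val (γ h))) Finₚ.≟ Mod3.res (τ (fromℤ (+ (2 ℕ.^ f h))))) ×-dec
    8∣W? (λ h → fromℤ (+ (2 ℕ.^ f h)) *ᴼ val (γ h))

  witness : ∀ {r} → Valid r → QWitness r
  witness (f>0 , total , residue , W-div) = record
    { f = f ; f>0 = f>0 ; total = total ; γ = γ ; residue = residue ; divisible = 8∣W⇒divisible _ W-div }

Zero : (Fin 4 → Parity) → Set
Zero p = ∀ i → p i ≡ 0ℙ

zero? : ∀ p → Dec (Zero p)
zero? p = all? λ i → p i ℙ.≟ 0ℙ

-- The prescribed sum of `Z-bits` is the only one that `ZY-of-R` allows.
R-table : ∀ j b → ¬ Zero (quad b) → let open R-row (row-at (R-rows j) (quad b)) in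
  Valid (12 ℕ.+ toℕ j) × foldCube _⊕_ Z-bits ≡ quad b 0F ⊕ parity (12 ℕ.+ toℕ j) ×
  (∀ i → moment i Y-bits ≡ quad b i)
R-table = toWitness {a? = all? λ j → allBits? λ b → let open R-row (row-at (R-rows j) (quad b)) in
  ¬? (zero? (quad b)) →-dec valid? (12 ℕ.+ toℕ j) ×-dec
  foldCube _⊕_ Z-bits ℙ.≟ quad b 0F ⊕ parity (12 ℕ.+ toℕ j) ×-dec
  (all? λ i → moment i Y-bits ℙ.≟ quad b i)} _

-- Both Z and Z + Y₀ vanish on R_8, hence the restriction on b.
R₈-table : ∀ b → quad b 0F ≡ 0ℙ → let open R-row (row-at R₈-rows (quad b)) in
  Valid 8 × foldCube _⊕_ Z-bits ≡ 0ℙ × (∀ i → moment i Y-bits ≡ quad b i)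
R₈-table = toWitness {a? = allBits? λ b → let open R-row (row-at R₈-rows (quad b)) in
  quad b 0F ℙ.≟ 0ℙ →-dec valid? 8 ×-dec foldCube _⊕_ Z-bits ℙ.≟ 0ℙ ×-dec
  (all? λ i → moment i Y-bits ℙ.≟ quad b i)} _

module Q₈-row (s : Parity) (alternative : Bool) (b : Bits 2) =
  Q-row 0x11111111 (row-at (Q₈-rows s alternative) (quad b))

Q₈-Realises : Parity → Bool → Bits 2 → Set
Q₈-Realises s alternative b = let open Q₈-row s alternative b in
  Valid 8 × moment 0F Y-bits ≡ s × (∀ i → moment i K-bits ≡ quad b i)

-- The excluded combination is the one ruled out by `Y-of-Q₈`.
Q₈-table : ∀ s b → ¬ (s ≡ 1ℙ × Zero (quad b)) → Q₈-Realises s false b × Q₈-Realises s true b ×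
  ¬ (∀ i → moment i (Q₈-row.Y-bits s false b) ≡ moment i (Q₈-row.Y-bits s true b))
Q₈-table = toWitness {a? = allℙ? λ s → allBits? λ b → ¬? (s ℙ.≟ 1ℙ ×-dec zero? (quad b)) →-dec
  realises? s false b ×-dec realises? s true b ×-dec
  ¬? (all? λ i → moment i (Q₈-row.Y-bits s false b) ℙ.≟ moment i (Q₈-row.Y-bits s true b))} _
  where
  realises? : ∀ s alternative b → Dec (Q₈-Realises s alternative b)
  realises? s alternative b = let open Q₈-row s alternative b in
    valid? 8 ×-dec moment 0F Y-bits ℙ.≟ s ×-dec (all? λ i → moment i K-bits ℙ.≟ quad b i)

-- With exponents not all 1, the combination Y₀ = 1, K = 0 that is missing on Q_8 occurs. Paired
-- with R_8, the totals 10 and 11 give k = 8 + 20 = 28 and k = 8 + 22 = 30.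
module Q₁₀-row = Q-row 0x21111121 0x44080995
module Q₁₁-row = Q-row 0x21111131 0x04080905

Q₁₀-table : Q₁₀-row.Valid 10 × moment 0F Q₁₀-row.Y-bits ≡ 1ℙ × (∀ i → moment i Q₁₀-row.K-bits ≡ 0ℙ)
Q₁₀-table = toWitness {a? = Q₁₀-row.valid? 10 ×-dec moment 0F Q₁₀-row.Y-bits ℙ.≟ 1ℙ ×-dec
  (all? λ i → moment i Q₁₀-row.K-bits ℙ.≟ 0ℙ)} _

Q₁₁-table : Q₁₁-row.Valid 11 × moment 0F Q₁₁-row.Y-bits ≡ 1ℙ × (∀ i → moment i Q₁₁-row.K-bits ≡ 0ℙ)
Q₁₁-table = toWitness {a? = Q₁₁-row.valid? 11 ×-dec moment 0F Q₁₁-row.Y-bits ℙ.≟ 1ℙ ×-dec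
  (all? λ i → moment i Q₁₁-row.K-bits ℙ.≟ 0ℙ)} _

module _ {a r} (ρ : RWitness (suc a)) (q : QWitness (suc r)) (x : |H|) where
  private
    module ρ = RWitness ρ
    module q = QWitness q

  cover : Z x ≡ foldCube _⊕_ ρ.Z-bits → (∀ i → Y i x ⊕ moment i q.Y-bits ≡ moment i ρ.Y-bits) →
          (∀ i → K i x ≡ moment i q.K-bits) → sumset H R⟨ suc a ⟩ Q⟨ suc r ⟩ x
  cover Z≡ Y≡ K≡ = Cover.cover ρ q x Z≡
    (λ i → trans (solve (Y i x) (Y≡ i)) (sym (moment-⊕ i ρ.Y-bits q.Y-bits))) K≡
    where
    solve : ∀ a {b c} → a ⊕ b ≡ c → a ≡ c ⊕ b
    solve a {b} refl = sym (trans (ℙ.+-assoc a b b) (trans (cong (a ⊕_) (ℙ.p+p≡0ℙ b)) (ℙ.+-identityʳ a)))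

-- R_13 does not realise the moment 0; one of the two rows of Q₈ leaves a nonzero one.
cover-R+Q₈ : ∀ j x → ¬ ((Z x ⊕ Y 0F x) ⊕ parity (12 ℕ.+ toℕ j) ≡ 1ℙ × Zero (λ i → K i x)) →
             sumset H R⟨ 12 ℕ.+ toℕ j ⟩ Q⟨ 8 ⟩ x
cover-R+Q₈ j x avoid = choose (zero? (residual false))
  where
  -- As Z + Y₀ is the parity of a on R_a and Z vanishes on Q_8, this is the value of Y₀ required of
  -- the summand in Q_8.
  s : Parity
  s = (Z x ⊕ Y 0F x) ⊕ parity (12 ℕ.+ toℕ j)
  κx : Bits 2
  κx = unquad (λ i → K i x)
  realised = Q₈-table s κx λ { (s≡1 , κ≡0) → avoid (s≡1 , λ i → trans (sym (quad-unquad (λ i → K i x) i)) (κ≡0 i)) }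
  residual : Bool → Fin 4 → Parity
  residual alternative i = Y i x ⊕ moment i (Q₈-row.Y-bits s alternative κx)
  balance : ∀ z y p m → m ≡ (z ⊕ y) ⊕ p → z ≡ (y ⊕ m) ⊕ p
  balance z y p _ refl = table z y p
    where
    table : ∀ z y p → z ≡ (y ⊕ ((z ⊕ y) ⊕ p)) ⊕ p
    table = toWitness {a? = allℙ? λ z → allℙ? λ y → allℙ? λ p → z ℙ.≟ (y ⊕ ((z ⊕ y) ⊕ p)) ⊕ p} _
  finish : ∀ alternative → Q₈-Realises s alternative κx → ¬ Zero (residual alternative) →
           sumset H R⟨ 12 ℕ.+ toℕ j ⟩ Q⟨ 8 ⟩ x
  finish alternative (valid , Y₀≡ , K≡) nonzero = cover (R-row.witness _ (proj₁ row)) (Q-row.witness _ _ valid) x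
    (trans (balance (Z x) (Y 0F x) _ _ Y₀≡) (sym (proj₁ (proj₂ row))))
    (λ i → sym (trans (proj₂ (proj₂ row) i) (quad-unquad (residual alternative) i)))
    (λ i → sym (trans (K≡ i) (quad-unquad (λ i → K i x) i)))
    where
    row = R-table j (unquad (residual alternative))
      λ z → nonzero λ i → trans (sym (quad-unquad (residual alternative) i)) (z i)
  choose : Dec (Zero (residual false)) → sumset H R⟨ 12 ℕ.+ toℕ j ⟩ Q⟨ 8 ⟩ x
  choose (no nonzero) = finish false (proj₁ realised) nonzero
  choose (yes zero₁)  = finish true (proj₁ (proj₂ realised)) λ zero₂ →
    proj₂ (proj₂ realised) λ i → ℙ.+-cancelˡ-≡ (Y i x) _ _ (trans (zero₁ i) (sym (zero₂ i)))

cover-R₈+Q : ∀ {r} (q : QWitness (suc r)) → moment 0F (QWitness.Y-bits q) ≡ 1ℙ →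
  (∀ i → moment i (QWitness.K-bits q) ≡ 0ℙ) → ∀ x → Z x ≡ 0ℙ → Y 0F x ≡ 1ℙ → Zero (λ i → K i x) →
  sumset H R⟨ 8 ⟩ Q⟨ suc r ⟩ x
cover-R₈+Q q Y₀≡1 K≡0 x Z≡0 Y₀x≡1 κ≡0 = cover (R-row.witness _ (proj₁ row)) q x
  (trans Z≡0 (sym (proj₁ (proj₂ row))))
  (λ i → sym (trans (proj₂ (proj₂ row) i) (quad-unquad residual i)))
  (λ i → trans (κ≡0 i) (sym (K≡0 i)))
  where
  residual : Fin 4 → Parity
  residual i = Y i x ⊕ moment i (QWitness.Y-bits q)
  row = R₈-table (unquad residual) (cong₂ _⊕_ Y₀x≡1 Y₀≡1)

parity-+2* : ∀ a r → parity (a ℕ.+ 2 ℕ.* r) ≡ parity a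
parity-+2* a r = trans (ℙ.+-homo-+ a (2 ℕ.* r))
  (trans (cong (parity a ⊕_) (ℙ.*-homo-* 2 r)) (ℙ.+-identityʳ (parity a)))

-- If a ≥ 12 then r ∈ {0, 8}, so that Y₀ vanishes on Q_r; otherwise Z vanishes on R_a and k is even.
C-constraint : ∀ k x → k ℕ.≤ 31 → C k x → Zero (λ i → K i x) →
               Z x ⊕ Y 0F x ≡ parity k ⊎ (Z x ≡ 0ℙ × parity k ≡ 0ℙ)
C-constraint k x k≤31 (a , r , a-ok , r-ok , refl , u , v , u∈ , v∈ , x≈) κ≡0 = by-a a-ok
  where
  Z≡ : Z x ≡ Z u ⊕ Z v
  Z≡ = trans (Zᶜʰ.φ-cong {x} {u +ᴴ v} x≈) (Zᶜʰ.homo u v)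
  Y≡ : Y 0F x ≡ Y 0F u ⊕ Y 0F v
  Y≡ = trans (Yᶜʰ.φ-cong 0F {x} {u +ᴴ v} x≈) (Yᶜʰ.homo 0F u v)
  K-v : Zero (λ i → K i v)
  K-v i = trans (cong (_⊕ K i v) (sym (K-of-R a u u∈ i)))
    (trans (sym (trans (Kᶜʰ.φ-cong i {x} {u +ᴴ v} x≈) (Kᶜʰ.homo i u v))) (κ≡0 i))
  from-Y : Y 0F v ≡ 0ℙ → Z x ⊕ Y 0F x ≡ parity (a ℕ.+ 2 ℕ.* r)
  from-Y Y-v = trans (cong₂ _⊕_ (trans Z≡ (trans (cong (Z u ⊕_) (Z-of-Q r v v∈)) (ℙ.+-identityʳ (Z u))))
                                (trans Y≡ (trans (cong (Y 0F u ⊕_) Y-v) (ℙ.+-identityʳ (Y 0F u)))))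
    (trans (ZY-of-R a u u∈) (sym (parity-+2* a r)))
  from-Z : Z u ≡ 0ℙ → parity a ≡ 0ℙ → Z x ≡ 0ℙ × parity (a ℕ.+ 2 ℕ.* r) ≡ 0ℙ
  from-Z Z-u p = trans Z≡ (cong₂ _⊕_ Z-u (Z-of-Q r v v∈)) , trans (parity-+2* a r) p
  Y₀ : ∀ r → r ≡ 0 → Q⟨ r ⟩ v → Y 0F v ≡ 0ℙ
  Y₀ _ refl v≈0 = trans (Yᶜʰ.φ-cong 0F {v} {0ᴴ} v≈0) (Yᶜʰ.φ-ε 0F)
  Y₈ : ∀ r → r ≡ 8 → Q⟨ r ⟩ v → Y 0F v ≡ 0ℙ
  Y₈ _ refl v∈ = Y-of-Q₈ v v∈ K-v
  Z₀ : ∀ a → a ≡ 0 → R⟨ a ⟩ u → Z u ≡ 0ℙ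
  Z₀ _ refl u≈0 = trans (Zᶜʰ.φ-cong {u} {0ᴴ} u≈0) Zᶜʰ.φ-ε
  Z₈ : ∀ a → a ≡ 8 → R⟨ a ⟩ u → Z u ≡ 0ℙ
  Z₈ _ refl u∈ = Z-of-R₈ u u∈
  by-r : 12 ℕ.≤ a → r ≡ 0 ⊎ r ≡ 8 ⊎ 10 ℕ.≤ r →
         Z x ⊕ Y 0F x ≡ parity (a ℕ.+ 2 ℕ.* r) ⊎ (Z x ≡ 0ℙ × parity (a ℕ.+ 2 ℕ.* r) ≡ 0ℙ)
  by-r _    (inj₁ r≡0)        = inj₁ (from-Y (Y₀ r r≡0 v∈))
  by-r _    (inj₂ (inj₁ r≡8)) = inj₁ (from-Y (Y₈ r r≡8 v∈))
  -- Already 12 + 2 · 10 = 32 exceeds the bound 31 on k.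
  by-r 12≤a (inj₂ (inj₂ 10≤r)) = ⊥-elim (ℕₚ.<⇒≱ (ℕₚ.+-mono-≤ 12≤a (ℕₚ.*-monoʳ-≤ 2 10≤r)) k≤31)
  by-a : a ≡ 0 ⊎ a ≡ 8 ⊎ 12 ℕ.≤ a →
         Z x ⊕ Y 0F x ≡ parity (a ℕ.+ 2 ℕ.* r) ⊎ (Z x ≡ 0ℙ × parity (a ℕ.+ 2 ℕ.* r) ≡ 0ℙ)
  by-a (inj₁ a≡0)         = inj₂ (from-Z (Z₀ a a≡0 u∈) (cong parity a≡0))
  by-a (inj₂ (inj₁ a≡8))  = inj₂ (from-Z (Z₈ a a≡8 u∈) (cong parity a≡8))
  by-a (inj₂ (inj₂ 12≤a)) = by-r 12≤a r-ok

-- Complements of a coset of a common kernel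

-- B is presented as the complement of a single fibre of a surjection onto F₂ⁿ. The stabilizer, the
-- quotient, the omitted class and the criterion are all derived from this form.
record Separation (G : Group₀) (B : Pred (AbelianGroup.Carrier G) 0ℓ) (n : ℕ) : Set where
  open AbelianGroup G using (Carrier)
  field
    χ           : Fin n → Carrier → Parity
    χ-character : ∀ i → Character G (χ i)
    section     : (Fin n → Parity) → Carrier
    χ-section   : ∀ p i → χ i (section p) ≡ p i
    t           : Fin n → Parity
    ⇒≢t         : ∀ x → B x → ¬ (∀ i → χ i x ≡ t i)
    ≢t⇒         : ∀ x → ¬ (∀ i → χ i x ≡ t i) → B x

module Separated (G : Group₀) (B : Pred (AbelianGroup.Carrier G) 0ℓ) (B-resp : B Respects AbelianGroup._≈_ G)
  {n : ℕ} (separation : Separation G B n) where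

  open Separation separation public
  private
    open module G = AbelianGroup G using (Carrier; _≈_; _∙_; _⁻¹; ε)
    module χ i = Character (χ-character i)
    S = stabilizer G B B-resp
    open module G/S = AbelianGroup (G /ˢ S) using () renaming (_≈_ to _~_)

  Trivial : Carrier → Set
  Trivial x = ∀ i → χ i x ≡ 0ℙ

  trivial? : ∀ x → Dec (Trivial x)
  trivial? x = all? λ i → χ i x ℙ.≟ 0ℙ

  at-t? : ∀ x → Dec (∀ i → χ i x ≡ t i)
  at-t? x = all? λ i → χ i x ℙ.≟ t i

  -- If some character is nonzero on g, an element x with χ(x) = t + χ(g) lies in B, whereas x + g
  -- takes the omitted value t.
  stabilizer⇒trivial : ∀ g → Subgroup.Member S g → Trivial g
  stabilizer⇒trivial g (to , _) = decidable-stable (trivial? g) λ nontrivial →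
    ⇒≢t (x ∙ g) (to (x , x∈B nontrivial , G.refl)) λ i →
      trans (χ.homo i x g) (trans (cong (_⊕ χ i g) (χ-section _ i))
        (trans (ℙ.+-assoc (t i) (χ i g) (χ i g)) (trans (cong (t i ⊕_) (ℙ.p+p≡0ℙ (χ i g))) (ℙ.+-identityʳ (t i)))))
    where
    x = section λ i → t i ⊕ χ i g
    x∈B : ¬ Trivial g → B x
    x∈B nontrivial = ≢t⇒ x λ x≡t → nontrivial λ i → ℙ.+-cancelˡ-≡ (t i) (χ i g) 0ℙ
      (trans (sym (χ-section _ i)) (trans (x≡t i) (sym (ℙ.+-identityʳ (t i)))))

  trivial⇒stabilizer : ∀ g → Trivial g → Subgroup.Member S g
  trivial⇒stabilizer g trivial =
      (λ { {x} (b , b∈ , e) → ≢t⇒ x λ x≡t → ⇒≢t b b∈ λ i → trans (sym (ℙ.+-identityʳ (χ i b)))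
            (trans (cong (χ i b ⊕_) (sym (trivial i))) (trans (sym (χ.homo i b g))
              (trans (sym (χ.φ-cong i e)) (x≡t i)))) })
    , (λ {x} x∈ → x ∙ g ⁻¹ , ≢t⇒ (x ∙ g ⁻¹) (λ x≡t → ⇒≢t x x∈ λ i → trans (sym (shift x i)) (x≡t i))
        , G.sym (AbelianGroupProperties.//-rightDividesˡ G g x))
    where
    shift : ∀ x i → χ i (x ∙ g ⁻¹) ≡ χ i x
    shift x i = trans (χ.homo i x (g ⁻¹)) 
      (trans (cong (χ i x ⊕_) (trans (χ.φ-⁻¹ i g) (trivial i))) (ℙ.+-identityʳ (χ i x)))

  ~⇒χ : ∀ {x y} → x ~ y → ∀ i → χ i x ≡ χ i y
  ~⇒χ {x} {y} (coset x-y∈) i = ℙ.+-cancelʳ-≡ (χ i y) (χ i x) (χ i y)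
    (trans (trans (cong (χ i x ⊕_) (sym (χ.φ-⁻¹ i y))) (sym (χ.homo i x (y ⁻¹))))
    (trans (stabilizer⇒trivial (x ∙ y ⁻¹) x-y∈ i) (sym (ℙ.p+p≡0ℙ (χ i y)))))

  χ⇒~ : ∀ {x y} → (∀ i → χ i x ≡ χ i y) → x ~ y
  χ⇒~ {x} {y} e = coset (trivial⇒stabilizer (x ∙ y ⁻¹) λ i →
    trans (χ.homo i x (y ⁻¹)) (trans (cong₂ _⊕_ (e i) (χ.φ-⁻¹ i y)) (ℙ.p+p≡0ℙ (χ i y))))

  isomorphism : (G /ˢ S) ≅ (C₂^ n)
  isomorphism = (λ x i → χ i x) , record
    { isGroupMonomorphism = record
      { isGroupHomomorphism = record
        { isMonoidHomomorphism = record
          { isMagmaHomomorphism = record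
            { isRelHomomorphism = record { cong = ~⇒χ }
            ; homo              = λ x y i → χ.homo i x y
            }
          ; ε-homo = λ i → χ.φ-ε i
          }
        ; ⁻¹-homo = λ x i → χ.φ-⁻¹ i x
        }
      ; injective = χ⇒~
      }
    ; surjective = λ p → section p , λ z~ i → trans (~⇒χ z~ i) (χ-section p i)
    }

  omitted : Carrier
  omitted = section t

  omitted∉ : ¬ (∃[ x ] B x × omitted ~ x)
  omitted∉ (x , x∈ , t~x) = ⇒≢t x x∈ λ i → trans (sym (~⇒χ t~x i)) (χ-section t i)

  only-omitted : ∀ y → ¬ (∃[ x ] B x × y ~ x) → y ~ omitted
  only-omitted y y∉ = χ⇒~ λ i → trans (decidable-stable (at-t? y)
    (λ y≢t → y∉ (y , ≢t⇒ y y≢t , G/S.refl {y})) i) (sym (χ-section t i))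

  nontrivial-factor : ∀ {x a b} → x ≈ a ∙ b → ¬ Trivial x → ¬ Trivial a ⊎ ¬ Trivial b
  nontrivial-factor {x} {a} {b} e nontrivial = decide (trivial? a)
    where
    decide : Dec (Trivial a) → ¬ Trivial a ⊎ ¬ Trivial b
    decide (no a≢0)  = inj₁ a≢0
    decide (yes a≡0) = inj₂ λ b≡0 → nontrivial λ i →
      trans (χ.φ-cong i e) (trans (χ.homo i a b) (cong₂ _⊕_ (a≡0 i) (b≡0 i)))

  nontrivial-summand : ∀ {A : Set} (P : A → Pred Carrier 0ℓ) as {x} →
    List.foldr (sumset G) (_≈ ε) (List.map P as) x → ¬ Trivial x →
    ∃[ a ] a ∈ as × ∃[ y ] P a y × ¬ Trivial y
  nontrivial-summand P []       x≈ε nontrivial = ⊥-elim (nontrivial λ i → trans (χ.φ-cong i x≈ε) (χ.φ-ε i))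
  nontrivial-summand P (a ∷ as) (y , z , y∈ , z∈ , e) nontrivial =
    [ (λ y≢0 → a , here refl , y , y∈ , y≢0)
    , (λ z≢0 → let a , a∈ , rest = nontrivial-summand P as z∈ z≢0 in a , there a∈ , rest)
    ]′ (nontrivial-factor e nontrivial)

  nontrivial-term : ∀ {A : Set} (f : A → Carrier) (weight : A → ℕ) as →
    ¬ Trivial (List.foldr _∙_ ε (List.map f as)) →
    ∃[ a ] ¬ Trivial (f a) × weight a ℕ.≤ sum (List.map weight as)
  nontrivial-term f weight []       nontrivial = ⊥-elim (nontrivial λ i → χ.φ-ε i)
  nontrivial-term f weight (a ∷ as) nontrivial =
    [ (λ a≢0 → a , a≢0 , ℕₚ.m≤m+n (weight a) (sum (List.map weight as)))
    , (λ rest → let b , b≢0 , b≤ = nontrivial-term f weight as rest in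
                b , b≢0 , ℕₚ.≤-trans b≤ (ℕₚ.m≤n+m (sum (List.map weight as)) (weight a)))
    ]′ (nontrivial-factor G.refl nontrivial)

  nontrivial-cong : ∀ {x y} → x ≈ y → ¬ Trivial x → ¬ Trivial y
  nontrivial-cong e nontrivial y≡0 = nontrivial λ i → trans (χ.φ-cong i e) (y≡0 i)

  module _ {A : Pred Carrier 0ℓ} {g : Carrier} where

    meets : ∀ {a} → A a → ¬ (∀ i → χ i a ⊕ χ i g ≡ t i) → Satisfiable (translate G A g ∩ B)
    meets {a} a∈ avoids = a ∙ g , (a , a∈ , G.refl) ,
      ≢t⇒ (a ∙ g) λ e → avoids λ i → trans (sym (χ.homo i a g)) (e i)

    meets⁻¹ : Satisfiable (translate G A g ∩ B) → (∀ i → χ i g ≡ t i) → ∃[ a ] A a × ¬ Trivial a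
    meets⁻¹ (x , (a , a∈ , e) , x∈) g≡t = a , a∈ , λ a≡0 → ⇒≢t x x∈ λ i →
      trans (χ.φ-cong i e) (trans (χ.homo i a g) (cong₂ _⊕_ (a≡0 i) (g≡t i)))

    -- If χ(g) differs from t, the summand ε already gives a point of B; if χ(g) = t, exactly the
    -- summands with a nonzero character value lead into B.
    meets⇔ : ∀ {Useful : Set} → A ε → (∃[ a ] A a × ¬ Trivial a → Useful) → (Useful → ∃[ a ] A a × ¬ Trivial a) →
             Satisfiable (translate G A g ∩ B) ⇔ (¬ (g ~ omitted) ⊎ Useful)
    meets⇔ {Useful} ε∈ useful useful⁻¹ = mk⇔ (λ meeting → forth meeting (at-t? g)) back
      where
      forth : Satisfiable (translate G A g ∩ B) → Dec (∀ i → χ i g ≡ t i) → ¬ (g ~ omitted) ⊎ Useful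
      forth _       (no g≢t)  = inj₁ λ g~t → g≢t λ i → trans (~⇒χ g~t i) (χ-section t i)
      forth meeting (yes g≡t) = inj₂ (useful (meets⁻¹ meeting g≡t))
      stay : ¬ (∀ i → χ i g ≡ t i) → Satisfiable (translate G A g ∩ B)
      stay g≢t = meets ε∈ λ e → g≢t λ i → trans (cong (_⊕ χ i g) (sym (χ.φ-ε i))) (e i)
      move : ∃[ a ] A a × ¬ Trivial a → Dec (∀ i → χ i g ≡ t i) → Satisfiable (translate G A g ∩ B)
      move _                (no g≢t)  = stay g≢t
      move (a , a∈ , a≢0) (yes g≡t) = meets a∈ λ e → a≢0 λ i → ℙ.+-cancelʳ-≡ (t i) (χ i a) 0ℙ
        (trans (cong (χ i a ⊕_) (sym (g≡t i))) (e i))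
      back : ¬ (g ~ omitted) ⊎ Useful → Satisfiable (translate G A g ∩ B)
      back (inj₁ g≁t)    = stay λ g≡t → g≁t (χ⇒~ λ i → trans (g≡t i) (sym (χ-section t i)))
      back (inj₂ useful) = move (useful⁻¹ useful) (at-t? g)

  ≁ε⇒nontrivial : ∀ x → ¬ (x ~ ε) → ¬ Trivial x
  ≁ε⇒nontrivial x x≁ε x≡0 = x≁ε (χ⇒~ λ i → trans (x≡0 i) (sym (χ.φ-ε i)))

  nontrivial⇒≁ε : ∀ x → ¬ Trivial x → ¬ (x ~ ε)
  nontrivial⇒≁ε x x≢0 x~ε = x≢0 λ i → trans (~⇒χ x~ε i) (χ.φ-ε i)

-- Sumsets, exponents of primes and costs of moves

module _ (G : Group₀) where
  private open module G = AbelianGroup G using (Carrier; _≈_; _∙_; ε)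

  ε∈sum : ∀ {A : Set} (P : A → Pred Carrier 0ℓ) as → (∀ a → a ∈ as → P a ε) →
          List.foldr (sumset G) (_≈ ε) (List.map P as) ε
  ε∈sum P []       p = G.refl
  ε∈sum P (a ∷ as) p = ε , ε , p a (here refl) , ε∈sum P as (λ b b∈ → p b (there b∈)) , G.sym (G.identityˡ ε)

  summand∈sum : ∀ {A : Set} (P : A → Pred Carrier 0ℓ) as → (∀ a → a ∈ as → P a ε) →
    ∀ {a x} → a ∈ as → P a x → List.foldr (sumset G) (_≈ ε) (List.map P as) x
  summand∈sum P (a ∷ as) p {x = x} (here refl) x∈ =
    x , ε , x∈ , ε∈sum P as (λ b b∈ → p b (there b∈)) , G.sym (G.identityʳ x)
  summand∈sum P (a ∷ as) p {x = x} (there a∈) x∈ =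
    ε , x , p a (here refl) , summand∈sum P as (λ b b∈ → p b (there b∈)) a∈ x∈ , G.sym (G.identityˡ x)

  singleton-sum : ∀ {A : Set} (f : A → Carrier) {a} as → as ≡ a ∷ [] → f a ≈ List.foldr _∙_ ε (List.map f as)
  singleton-sum f {a} _ refl = G.sym (G.identityʳ (f a))

∃-exponent : ∀ {q} → 2 ℕ.≤ q → ∀ bound n → n ℕ.≤ bound → n ≢ 0 → ∃[ e ] q ^ e ∥ n
∃-exponent {q} 2≤q zero    n n≤ n≢0 = contradiction (ℕₚ.n≤0⇒n≡0 n≤) n≢0
∃-exponent {q} 2≤q (suc bound) n n≤ n≢0 = decide (q ℕ∣.∣? n)
  where
  instance
    q≢0 : NonZero q
    q≢0 = ℕ.>-nonZero (ℕₚ.<-trans (ℕ.s≤s ℕ.z≤n) 2≤q)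
  decide : Dec (q ℕ∣.∣ n) → ∃[ e ] q ^ e ∥ n
  decide (no q∤n) = 0 , ℕ∣.1∣ n , λ q∣n → q∤n (subst (ℕ∣._∣ n) (ℕₚ.*-identityʳ q) q∣n)
  decide (yes (ℕ∣.divides m refl)) = suc e ,
      subst (q ℕ.* q ℕ.^ e ℕ∣.∣_) (ℕₚ.*-comm q m) (ℕ∣.*-monoʳ-∣ q q^e∣m) ,
      λ q^∣ → q^∤m (ℕ∣.*-cancelˡ-∣ q (subst (q ℕ.* q ℕ.^ suc e ℕ∣.∣_) (ℕₚ.*-comm m q) q^∣))
    where
    m≢0 : m ≢ 0
    m≢0 refl = n≢0 refl
    m<n : m ℕ.< m ℕ.* q
    m<n = ℕₚ.m<m*n m q {{ℕ.≢-nonZero m≢0}} 2≤q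
    rec = ∃-exponent 2≤q bound m (ℕₚ.≤-pred (ℕₚ.≤-trans m<n n≤)) m≢0
    e = proj₁ rec
    q^e∣m = proj₁ (proj₂ rec)
    q^∤m = proj₂ (proj₂ rec)

-- ϖ ∣ q gives q^f = N ϖ ∣ N q = q².
cost≤2 : ∀ {q} (μ : Move q) → cost μ ℕ.≤ 2
cost≤2     (rational _ _ _ _) = ℕ.s≤s ℕ.z≤n
cost≤2 {q} (eisenstein pr 3<q h ϖ f _ ϖ∣q Nϖ≡q^f) = ℕₚ.≮⇒≥ λ 2<f →
  ℕₚ.<⇒≱ (ℕₚ.^-monoʳ-< q (ℕₚ.<-trans (ℕ.s≤s (ℕ.s≤s ℕ.z≤n)) 3<q) 2<f) (ℕ∣.∣⇒≤ q^f∣q²)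
  where
  open RawMagmaDefinitions._∣ʳ_ ϖ∣q using (quotient; equality)
  instance
    q²≢0 : NonZero (q ℕ.^ 2)
    q²≢0 = ℕₚ.m^n≢0 q 2 {{ℕ.>-nonZero (ℕₚ.<-trans (ℕ.s≤s ℕ.z≤n) 3<q)}}
  N-fromℤ : ∀ i → N (fromℤ i) ≡ i Int.* i
  N-fromℤ = eq
    where
    open Int using (_+_; _*_; _-_)
    eq : ∀ i → i * i - i * + 0 + + 0 * + 0 ≡ i * i
    eq = ℤ-Solver.solve-∀
  q^f∣q² : q ℕ.^ f ℕ∣.∣ q ℕ.^ 2
  q^f∣q² = ℕ∣.divides Int.∣ N quotient ∣ (trans (cong (q ℕ.*_) (ℕₚ.*-identityʳ q))
    (trans (sym (ℤₚ.abs-* (+ q) (+ q))) (trans (cong Int.∣_∣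
      (trans (sym (N-fromℤ (+ q))) (trans (cong N (sym equality))
        (trans (N-* quotient ϖ) (cong (N quotient Int.*_) Nϖ≡q^f)))))
      (ℤₚ.abs-* (N quotient) (+ (q ℕ.^ f))))))

-- The criterion

module Criterion {k n} (separation : Separation H (C k) n) where
  open Separated H (C k) (C-resp k) separation public

  module _ (m : ℤ) (m⊥6 : Coprime m (+ 6)) where
    private
      M≢0 : Int.∣ m ∣ ≢ 0
      M≢0 M≡0 = six≢1 (m⊥6 {6} (subst (6 ℕ∣.∣_) (sym M≡0) (6 ℕ∣.∣0) , ℕ∣.∣-refl))
        where
        six≢1 : 6 ≢ 1
        six≢1 ()

      Part : ℕ → Pred |H| 0ℓ
      Part q x = ∃[ e ] q ^ e ∥ Int.∣ m ∣ × P q (e ℕ.⊓ 26) x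

      isDivisor? : ∀ q → Dec (Prime q × q ℕ∣.∣ Int.∣ m ∣)
      isDivisor? q = prime? q ×-dec q ℕ∣.∣? Int.∣ m ∣

      divisor⁻ : ∀ {q} → q ∈ primeDivisors Int.∣ m ∣ → Prime q × q ℕ∣.∣ Int.∣ m ∣
      divisor⁻ q∈ = proj₂ (∈-filter⁻ isDivisor? {xs = List.upTo (suc Int.∣ m ∣)} q∈)

      divisor⁺ : ∀ {q} → Prime q → q ℕ∣.∣ Int.∣ m ∣ → q ∈ primeDivisors Int.∣ m ∣
      divisor⁺ pr q∣M = ∈-filter⁺ isDivisor? (∈-upTo⁺ (ℕ.s≤s (ℕ∣.∣⇒≤ {{ℕ.≢-nonZero M≢0}} q∣M))) (pr , q∣M)

      0∈Part : ∀ q → q ∈ primeDivisors Int.∣ m ∣ → Part q 0ᴴ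
      0∈Part q q∈ =
        let e , q^e∥M = ∃-exponent (ℕ.nonTrivial⇒n>1 q {{prime⇒nonTrivial (proj₁ (divisor⁻ q∈))}})
                          Int.∣ m ∣ Int.∣ m ∣ ℕₚ.≤-refl M≢0
        in e , q^e∥M , [] , ℕ.z≤n , AbelianGroup.refl H {0ᴴ}

      Useful : Set
      Useful = UsefulMove k m

      useful-move : ∀ q → q ∈ primeDivisors Int.∣ m ∣ → ∀ e → q ^ e ∥ Int.∣ m ∣ → (μ : Move q) →
                    ¬ Trivial (value μ) → cost μ ℕ.≤ e → Useful
      useful-move q q∈ e q^e∥M μ μ≢0 μ≤e = q , proj₁ (divisor⁻ q∈) , proj₂ (divisor⁻ q∈) , μ
        , nontrivial⇒≁ε (value μ) μ≢0 , e , q^e∥M , μ≤e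

      useful-part : ∀ q → q ∈ primeDivisors Int.∣ m ∣ → ∀ x → Part q x → ¬ Trivial x → Useful
      useful-part q q∈ x (e , q^e∥M , ms , cost≤ , x≈) x≢0 =
        from-term (nontrivial-term value cost ms (nontrivial-cong {x} {List.foldr _+ᴴ_ 0ᴴ (List.map value ms)} x≈ x≢0))
        where
        from-term : ∃[ μ ] ¬ Trivial (value μ) × cost μ ℕ.≤ sum (List.map cost ms) → Useful
        from-term (μ , μ≢0 , μ≤) = useful-move q q∈ e q^e∥M μ μ≢0
          (ℕₚ.≤-trans μ≤ (ℕₚ.≤-trans cost≤ (ℕₚ.m⊓n≤m e 26)))

      useful-sum : ∃[ x ] primeSum Int.∣ m ∣ x × ¬ Trivial x → Useful
      useful-sum (x , x∈ , x≢0) = from-part (nontrivial-summand Part (primeDivisors Int.∣ m ∣) {x} x∈ x≢0)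
        where
        from-part : ∃[ q ] q ∈ primeDivisors Int.∣ m ∣ × ∃[ x ] Part q x × ¬ Trivial x → Useful
        from-part (q , q∈ , x , x∈ , x≢0) = useful-part q q∈ x x∈ x≢0

      -- ms stays a variable: were the sum to unfold, conversion would compare the proofs inside units.
      move∈P : ∀ {q} (μ : Move q) ms → ms ≡ μ ∷ [] → ∀ e → cost μ ℕ.≤ e → P q (e ℕ.⊓ 26) (value μ)
      move∈P μ ms ms≡ e μ≤e = ms , cost≤ ms ms≡ , singleton-sum H value ms ms≡
        where
        cost≤ : ∀ ms → ms ≡ μ ∷ [] → sum (List.map cost ms) ℕ.≤ e ℕ.⊓ 26
        cost≤ _ refl = ℕₚ.≤-trans (ℕₚ.≤-reflexive (ℕₚ.+-identityʳ (cost μ)))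
          (ℕₚ.⊓-glb μ≤e (ℕₚ.≤-trans (cost≤2 μ) (ℕₚ.m≤m+n 2 24)))

      useful-sum⁻¹ : Useful → ∃[ x ] primeSum Int.∣ m ∣ x × ¬ Trivial x
      useful-sum⁻¹ (q , pr , q∣M , μ , μ≁0 , e , q^e∥M , μ≤e) = value μ
        , summand∈sum H Part (primeDivisors Int.∣ m ∣) 0∈Part {q} {value μ} (divisor⁺ pr q∣M)
            (e , q^e∥M , move∈P μ (μ ∷ []) refl e μ≤e)
        , ≁ε⇒nontrivial (value μ) μ≁0

    criterion : Represented k m m⊥6 ⇔ (¬ (H/P._≈_ k (π k (c m m⊥6)) omitted) ⊎ UsefulMove k m)
    criterion = meets⇔ {primeSum Int.∣ m ∣} {c m m⊥6} {UsefulMove k m}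
      (ε∈sum H Part (primeDivisors Int.∣ m ∣) 0∈Part) useful-sum useful-sum⁻¹

  omits-exactly : OmitsExactly k omitted
  omits-exactly = omitted∉ , only-omitted

-- The cases k = 28, 29, 30, 31

⊕-character : ∀ {G φ ψ} → Character G φ → Character G ψ → Character G (λ x → φ x ⊕ ψ x)
⊕-character {G} {φ} {ψ} φ-character ψ-character = record
  { homo   = λ x y → trans (cong₂ _⊕_ (φ.homo x y) (ψ.homo x y)) (interchange (φ x) (φ y) (ψ x) (ψ y))
  ; φ-cong = λ e → cong₂ _⊕_ (φ.φ-cong e) (ψ.φ-cong e)
  }
  where
  module φ = Character φ-character
  module ψ = Character ψ-character

-- The origin lies on none of the faces h_i = 1, so its entry affects moment 0 only. There
-- `correctionᶻ z w` has χ₄ = z and χ₁₂ = w, and the exponent of σ corrects the total of κ to p₀; η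
-- is trivial on σ.
representative : (z w : Parity) → (Fin 4 → Parity) → |H|
representative z w p (false ∷ false ∷ false ∷ []) = correctionᶻ z w , σᴼ ^ᴼ (p 0F ⊕ p 1F ⊕ p 2F ⊕ p 3F)
representative z w p (true ∷ false ∷ false ∷ [])  = ℤ₂₄.ε , σᴼ ^ᴼ p 1F
representative z w p (false ∷ true ∷ false ∷ [])  = ℤ₂₄.ε , σᴼ ^ᴼ p 2F
representative z w p (false ∷ false ∷ true ∷ [])  = ℤ₂₄.ε , σᴼ ^ᴼ p 3F
representative z w p _                            = ℤ₂₄.ε , O₈.ε

representative-characters : ∀ z w b → let g = representative z w (quad b) in
  Z g ≡ z × Y 0F g ≡ w × (∀ i → K i g ≡ quad b i)
representative-characters = toWitness {a? = allℙ? λ z → allℙ? λ w → allBits? λ b →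
  let g = representative z w (quad b) in
  Z g ℙ.≟ z ×-dec Y 0F g ℙ.≟ w ×-dec (all? λ i → K i g ℙ.≟ quad b i)} _

C-intro : ∀ {k} a r {x} → a ≡ 8 ⊎ 12 ℕ.≤ a → r ≡ 8 ⊎ 10 ℕ.≤ r → a ℕ.+ 2 ℕ.* r ≡ k →
          sumset H R⟨ a ⟩ Q⟨ r ⟩ x → C k x
C-intro a r a-ok r-ok e x∈ = a , r , inj₂ a-ok , inj₂ r-ok , e , x∈

C-intro₈ : ∀ j x → ¬ ((Z x ⊕ Y 0F x) ⊕ parity (12 ℕ.+ toℕ j) ≡ 1ℙ × Zero (λ i → K i x)) → C (28 ℕ.+ toℕ j) x
C-intro₈ j x avoid = C-intro (12 ℕ.+ toℕ j) 8 (inj₂ (ℕₚ.m≤m+n 12 (toℕ j))) (inj₁ refl)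
  (ℕₚ.+-comm (12 ℕ.+ toℕ j) 16) (cover-R+Q₈ j x avoid)

≡0⊎≡1 : ∀ p → p ≡ 0ℙ ⊎ p ≡ 1ℙ
≡0⊎≡1 0ℙ = inj₁ refl
≡0⊎≡1 1ℙ = inj₂ refl

1≢0 : 1ℙ ≢ 0ℙ
1≢0 ()

28+j≤31 : ∀ (j : Fin 4) → 28 ℕ.+ toℕ j ℕ.≤ 31
28+j≤31 j = ℕₚ.+-monoʳ-≤ 28 (Finₚ.toℕ≤pred[n] j)

module Even (j : Fin 4) (j-even : parity (12 ℕ.+ toℕ j) ≡ 0ℙ)
  (r : ℕ) (10≤r : 10 ℕ.≤ suc r) (8+2r≡k : 8 ℕ.+ 2 ℕ.* suc r ≡ 28 ℕ.+ toℕ j)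
  (q : QWitness (suc r)) (Y₀≡1 : moment 0F (QWitness.Y-bits q) ≡ 1ℙ)
  (K≡0 : ∀ i → moment i (QWitness.K-bits q) ≡ 0ℙ) where

  χ : Fin 6 → |H| → Parity
  χ 0F            = Z
  χ 1F            = Y 0F
  χ (suc (suc i)) = K i

  t : Fin 6 → Parity
  t 0F      = 1ℙ
  t (suc _) = 0ℙ

  section : (Fin 6 → Parity) → |H|
  section p = representative (p 0F) (p 1F) (quad (unquad λ i → p (suc (suc i))))

  χ-section : ∀ p i → χ i (section p) ≡ p i
  χ-section p = λ where
      0F            → proj₁ values
      1F            → proj₁ (proj₂ values)
      (suc (suc i)) → trans (proj₂ (proj₂ values) i) (quad-unquad (λ i → p (suc (suc i))) i)
    where values = representative-characters (p 0F) (p 1F) (unquad λ i → p (suc (suc i)))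

  ⇒≢t : ∀ x → C (28 ℕ.+ toℕ j) x → ¬ (∀ i → χ i x ≡ t i)
  ⇒≢t x x∈ χ≡t =
    [ (λ e → 1≢0 (trans (sym (cong₂ _⊕_ (χ≡t 0F) (χ≡t 1F))) (trans e j-even)))
    , (λ e → 1≢0 (trans (sym (χ≡t 0F)) (proj₁ e)))
    ]′ (C-constraint (28 ℕ.+ toℕ j) x (28+j≤31 j) x∈ (λ i → χ≡t (suc (suc i))))

  -- The sumset R_{k-16} + Q_8 misses only classes with Z + Y₀ = 1 and K = 0. Among these, (Z, Y₀) =
  -- (0, 1) is reached from R_8, and (1, 0) is the omitted value.
  ≢t⇒ : ∀ x → ¬ (∀ i → χ i x ≡ t i) → C (28 ℕ.+ toℕ j) x
  ≢t⇒ x χ≢t = cases (≡0⊎≡1 (Z x)) (≡0⊎≡1 (Y 0F x)) (zero? (λ i → K i x))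
    where
    balanced : Z x ⊕ Y 0F x ≡ 0ℙ → C (28 ℕ.+ toℕ j) x
    balanced e = C-intro₈ j x λ s → 1≢0 (trans (sym (proj₁ s)) (cong₂ _⊕_ e j-even))
    cases : Z x ≡ 0ℙ ⊎ Z x ≡ 1ℙ → Y 0F x ≡ 0ℙ ⊎ Y 0F x ≡ 1ℙ → Dec (Zero (λ i → K i x)) → C (28 ℕ.+ toℕ j) x
    cases _          _          (no K≢0)  = C-intro₈ j x λ s → K≢0 (proj₂ s)
    cases (inj₁ Z≡0) (inj₁ Y≡0) (yes _)   = balanced (cong₂ _⊕_ Z≡0 Y≡0)
    cases (inj₂ Z≡1) (inj₂ Y≡1) (yes _)   = balanced (cong₂ _⊕_ Z≡1 Y≡1)
    cases (inj₁ Z≡0) (inj₂ Y≡1) (yes K-x) = C-intro 8 (suc r) (inj₁ refl) (inj₂ 10≤r) 8+2r≡k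
      (cover-R₈+Q q Y₀≡1 K≡0 x Z≡0 Y≡1 K-x)
    cases (inj₂ Z≡1) (inj₁ Y≡0) (yes K-x) = ⊥-elim (χ≢t λ { 0F → Z≡1 ; 1F → Y≡0 ; (suc (suc i)) → K-x i })

  separation : Separation H (C (28 ℕ.+ toℕ j)) 6
  separation = record
    { χ = χ ; section = section ; χ-section = χ-section ; t = t ; ⇒≢t = ⇒≢t ; ≢t⇒ = ≢t⇒
    ; χ-character = λ { 0F → Z-character ; 1F → Y-character 0F ; (suc (suc i)) → K-character i }
    }

module Odd (j : Fin 4) (j-odd : parity (12 ℕ.+ toℕ j) ≡ 1ℙ) where

  χ : Fin 5 → |H| → Parity
  χ 0F      x = Z x ⊕ Y 0F x
  χ (suc i) x = K i x

  section : (Fin 5 → Parity) → |H|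
  section p = representative 0ℙ (p 0F) (quad (unquad λ i → p (suc i)))

  χ-section : ∀ p i → χ i (section p) ≡ p i
  χ-section p = λ where
      0F      → cong₂ _⊕_ (proj₁ values) (proj₁ (proj₂ values))
      (suc i) → trans (proj₂ (proj₂ values) i) (quad-unquad (λ i → p (suc i)) i)
    where values = representative-characters 0ℙ (p 0F) (unquad λ i → p (suc i))

  ⇒≢0 : ∀ x → C (28 ℕ.+ toℕ j) x → ¬ (∀ i → χ i x ≡ 0ℙ)
  ⇒≢0 x x∈ χ≡0 =
    [ (λ e → 1≢0 (trans (sym j-odd) (trans (sym e) (χ≡0 0F))))
    , (λ e → 1≢0 (trans (sym j-odd) (proj₂ e)))
    ]′ (C-constraint (28 ℕ.+ toℕ j) x (28+j≤31 j) x∈ (λ i → χ≡0 (suc i)))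

  -- For odd k the sumset R_{k-16} + Q_8 alone reaches every class outside the common kernel.
  ≢0⇒ : ∀ x → ¬ (∀ i → χ i x ≡ 0ℙ) → C (28 ℕ.+ toℕ j) x
  ≢0⇒ x χ≢0 = C-intro₈ j x λ s → χ≢0 λ
    { 0F      → ℙ.+-cancelʳ-≡ (parity (12 ℕ.+ toℕ j)) (Z x ⊕ Y 0F x) 0ℙ (trans (proj₁ s) (sym j-odd))
    ; (suc i) → proj₂ s i
    }

  separation : Separation H (C (28 ℕ.+ toℕ j)) 5
  separation = record
    { χ = χ ; section = section ; χ-section = χ-section ; t = λ _ → 0ℙ ; ⇒≢t = ⇒≢0 ; ≢t⇒ = ≢0⇒
    ; χ-character = λ { 0F → ⊕-character {H} Z-character (Y-character 0F) ; (suc i) → K-character i }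
    }

separation₂₈ : Separation H (C 28) 6
-- `Even` takes the predecessor of the total of f: 9 stands for Q_10, and below 10 for Q_11.
separation₂₈ = Even.separation 0F refl 9 ℕₚ.≤-refl refl
  (Q₁₀-row.witness (proj₁ Q₁₀-table)) (proj₁ (proj₂ Q₁₀-table)) (proj₂ (proj₂ Q₁₀-table))

separation₃₀ : Separation H (C 30) 6
separation₃₀ = Even.separation 2F refl 10 (ℕₚ.n≤1+n 10) refl
  (Q₁₁-row.witness (proj₁ Q₁₁-table)) (proj₁ (proj₂ Q₁₁-table)) (proj₂ (proj₂ Q₁₁-table))

separation₂₉ : Separation H (C 29) 5
separation₂₉ = Odd.separation 1F refl

separation₃₁ : Separation H (C 31) 5
separation₃₁ = Odd.separation 3F refl

conclusion : ∀ {k n} → Separation H (C k) n →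
  ∃[ t ] OmitsExactly k t × (∀ m (m⊥6 : Coprime m (+ 6)) →
    Represented k m m⊥6 ⇔ (¬ (H/P._≈_ k (π k (c m m⊥6)) t) ⊎ UsefulMove k m))
conclusion separation = Criterion.omitted separation , Criterion.omits-exactly separation , Criterion.criterion separation

isomorphism : ∀ {k n} → Separation H (C k) n → H/P k ≅ (C₂^ n)
isomorphism separation = Criterion.isomorphism separation

corollary5p5 : (∀ k → k ∈ 28 ∷ 30 ∷ [] → H/P k ≅ (C₂^ 6))
    × (∀ k → k ∈ 29 ∷ 31 ∷ [] → H/P k ≅ (C₂^ 5))
    × (∀ k → k ∈ 28 ∷ 29 ∷ 30 ∷ 31 ∷ [] →
    ∃[ t ] OmitsExactly k t
    × (∀ m (m⊥6 : Coprime m (+ 6)) →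
    Represented k m m⊥6
    ⇔ (¬ (H/P._≈_ k (π k (c m m⊥6)) t) ⊎ UsefulMove k m)))
corollary5p5 =
    (λ { _ (here refl) → isomorphism separation₂₈ ; _ (there (here refl)) → isomorphism separation₃₀ })
  , (λ { _ (here refl) → isomorphism separation₂₉ ; _ (there (here refl)) → isomorphism separation₃₁ })
  , (λ { _ (here refl)                         → conclusion separation₂₈
       ; _ (there (here refl))                 → conclusion separation₂₉
       ; _ (there (there (here refl)))         → conclusion separation₃₀
       ; _ (there (there (there (here refl)))) → conclusion separation₃₁ })
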